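{- A signed colored graph satisfies Axioms 1, 2, 3, $4^+$, and 5 if and only if it is a dual equivalence graph.
   Context: Tableaux are in French notation; the row reading word reads rows left to right starting from the top row. For $w\in S_n$, $\sigma(w)_i=+1$ if $i$ precedes $i+1$ in $w$, else $-1$; a tableau's signature is that of its row reading word. For $1<i<n$, $d_i$ fixes $w$ if $i$ lies positionally between $i-1$ and $i+1$, otherwise swaps $i$ with whichever of $i\pm1$ is not in the middle of the three positions; it acts on standard tableaux via row reading words. $\mathcal G_\lambda$ ($\lambda\vdash n$) has vertices $\mathrm{SYT}(\lambda)$, tableau signatures, and $i$-edges $\{T,d_i(T)\}$, $d_i(T)\ne T$, $1<i<n$. A signed colored graph $(V,\sigma,E_{m+1}\cup\dots\cup E_{n-1})$: a finite set $V$, for each $m<i<n$ ($m,n$ positive integers) a set $E_i$ of unordered pairs of distinct vertices, and $\sigma\colon V\to\{\pm1\}^{N-1}$, $N\ge n$. An edge colored graph is the same without $\sigma$; an isomorphism of edge colored graphs is a bijection on vertices preserving $i$-edges in both directions. A vertex $v$ admits an $i$-neighbor if $\sigma(v)_{i-1}=-\sigma(v)_i$. Axioms: (Ax1) for $m<i<n$, $E_i$ is a complete matching on the vertices admitting an $i$-neighbor; (Ax2) if $\{v,w\}\in E_i$ then $\sigma(v)_i=-\sigma(w)_i$, $\sigma(v)_{i-1}=-\sigma(w)_{i-1}$, and $\sigma(v)_h=\sigma(w)_h$ for $h<i-2$ and $h>i+1$; (Ax3) for $\{v,w\}\in E_i$: if $\sigma_{i-2}$ is defined then $v$ or $w$ admits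 an $(i-1)$-neighbor; if $\sigma_{i+1}$ is defined then $v$ or $w$ admits an $(i+1)$-neighbor; (Ax4) for $m+1<i<n$, each connected component of the edge colored graph $(V,E_{i-2}\cup E_{i-1}\cup E_i)$ is isomorphic to a component of $(V',E'_{i-2}\cup E'_{i-1}\cup E'_i)$ for some $\mathcal G_\lambda=(V',\sigma',E')$ ($E_{i-2}$ omitted if $i=m+2$); (Ax$4^+$) for $m+1<i<n$, each connected component of the edge colored graph $(V,E_{i-3}\cup E_{i-2}\cup E_{i-1}\cup E_i)$ is isomorphic to a component of $(V',E'_{i-3}\cup E'_{i-2}\cup E'_{i-1}\cup E'_i)$ for some $\mathcal G_\lambda=(V',\sigma',E')$, where $E_{i-3}$ is omitted if $i\le m+3$ and $E_{i-2}$ is omitted if $i\le m+2$; (Ax5) if $|i-j|>2$, $\{v,w\}\in E_i$, $\{w,x\}\in E_j$, then some $y$ has $\{v,y\}\in E_j$ and $\{x,y\}\in E_i$; (Ax6) for $m<i<n$, any two vertices in one connected component of $(V,\sigma,E_{m+1}\cup\dots\cup E_i)$ are joined by a path using at most one edge of $E_i$. A dual equivalence graph is a signed colored graph satisfying Axioms 1–6. -}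

module Defs where

open import Data.Nat using (ℕ; zero; suc; _+_; _∸_; _≤_; _<_; ∣_-_∣; _≡ᵇ_; _<ᵇ_)
open import Data.Bool using (Bool; true; false; if_then_else_; _∧_; _∨_)
open import Data.Fin using (Fin)
open import Data.List using (List; []; _∷_; map; concat; reverse; length; upTo)
open import Data.Nat.ListAction using (sum)
open import Data.List.Relation.Binary.Permutation.Propositional using (_↭_)
open import Data.Maybe using (Maybe; just; nothing)
open import Data.Product using (Σ; ∃; ∃-syntax; _×_; _,_)
open import Data.Sum using (_⊎_)
open import Relation.Nullary using (¬_)
open import Relation.Binary.PropositionalEquality using (_≡_)
open import Relation.Binary.Construct.Closure.ReflexiveTransitive using (Star)
open import Function.Bundles using (_⇔_)

data Sgn : Set where
  plus minus : Sgn

negS : Sgn → Sgn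
negS plus  = minus
negS minus = plus

-- Signed colored graphs (V = Fin size).
-- σ v h is meaningful for 1 ≤ h < N (indices 1..N-1); other values are junk
-- and are never referenced by the axioms.
-- E i is a set of unordered pairs of distinct vertices (symmetric,
-- irreflexive Bool relation), nonempty only for m < i < n.

record SCG : Set where
  field
    m n N size : ℕ
    m-pos   : 1 ≤ m
    n-pos   : 1 ≤ n
    n≤N     : n ≤ N
    σ       : Fin size → ℕ → Sgn
    E       : ℕ → Fin size → Fin size → Bool
    E-sym   : ∀ i v w → E i v w ≡ E i w v
    E-irr   : ∀ i v → E i v v ≡ false
    E-range : ∀ i v w → E i v w ≡ true → (m < i) × (i < n)

module _ (G : SCG) where
  open SCG G

  V : Set
  V = Fin size

  Edge : ℕ → V → V → Set
  Edge i v w = E i v w ≡ true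

  Defd : ℕ → Set
  Defd h = (1 ≤ h) × (h < N)

  Admits : ℕ → V → Set
  Admits i v = σ v (i ∸ 1) ≡ negS (σ v i)

  InRange : ℕ → Set
  InRange i = (m < i) × (i < n)

  Conn : (ℕ → Set) → V → V → Set
  Conn C = Star (λ x y → Σ ℕ (λ j → C j × Edge j x y))

  Ax1 : Set
  Ax1 = ∀ i → InRange i →
          (∀ v → Admits i v ⇔ (∃[ w ] Edge i v w))
        × (∀ v w w' → Edge i v w → Edge i v w' → w ≡ w')

  Ax2 : Set
  Ax2 = ∀ i v w → Edge i v w →
          (σ v i ≡ negS (σ w i))
        × (σ v (i ∸ 1) ≡ negS (σ w (i ∸ 1)))
        × (∀ h → Defd h → (h + 2 < i ⊎ i + 1 < h) → σ v h ≡ σ w h)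

  Ax3 : Set
  Ax3 = ∀ i v w → Edge i v w →
          (Defd (i ∸ 2) → Admits (i ∸ 1) v ⊎ Admits (i ∸ 1) w)
        × (Defd (i + 1) → Admits (i + 1) v ⊎ Admits (i + 1) w)

  Ax5 : Set
  Ax5 = ∀ i j v w x → 2 < ∣ i - j ∣ → Edge i v w → Edge j w x →
          ∃[ y ] (Edge j v y × Edge i x y)

  Below : ℕ → ℕ → Set
  Below i j = (m < j) × (j < i)

  Ax6 : Set
  Ax6 = ∀ i → InRange i → ∀ v w →
          Conn (λ j → (m < j) × (j ≤ i)) v w →
          ∃[ a ] ∃[ b ] (Conn (Below i) v a × (a ≡ b ⊎ Edge i a b) × Conn (Below i) b w)

-- Partitions and standard Young tableaux (French notation).
-- A tableau is a list of rows, row 0 being the bottom (longest) row.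

data Decr : List ℕ → Set where
  []  : Decr []
  [_] : ∀ a → Decr (a ∷ [])
  _∷_ : ∀ {a b l} → b ≤ a → Decr (b ∷ l) → Decr (a ∷ b ∷ l)

data AllPos : List ℕ → Set where
  []  : AllPos []
  _∷_ : ∀ {a l} → 1 ≤ a → AllPos l → AllPos (a ∷ l)

IsPartition : List ℕ → Set
IsPartition λ′ = Decr λ′ × AllPos λ′

Tab : Set
Tab = List (List ℕ)

at : {A : Set} → List A → ℕ → Maybe A
at []       _       = nothing
at (x ∷ xs) zero    = just x
at (x ∷ xs) (suc k) = at xs k

entry : Tab → ℕ → ℕ → Maybe ℕ
entry T r c with at T r
... | nothing  = nothing
... | just row = at row c

readingWord : Tab → List ℕ
readingWord T = concat (reverse T)

IsSYT : List ℕ → Tab → Set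
IsSYT λ′ T =
    (map length T ≡ λ′)
  × (∀ r c a b → entry T r c ≡ just a → entry T r (suc c) ≡ just b → a < b)
  × (∀ r c a b → entry T r c ≡ just a → entry T (suc r) c ≡ just b → a < b)
  × (readingWord T ↭ map suc (upTo (sum λ′)))

pos : ℕ → List ℕ → ℕ
pos a []       = 0
pos a (x ∷ xs) = if a ≡ᵇ x then 0 else suc (pos a xs)

between : ℕ → ℕ → ℕ → Bool
between x y z = ((x <ᵇ y) ∧ (y <ᵇ z)) ∨ ((z <ᵇ y) ∧ (y <ᵇ x))

swapV : ℕ → ℕ → ℕ → ℕ
swapV a b x = if x ≡ᵇ a then b else (if x ≡ᵇ b then a else x)

-- the value permutation effected by the elementary dual equivalence d_i on w
dVal : ℕ → List ℕ → ℕ → ℕ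
dVal i w =
  let p = pos (i ∸ 1) w ; q = pos i w ; r = pos (i + 1) w in
  if between p q r then (λ x → x)
  else (if between q p r then swapV i (i + 1) else swapV (i ∸ 1) i)

dWord : ℕ → List ℕ → List ℕ
dWord i w = map (dVal i w) w

dTab : ℕ → Tab → Tab
dTab i T = map (map (dVal i (readingWord T))) T

GEdge₀ : List ℕ → ℕ → Tab → Tab → Set
GEdge₀ λ′ i T U = (1 < i) × (i < sum λ′) × IsSYT λ′ T × IsSYT λ′ U
                 × (U ≡ dTab i T) × ¬ (U ≡ T)

GEdge : List ℕ → ℕ → Tab → Tab → Set
GEdge λ′ i T U = GEdge₀ λ′ i T U ⊎ GEdge₀ λ′ i U T

GConn : List ℕ → (ℕ → Set) → Tab → Tab → Set
GConn λ′ C = Star (λ x y → Σ ℕ (λ j → C j × GEdge λ′ j x y))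

module _ (G : SCG) where
  open SCG G

  -- the component of v0 in (V, ⋃_{C j} E_j) is isomorphic, as an edge
  -- colored graph with colors C, to a component of (SYT λ, ⋃_{C j} E'_j)
  CompIso : (ℕ → Set) → Fin size → Set
  CompIso C v0 =
    ∃[ λ′ ] ∃[ T0 ] IsPartition λ′ × IsSYT λ′ T0 ×
    (Σ (Fin size → Tab) λ f → Σ (Tab → Fin size) λ g →
        (∀ v → Conn G C v0 v → GConn λ′ C T0 (f v) × g (f v) ≡ v)
      × (∀ T → GConn λ′ C T0 T → Conn G C v0 (g T) × f (g T) ≡ T)
      × (∀ j v w → C j → Conn G C v0 v → Conn G C v0 w →
           Edge G j v w ⇔ GEdge λ′ j (f v) (f w)))

  Cols4 : ℕ → ℕ → Set
  Cols4 i j = (m < j) × (i ≤ j + 2) × (j ≤ i)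

  Cols4⁺ : ℕ → ℕ → Set
  Cols4⁺ i j = (m < j) × (i ≤ j + 3) × (j ≤ i)

  Ax4 : Set
  Ax4 = ∀ i → suc m < i → i < n → ∀ v0 → CompIso (Cols4 i) v0

  Ax4⁺ : Set
  Ax4⁺ = ∀ i → suc m < i → i < n → ∀ v0 → CompIso (Cols4⁺ i) v0

IsDEG : SCG → Set
IsDEG G = Ax1 G × Ax2 G × Ax3 G × Ax4 G × Ax5 G × Ax6 G

{-# OPTIONS --safe #-}
module Submission where

-- A standard tableau is encoded by the word of contents of its cells in order of their letters; the elementary dual
-- equivalences act on such words by comparing three consecutive contents, and two words are connected by them exactly
-- when they have the same shape.  By induction on i, the vertices of the graph are mapped to content words compatibly
-- with signatures and with the colours m + 1, …, i.  The next content is read off from the sign σ_{i+1} on a component,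
-- which by Axiom 3 is monotone on the corners of the shape; Axioms 2, 3, 4 and 5 then force E_{i+1} to act as on words.
-- This map is a covering.  Given Axiom 6 it is injective on components, so the components are those of genuine tableaux
-- and Axiom 4⁺ holds.  Conversely, given Axiom 4⁺, the component obtained from a lower component by moving the last
-- letter between two corners is unique, and for three corners the moves close up to a triangle, since six letters
-- forming the shape (3,2,1) can be placed at and between the corners; hence one E_{i+1}-edge always suffices.

-- The isomorphisms of Axioms 4 and 4⁺ ignore signatures and concern unrelated partitions at
-- different vertices, so they cannot be glued. Only three finite consequences are extracted from
-- them: `Double` on four letters, `Square` on five, and the closing of `loop` on six. Each is
-- verified by evaluation on all permutations; this is possible because an elementary dual
-- equivalence compares positions in a reading word by the same rule `dd` by which it compares
-- contents. The walk `loop` needs six letters, hence four consecutive colours, and this is where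
-- the extra colour of Axiom 4⁺ enters. Both implications run one induction, `Build`, whose only
-- varying input is `link`, an instance of Axiom 6 for each colour. That instance is only required
-- for a map already known to be injective one level below, so one implication can prove it in the
-- course of the induction while the other takes it from Axiom 6.

open import Defs
open import Data.Bool using (Bool; true; false; if_then_else_; _∧_; _∨_; not)
open import Data.Bool.ListAction using (all)
open import Data.Bool.Properties using (T-≡; ∨-zeroʳ; ∨-comm; ∧-zeroʳ; ¬-not)
open import Data.Empty using (⊥; ⊥-elim)
open import Data.Fin using (Fin)
open import Data.Fin.Properties using (any?)
open import Data.List using (List; []; _∷_; map; length; _++_; concat; reverse; upTo; _∷ʳ_; concatMap; applyUpTo)
open import Data.List.Membership.Propositional using (_∈_; _∉_)
open import Data.List.Membership.Propositional.Properties using (∈-∃++; ∈-map⁺; ∈-map⁻; ∈-upTo⁺; ∈-upTo⁻; ∈-++⁺ˡ; ∈-++⁺ʳ; ∈-++⁻; ∈-concatMap⁺)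
open import Data.List.Properties using (length-++; unfold-reverse; concat-++; concat-map; reverse-map; map-∘; length-map; map-cong; map-id; ++-identityʳ; map-cong-local; ∷-injective; map-++; upTo-∷ʳ; ++-assoc; length-upTo; ≡-dec)
open import Data.List.Relation.Binary.Permutation.Propositional using (_↭_; ↭⇒↭ₛ; ↭-sym; ↭-trans; prep; swap; ↭-refl; ↭-reflexive)
open import Data.List.Relation.Binary.Permutation.Propositional.Properties using (∈-resp-↭; shift; ↭-length; ++⁺ʳ; ∷↭∷ʳ) renaming (map⁺ to ↭-map⁺)
open import Data.List.Relation.Unary.All using (All; []; _∷_)
open import Data.List.Relation.Unary.AllPairs using ([]; _∷_; AllPairs)
open import Data.List.Relation.Unary.Any using (here; there)
open import Data.List.Relation.Unary.Linked using (Linked; [-]; _∷_)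
open import Data.List.Relation.Unary.Linked.Properties using (Linked⇒AllPairs)
open import Data.List.Relation.Unary.Unique.Propositional using (Unique)
open import Data.Maybe using (Maybe; just)
open import Data.Nat using (ℕ; zero; suc; _+_; _∸_; _≤_; _<_; z≤n; s≤s; _≡ᵇ_; _<ᵇ_; _≤ᵇ_; _≟_; _≤?_; _<?_; ∣_-_∣)
open import Data.Nat.ListAction using (sum)
open import Data.Nat.Properties
open import Data.Product using (∃; ∃-syntax; _×_; _,_; proj₁; proj₂)
open import Data.Sum using (_⊎_; inj₁; inj₂)
open import Function using (_∘_; case_of_)
open import Function.Bundles using (Equivalence; _⇔_; mk⇔)
open import Relation.Binary.Construct.Closure.ReflexiveTransitive using (ε; _◅_; _◅◅_)
open import Relation.Binary.Definitions using (tri<; tri≈; tri>)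
open import Relation.Binary.PropositionalEquality
open import Relation.Nullary using (¬_; Dec; yes; no)
open import Data.List.Membership.DecPropositional _≟_ using () renaming (_∈?_ to mem?)
import Data.List.Relation.Unary.All as All
import Data.List.Relation.Unary.All.Properties as AllP
import Data.List.Relation.Unary.Unique.Propositional.Properties as UniqueP
import Data.List.Relation.Binary.Permutation.Setoid.Properties as PermS
import Data.Maybe as Maybe
import Data.List.Relation.Unary.Any as Any
import Data.Bool.Properties as Bool

-- Content words and shapes

true≢false : ∀ {b : Bool} → b ≡ true → b ≡ false → ⊥
true≢false refl ()

<ᵇ-true : ∀ {a b} → a < b → (a <ᵇ b) ≡ true
<ᵇ-true {a} {b} a<b = Equivalence.to T-≡ (<⇒<ᵇ a<b)

<ᵇ-false : ∀ {a b} → b ≤ a → (a <ᵇ b) ≡ false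
<ᵇ-false {a} {b} b≤a = ¬-not λ e → <⇒≱ (<ᵇ⇒< a b (Equivalence.from T-≡ e)) b≤a

<ᵇ-true⁻¹ : ∀ {a b} → (a <ᵇ b) ≡ true → a < b
<ᵇ-true⁻¹ {a} {b} e = <ᵇ⇒< a b (Equivalence.from T-≡ e)

≡ᵇ-refl : ∀ n → (n ≡ᵇ n) ≡ true
≡ᵇ-refl n = Equivalence.to T-≡ (≡⇒≡ᵇ n n refl)

≡ᵇ-false : ∀ {m n} → m ≢ n → (m ≡ᵇ n) ≡ false
≡ᵇ-false {m} {n} m≢n = ¬-not λ e → m≢n (≡ᵇ⇒≡ m n (Equivalence.from T-≡ e))

Btw : ℕ → ℕ → ℕ → Set
Btw a b c = (a < b × b < c) ⊎ (c < b × b < a)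

btw-sym : ∀ {a b c} → Btw a b c → Btw c b a
btw-sym (inj₁ p) = inj₂ p
btw-sym (inj₂ p) = inj₁ p

btw-true : ∀ {x y z} → Btw x y z → between x y z ≡ true
btw-true (inj₁ (p , q)) rewrite <ᵇ-true p | <ᵇ-true q = refl
btw-true (inj₂ (p , q)) rewrite <ᵇ-true p | <ᵇ-true q = ∨-zeroʳ _

btw-excl : ∀ {x y z} → Btw x y z → between y x z ≡ false
btw-excl (inj₁ (p , q)) rewrite <ᵇ-false (<⇒≤ p) | <ᵇ-false (<⇒≤ (<-trans p q)) = refl
btw-excl {x} {y} {z} (inj₂ (p , q)) rewrite <ᵇ-false (<⇒≤ (<-trans p q)) | <ᵇ-false (<⇒≤ q)
  | ∧-zeroʳ (y <ᵇ x) = ∧-zeroʳ _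

between-sym : ∀ x y z → between x y z ≡ between z y x
between-sym x y z = ∨-comm ((x <ᵇ y) ∧ (y <ᵇ z)) _

btw-excl₃ : ∀ {x y z} → Btw x y z → between x z y ≡ false
btw-excl₃ {x} {y} {z} b = trans (between-sym x z y) (btw-excl (btw-sym b))

btw-apart : ∀ {y x z} → Btw y x z → (y ≢ z) × (suc y ≢ z) × (suc z ≢ y)
btw-apart (inj₁ (p , q)) =
  (λ { refl → <-asym p q }) , (λ { refl → <⇒≱ q p }) , (λ { refl → <-asym (<-trans p q) (n<1+n _) })
btw-apart (inj₂ (p , q)) =
  (λ { refl → <-asym p q }) , (λ { refl → <-asym (<-trans p q) (n<1+n _) }) , (λ { refl → <⇒≱ q p })

btw-tri : ∀ {x y z} → x ≢ y → y ≢ z → x ≢ z → Btw x y z ⊎ Btw y x z ⊎ Btw x z y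
btw-tri {x} {y} {z} xy yz xz with <-cmp x y | <-cmp y z | <-cmp x z
... | tri≈ _ e _ | _ | _ = ⊥-elim (xy e)
... | _ | tri≈ _ e _ | _ = ⊥-elim (yz e)
... | _ | _ | tri≈ _ e _ = ⊥-elim (xz e)
... | tri< a _ _ | tri< b _ _ | _ = inj₁ (inj₁ (a , b))
... | tri> _ _ a | tri> _ _ b | _ = inj₁ (inj₂ (b , a))
... | tri< a _ _ | tri> _ _ b | tri< c _ _ = inj₂ (inj₂ (inj₁ (c , b)))
... | tri< a _ _ | tri> _ _ b | tri> _ _ c = inj₂ (inj₁ (inj₂ (c , a)))
... | tri> _ _ a | tri< b _ _ | tri< c _ _ = inj₂ (inj₁ (inj₁ (a , c)))
... | tri> _ _ a | tri< b _ _ | tri> _ _ c = inj₂ (inj₂ (inj₂ (b , c)))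

-- Words list the contents of the cells of a tableau from the last letter to the first; dd t is the elementary
-- dual equivalence on the letters at depths t, t + 1, t + 2.
dd₃ : ℕ → ℕ → ℕ → List ℕ → List ℕ
dd₃ z y x u = if between x y z then z ∷ y ∷ x ∷ u
              else (if between y x z then y ∷ z ∷ x ∷ u else z ∷ x ∷ y ∷ u)

dd : ℕ → List ℕ → List ℕ
dd zero    (z ∷ y ∷ x ∷ u) = dd₃ z y x u
dd zero    w               = w
dd (suc t) []              = []
dd (suc t) (c ∷ w)         = c ∷ dd t w

dd-y : ∀ {z y x} u → Btw x y z → dd₃ z y x u ≡ z ∷ y ∷ x ∷ u
dd-y u b rewrite btw-true b = refl

dd-x : ∀ {z y x} u → Btw y x z → dd₃ z y x u ≡ y ∷ z ∷ x ∷ u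
dd-x u b rewrite btw-excl b | btw-true b = refl

dd-z : ∀ {z y x} u → Btw x z y → dd₃ z y x u ≡ z ∷ x ∷ y ∷ u
dd-z {z} {y} {x} u b
  rewrite btw-excl₃ {x} {z} {y} b | btw-excl₃ {y} {z} {x} (btw-sym b) = refl

run : List ℕ → List ℕ → List ℕ
run []       w = w
run (t ∷ ts) w = run ts (dd t w)

run-++ : ∀ ts ts' w → run (ts ++ ts') w ≡ run ts' (run ts w)
run-++ []       ts' w = refl
run-++ (t ∷ ts) ts' w = run-++ ts ts' (dd t w)

run-suc : ∀ ts c w → run (map suc ts) (c ∷ w) ≡ c ∷ run ts w
run-suc []       c w = refl
run-suc (t ∷ ts) c w = run-suc ts c (dd t w)

length-dd : ∀ t w → length (dd t w) ≡ length w
length-dd zero    []              = refl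
length-dd zero    (_ ∷ [])        = refl
length-dd zero    (_ ∷ _ ∷ [])    = refl
length-dd zero    (z ∷ y ∷ x ∷ u) with between x y z | between y x z
... | true  | _     = refl
... | false | true  = refl
... | false | false = refl
length-dd (suc t) []              = refl
length-dd (suc t) (c ∷ w)         = cong suc (length-dd t w)

sgn : ℕ → ℕ → Sgn
sgn y z = if y <ᵇ z then plus else minus

signAt : ℕ → List ℕ → Sgn
signAt zero    (z ∷ y ∷ _) = sgn y z
signAt zero    _           = plus
signAt (suc t) []          = plus
signAt (suc t) (c ∷ w)     = signAt t w

sgn-plus : ∀ {y z} → y < z → sgn y z ≡ plus
sgn-plus p rewrite <ᵇ-true p = refl

sgn-minus : ∀ {y z} → z ≤ y → sgn y z ≡ minus
sgn-minus p rewrite <ᵇ-false p = refl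

sgn-plus⁻¹ : ∀ {y z} → sgn y z ≡ plus → y < z
sgn-plus⁻¹ {y} {z} e with y <? z
... | yes p = p
... | no ¬p with trans (sym e) (sgn-minus (≮⇒≥ ¬p))
... | ()

-- A shape is encoded by its boundary: position p carries `true` for one of the two
-- kinds of unit steps.  A cell of content c can be added when the steps at c, c+1
-- read true, false, and adding it exchanges them.
record Add (c : ℕ) (s : ℕ → Bool) : Set where
  constructor _,_
  field
    stepˡ : s c ≡ true
    stepʳ : s (suc c) ≡ false

record Rem (c : ℕ) (s : ℕ → Bool) : Set where
  constructor _,_
  field
    stepˡ : s c ≡ false
    stepʳ : s (suc c) ≡ true

opaque
  addc : ℕ → (ℕ → Bool) → ℕ → Bool
  addc c s p = if p ≡ᵇ c then false else (if p ≡ᵇ suc c then true else s p)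

  addc-at : ∀ c s → addc c s c ≡ false
  addc-at c s rewrite ≡ᵇ-refl c = refl

  addc-suc : ∀ c s → addc c s (suc c) ≡ true
  addc-suc c s rewrite ≡ᵇ-false {suc c} {c} (1+n≢n) | ≡ᵇ-refl c = refl

  addc-other : ∀ {c p} s → p ≢ c → p ≢ suc c → addc c s p ≡ s p
  addc-other s a b rewrite ≡ᵇ-false a | ≡ᵇ-false b = refl

  addc-cong : ∀ c {s s'} → s ≗ s' → addc c s ≗ addc c s'
  addc-cong c e p with p ≡ᵇ c | p ≡ᵇ suc c
  ... | true  | _     = refl
  ... | false | true  = refl
  ... | false | false = e p

add-cong : ∀ {c s s'} → s ≗ s' → Add c s → Add c s'
add-cong e (a , b) = trans (sym (e _)) a , trans (sym (e _)) b

rem-cong : ∀ {c s s'} → s ≗ s' → Rem c s → Rem c s'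
rem-cong e (a , b) = trans (sym (e _)) a , trans (sym (e _)) b

≗-sym : ∀ {s s' : ℕ → Bool} → s ≗ s' → s' ≗ s
≗-sym e p = sym (e p)

≗-trans : ∀ {s s' s'' : ℕ → Bool} → s ≗ s' → s' ≗ s'' → s ≗ s''
≗-trans e f p = trans (e p) (f p)

-- Adding a cell of content `y` changes the boundary steps at `y` and `y + 1`. The conditions make
-- the two pairs of steps disjoint, so that the additions commute.
Apart : ℕ → ℕ → Set
Apart y z = (y ≢ z) × (suc y ≢ z) × (suc z ≢ y)

apart-sym : ∀ {y z} → Apart y z → Apart z y
apart-sym (a , b , c) = a ∘ sym , c , b

addc-comm : ∀ {y z} s → Apart y z → addc z (addc y s) ≗ addc y (addc z s)
addc-comm {y} {z} s (yz , syz , szy) p with p ≟ z | p ≟ suc z | p ≟ y | p ≟ suc y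
... | yes refl | _ | yes refl | _ = ⊥-elim (yz refl)
... | yes refl | _ | _ | yes refl = ⊥-elim (syz refl)
... | _ | yes refl | yes refl | _ = ⊥-elim (szy refl)
... | _ | yes refl | _ | yes refl = ⊥-elim (yz refl)
... | yes refl | _ | no a | no b = trans (addc-at p (addc y s)) (sym (trans (addc-other (addc p s) a b) (addc-at p s)))
... | no _ | yes refl | no a | no b = trans (addc-suc z (addc y s)) (sym (trans (addc-other (addc z s) a b) (addc-suc z s)))
... | no a | no b | yes refl | _ = trans (trans (addc-other (addc p s) a b) (addc-at p s)) (sym (addc-at p (addc z s)))
... | no a | no b | no _ | yes refl = trans (trans (addc-other (addc y s) a b) (addc-suc y s)) (sym (addc-suc y (addc z s)))
... | no a | no b | no c | no d =
  trans (trans (addc-other (addc y s) a b) (addc-other s c d)) (sym (trans (addc-other (addc z s) c d) (addc-other s a b)))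

add-swap₁ : ∀ {y z s} → Add z (addc y s) → Apart y z → Add z s
add-swap₁ {y} {z} {s} (a , b) (yz , syz , szy) =
  trans (sym (addc-other s (yz ∘ sym) (syz ∘ sym))) a ,
  trans (sym (addc-other s szy (yz ∘ sym ∘ suc-injective))) b

add-swap₂ : ∀ {y z s} → Add y s → Apart y z → Add y (addc z s)
add-swap₂ {y} {z} {s} (a , b) (yz , syz , szy) =
  trans (addc-other s yz (szy ∘ sym)) a ,
  trans (addc-other s syz (yz ∘ suc-injective)) b

-- Corners of neighbouring contents would share a boundary step, which one of them needs `true` and
-- the other `false`.
rem-apart : ∀ {a b s} → Rem a s → Rem b s → a ≢ b → Apart a b
rem-apart (p , q) (p' , q') ne = ne , (λ { refl → true≢false q p' }) , (λ { refl → true≢false q' p })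

rem-addc⁻¹ : ∀ {a b s} → Rem a (addc b s) → a ≢ b → Rem a s
rem-addc⁻¹ {a} {b} {s} (p , q) ne =
  trans (sym (addc-other s ne λ { refl → true≢false (addc-suc b s) p })) p ,
  trans (sym (addc-other s (λ { refl → true≢false q (addc-at (suc a) s) }) (ne ∘ suc-injective))) q

rem-addc : ∀ {b} s → Rem b (addc b s)
rem-addc {b} s = addc-at b s , addc-suc b s

add≢rem : ∀ {c s} → Add c s → ¬ Rem c s
add≢rem (a , _) (b , _) = true≢false a b

private
  ivt : ∀ (s : ℕ → Bool) (b b' : Bool) → (∀ x → s x ≡ b ⊎ s x ≡ b') → ∀ p d → s p ≡ b → s (d + p) ≡ b' → b ≢ b' →
        ∃[ c ] (p ≤ c) × (c < d + p) × s c ≡ b × s (suc c) ≡ b'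
  ivt s b b' dec p zero e e' ne = ⊥-elim (ne (trans (sym e) e'))
  ivt s b b' dec p (suc d) e e' ne with dec (d + p)
  ... | inj₁ x = d + p , m≤n+m p d , ≤-refl , x , e'
  ... | inj₂ x with ivt s b b' dec p d e x ne
  ... | c , l , r , u , v = c , l , m≤n⇒m≤1+n r , u , v

bool-dec : ∀ b → b ≡ true ⊎ b ≡ false
bool-dec true = inj₁ refl
bool-dec false = inj₂ refl

bool-dec' : ∀ b → b ≡ false ⊎ b ≡ true
bool-dec' true = inj₂ refl
bool-dec' false = inj₁ refl

rem-between : ∀ {s p q} → s p ≡ false → s q ≡ true → p ≤ q → ∃[ c ] (p ≤ c) × (c < q) × Rem c s
rem-between {s} {p} {q} e e' l with ivt s false true (bool-dec' ∘ s) p (q ∸ p) e (subst (λ x → s x ≡ true) (sym (m∸n+n≡m l)) e') (λ ())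
... | c , a , b , u , v = c , a , subst (c <_) (m∸n+n≡m l) b , u , v

gap : ∀ {s a b} → Add a s → Add b s → a < b → ∃[ z ] (a < z) × (z < b) × Rem z s
gap (_ , e) (e' , _) l = rem-between e e' l

gap-btw : ∀ {s a b} → Add a s → Add b s → a ≢ b → ∃[ z ] Btw a z b × Rem z s
gap-btw {s} {a} {b} A B ne with <-cmp a b
... | tri≈ _ e _ = ⊥-elim (ne e)
... | tri< l _ _ = let z , p , q , r = gap A B l in z , inj₁ (p , q) , r
... | tri> _ _ l = let z , p , q , r = gap B A l in z , inj₂ (p , q) , r

-- Addable and removable corners alternate along the boundary, so comparisons with the removable
-- corners pin down an addable one. This is how signs, which only compare contents, determine the
-- contents themselves.
add-separated : ∀ {s c c'} → Add c s → Add c' s → (∀ x → Rem x s → x < c → x < c') → (∀ x → Rem x s → x < c' → x < c) → c ≡ c'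
add-separated {s} {c} {c'} A A' f g with <-cmp c c'
... | tri≈ _ e _ = e
... | tri< l _ _ = let z , p , q , r = gap A A' l in ⊥-elim (<-asym p (g z r q))
... | tri> _ _ l = let z , p , q , r = gap A' A l in ⊥-elim (<-asym p (f z r q))

-- Valid words, their corners, and connectivity of words of equal shape

module Words (M : ℕ) where

  sh : List ℕ → ℕ → Bool
  sh []      p = p ≤ᵇ M
  sh (c ∷ w)   = addc c (sh w)

  data Valid : List ℕ → Set where
    []  : Valid []
    _∷_ : ∀ {c w} → Add c (sh w) → Valid w → Valid (c ∷ w)

  vacuum-rem : ∀ {x} → ¬ Rem x (sh [])
  vacuum-rem {x} (a , b) = true≢false
    (Equivalence.to T-≡ (≤⇒≤ᵇ (≤-trans (n≤1+n x) (≤ᵇ⇒≤ (suc x) M (Equivalence.from T-≡ b))))) a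

  opaque
    -- Induction on the word: `x` is brought to the end of the tail and then exchanged with the last
    -- letter `a`. Both are removable from the whole shape, hence apart, so the exchanged word is
    -- valid.
    bring-last : ∀ w x → Valid w → Rem x (sh w) → ∃[ w' ] Valid (x ∷ w') × length w ≡ suc (length w') × sh (x ∷ w') ≗ sh w
    bring-last [] x v r = ⊥-elim (vacuum-rem r)
    bring-last (a ∷ t) x (A ∷ v) r with x ≟ a
    ... | yes refl = t , A ∷ v , refl , λ _ → refl
    ... | no ne with bring-last t x v (rem-addc⁻¹ r ne)
    ... | t' , X ∷ v' , len , e =
      a ∷ t' , add-swap₂ X ap ∷ (add-swap₁ A' ap ∷ v') , cong suc len ,
      ≗-trans (≗-sym (addc-comm (sh t') ap)) (addc-cong a e)
      where
      ap : Apart x a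
      ap = rem-apart r (rem-addc (sh t)) ne
      A' : Add a (sh (x ∷ t'))
      A' = add-cong (≗-sym e) A

    tail-≗ : ∀ {c w w'} → Valid (c ∷ w) → Valid (c ∷ w') → sh (c ∷ w) ≗ sh (c ∷ w') → sh w ≗ sh w'
    tail-≗ {c} {w} {w'} ((a , b) ∷ _) ((a' , b') ∷ _) e p with p ≟ c | p ≟ suc c
    ... | yes refl | _ = trans a (sym a')
    ... | no _ | yes refl = trans b (sym b')
    ... | no n | no n' = trans (sym (addc-other (sh w) n n')) (trans (e p) (addc-other (sh w') n n'))

    -- If the last letters `a` and `b` differ, removing both corners leaves a corner `z` between
    -- them, and `a ∷ b ∷ z ∷ t₂` and `b ∷ a ∷ z ∷ t₂` differ by one move at depth 0. Induction on
    -- the length joins each given word to the one of these with the same last letter.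
    same-shape-connected : ∀ w w' → Valid w → Valid w' → length w ≡ length w' → sh w ≗ sh w' → ∃[ ts ] run ts w ≡ w'
    same-shape-connected w = go (length w) w refl
      where
      go : ∀ n w → length w ≡ n → ∀ w' → Valid w → Valid w' → length w ≡ length w' → sh w ≗ sh w' → ∃[ ts ] run ts w ≡ w'
      go n [] _ [] v v' l e = [] , refl
      go (suc n) (a ∷ t) ln (b ∷ t') (A ∷ v) (B ∷ v') l e with a ≟ b
      ... | yes refl =
        let ts , q = go n t (suc-injective ln) t' v v' (suc-injective l) (tail-≗ (A ∷ v) (B ∷ v') e)
        in map suc ts , trans (run-suc ts a t) (cong (a ∷_) q)
      ... | no ne
        with bring-last t b v (rem-addc⁻¹ (rem-cong (≗-sym e) (rem-addc (sh t'))) (ne ∘ sym))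
      ... | t₁ , B₁ ∷ v₁ , l₁ , e₁
        with gap-btw B₁ (add-swap₁ (add-cong (≗-sym e₁) A) ap) (ne ∘ sym)
        where
        ap : Apart b a
        ap = rem-apart (rem-cong (≗-sym e) (rem-addc (sh t'))) (rem-addc (sh t)) (ne ∘ sym)
      ... | z , bt , rz with bring-last t₁ z v₁ rz
      ... | t₂ , vz , l₂ , e₂ =
        let ap : Apart b a
            ap = rem-apart (rem-cong (≗-sym e) (rem-addc (sh t'))) (rem-addc (sh t)) (ne ∘ sym)
            Ab : Add b (sh (z ∷ t₂))
            Ab = add-cong (≗-sym e₂) B₁
            eb : sh (b ∷ z ∷ t₂) ≗ sh t
            eb = ≗-trans (addc-cong b e₂) e₁
            Aa : Add a (sh (b ∷ z ∷ t₂))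
            Aa = add-cong (≗-sym eb) A
            lz : length t ≡ suc (suc (length t₂))
            lz = trans l₁ (cong suc l₂)
            ts₁ , q₁ = go n t (suc-injective ln) (b ∷ z ∷ t₂) v (Ab ∷ vz) lz (≗-sym eb)
            vb : Valid (b ∷ a ∷ z ∷ t₂)
            vb = add-swap₂ Ab ap ∷ (add-swap₁ Aa ap ∷ vz)
            ea : sh (a ∷ z ∷ t₂) ≗ sh t'
            ea = tail-≗ vb (B ∷ v') (≗-trans (≗-sym (addc-comm (sh (z ∷ t₂)) ap)) (≗-trans (addc-cong a eb) e))
            ts₂ , q₂ = go n (a ∷ z ∷ t₂) (trans (sym lz) (suc-injective ln)) t' (add-swap₁ Aa ap ∷ vz) v'
                          (trans (sym lz) (suc-injective l)) ea
        in map suc ts₁ ++ (0 ∷ map suc ts₂) ,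
           trans (run-++ (map suc ts₁) _ (a ∷ t))
           (trans (cong (run (0 ∷ map suc ts₂)) (trans (run-suc ts₁ a t) (cong (a ∷_) q₁)))
           (trans (cong (run (map suc ts₂)) (dd-x {a} {b} {z} t₂ bt))
           (trans (run-suc ts₂ b (a ∷ z ∷ t₂)) (cong (b ∷_) q₂))))

  -- Equal contents `x` and `z` would put two cells on one diagonal. Between their additions a cell
  -- of each neighbouring content must be added, and only the single letter `y` is available.
  distinct : ∀ {z y x u} → Valid (z ∷ y ∷ x ∷ u) → (x ≢ y) × (y ≢ z) × (x ≢ z)
  distinct {z} {y} {x} {u} (Z ∷ (Y ∷ (X ∷ v))) =
    (λ { refl → add≢rem Y (rem-addc (sh u)) }) ,
    (λ { refl → add≢rem Z (rem-addc (sh (x ∷ u))) }) ,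
    (third ∘ sym)
    where
    x≢y : x ≢ y
    x≢y refl = add≢rem Y (rem-addc (sh u))
    third : z ≡ x → ⊥
    third refl with z ≟ suc y
    ... | no a = true≢false (Add.stepˡ Z) (trans (addc-other (sh (z ∷ u)) x≢y a) (addc-at z (sh u)))
    ... | yes refl = true≢false (trans (addc-other (sh (z ∷ u)) (λ ()) 1+n≢n) (addc-suc z (sh u))) (Add.stepʳ Z)

  valid-tri : ∀ {z y x u} → Valid (z ∷ y ∷ x ∷ u) → Btw x y z ⊎ Btw y x z ⊎ Btw x z y
  valid-tri v = let a , b , c = distinct v in btw-tri a b c

  swap-valid : ∀ {z y u} → Valid (z ∷ y ∷ u) → Apart y z → Valid (y ∷ z ∷ u) × sh (y ∷ z ∷ u) ≗ sh (z ∷ y ∷ u)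
  swap-valid {z} {y} {u} (Z ∷ (Y ∷ v)) ap =
    (add-swap₂ Y ap ∷ (add-swap₁ Z ap ∷ v)) , addc-comm (sh u) (apart-sym ap)

  dd-valid : ∀ t {w} → Valid w → Valid (dd t w) × sh (dd t w) ≗ sh w
  dd-valid zero {[]} v = v , λ _ → refl
  dd-valid zero {_ ∷ []} v = v , λ _ → refl
  dd-valid zero {_ ∷ _ ∷ []} v = v , λ _ → refl
  dd-valid zero {z ∷ y ∷ x ∷ u} v with valid-tri v
  ... | inj₁ b rewrite dd-y u b = v , λ _ → refl
  ... | inj₂ (inj₁ b) rewrite dd-x u b = swap-valid v (btw-apart b)
  ... | inj₂ (inj₂ b) rewrite dd-z u b with v
  ... | Z ∷ v' = let v'' , e = swap-valid v' (btw-apart b) in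
        (add-cong (≗-sym e) Z ∷ v'') , addc-cong z e
  dd-valid (suc t) {[]} v = v , λ _ → refl
  dd-valid (suc t) {c ∷ w} (C ∷ v) = let v' , e = dd-valid t v in
    (add-cong (≗-sym e) C ∷ v') , addc-cong c e

  run-valid : ∀ ts {w} → Valid w → Valid (run ts w) × sh (run ts w) ≗ sh w
  run-valid [] v = v , λ _ → refl
  run-valid (t ∷ ts) {w} v =
    let v' , e = dd-valid t v ; v'' , e' = run-valid ts v' in v'' , ≗-trans e' e

  opaque
    run-to-last : ∀ {u q} → Valid u → Rem q (sh u) → ∃[ ts ] ∃[ u' ] run ts u ≡ q ∷ u' × Valid (q ∷ u') × sh (q ∷ u') ≗ sh u
    run-to-last {u} {q} v r =
      let u' , v' , l , e = bring-last u q v r ; ts , p = same-shape-connected u (q ∷ u') v v' l (≗-sym e) in ts , u' , p , v' , e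

  sh-left : ∀ {w} → Valid w → ∀ p → p + length w ≤ M → sh w p ≡ true
  sh-left [] p l = Equivalence.to T-≡ (≤⇒≤ᵇ (subst (_≤ M) (+-identityʳ p) l))
  sh-left {c ∷ w} (C ∷ v) p l with p ≟ c | p ≟ suc c
  ... | yes refl | _ = ⊥-elim (true≢false (sh-left v (suc p) (subst (_≤ M) (+-suc p (length w)) l)) (Add.stepʳ C))
  ... | no _ | yes refl = addc-suc c (sh w)
  ... | no a | no b = trans (addc-other (sh w) a b) (sh-left v p (≤-trans (+-monoʳ-≤ p (n≤1+n _)) l))

  sh-right : ∀ {w} → Valid w → ∀ p → M + length w < p → sh w p ≡ false
  sh-right [] p l = ¬-not λ e → <⇒≱ (subst (_< p) (+-identityʳ M) l) (≤ᵇ⇒≤ p M (Equivalence.from T-≡ e))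
  sh-right {c ∷ w} (C ∷ v) p l with p ≟ c | p ≟ suc c
  ... | yes refl | _ = addc-at c (sh w)
  ... | no _ | yes refl = ⊥-elim (true≢false (Add.stepˡ C) (sh-right v c (≤-pred (subst (_< suc c) (+-suc M (length w)) l))))
  ... | no a | no b = trans (addc-other (sh w) a b) (sh-right v p (≤-trans (s≤s (+-monoʳ-≤ M (n≤1+n _))) l))

  remHead : ∀ {a w} → Rem a (sh (a ∷ w))
  remHead {a} {w} = rem-addc (sh w)

  tailV : ∀ {a w} → Valid (a ∷ w) → Valid w
  tailV (_ ∷ v) = v

  headA : ∀ {a w} → Valid (a ∷ w) → Add a (sh w)
  headA (A ∷ _) = A

  opaque
    -- The normal form from which the move at depth 0 exchanges the corners `x` and `y`; the
    -- separating `z` comes from `gap-btw` once both are removed.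
    two-corners : ∀ {w x y} → Valid w → Rem x (sh w) → Rem y (sh w) → x ≢ y →
      ∃[ z ] ∃[ t ] Btw x z y × Valid (x ∷ y ∷ z ∷ t) × length w ≡ 3 + length t × sh (x ∷ y ∷ z ∷ t) ≗ sh w
    two-corners {w} {x} {y} v rx ry ne with bring-last w x v rx
    ... | u , vx , lx , ex with bring-last u y (tailV vx) (rem-addc⁻¹ (rem-cong (≗-sym ex) ry) (ne ∘ sym))
    ... | t₁ , vy , ly , ey with gap-btw (add-swap₁ (add-cong (≗-sym ey) (headA vx)) (apart-sym (rem-apart rx ry ne))) (headA vy) ne
    ... | z , bz , rz with bring-last t₁ z (tailV vy) rz
    ... | t , vz , lz , ez =
      z , t , bz , (add-cong (≗-sym eyz) (headA vx) ∷ (add-cong (≗-sym ez) (headA vy) ∷ vz)) ,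
      trans lx (cong suc (trans ly (cong suc lz))) , ≗-trans (addc-cong x eyz) ex
      where
      eyz : sh (y ∷ z ∷ t) ≗ sh u
      eyz = ≗-trans (addc-cong y ez) ey

-- Tableaux and their reading words

letters : ℕ → List ℕ
letters n = map suc (upTo n)

∈-letters⁺ : ∀ {n x} → 1 ≤ x → x ≤ n → x ∈ letters n
∈-letters⁺ {n} {suc x} _ l = ∈-map⁺ suc (∈-upTo⁺ l)

∈-letters⁻ : ∀ {n x} → x ∈ letters n → (1 ≤ x) × (x ≤ n)
∈-letters⁻ {n} p with ∈-map⁻ suc p
... | y , q , refl = s≤s z≤n , ∈-upTo⁻ q

unique-↭ : ∀ {xs ys : List ℕ} → xs ↭ ys → Unique xs → Unique ys
unique-↭ p = PermS.Unique-resp-↭ (setoid ℕ) (↭⇒↭ₛ p)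

unique-letters : ∀ {w n} → w ↭ letters n → Unique w
unique-letters p = unique-↭ (↭-sym p) (UniqueP.map⁺ suc-injective (UniqueP.upTo⁺ _))

≡ᵇ-true⁻¹ : ∀ {m n} → (m ≡ᵇ n) ≡ true → m ≡ n
≡ᵇ-true⁻¹ {m} {n} e with m ≟ n
... | yes p = p
... | no ¬p = ⊥-elim (true≢false e (≡ᵇ-false ¬p))

pos-here : ∀ a xs → pos a (a ∷ xs) ≡ 0
pos-here a xs rewrite ≡ᵇ-refl a = refl

pos-there : ∀ {a x} xs → a ≢ x → pos a (x ∷ xs) ≡ suc (pos a xs)
pos-there xs ne rewrite ≡ᵇ-false ne = refl

pos-injective : ∀ {x y w} → x ∈ w → pos x w ≡ pos y w → x ≡ y
pos-injective {x} {y} {h ∷ w} x∈ e with x ≟ h | y ≟ h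
... | yes refl | yes refl = refl
... | yes refl | no ne = case trans (sym (pos-here h w)) (trans e (pos-there w ne)) of λ ()
... | no ne | yes refl = case trans (sym (pos-here h w)) (trans (sym e) (pos-there w ne)) of λ ()
pos-injective {x} {y} {h ∷ w} (here p) e | no ne | no ne' = ⊥-elim (ne p)
pos-injective {x} {y} {h ∷ w} (there p) e | no ne | no ne' =
  pos-injective p (suc-injective (trans (sym (pos-there w ne)) (trans e (pos-there w ne'))))

pos-< : ∀ {x w} → x ∈ w → pos x w < length w
pos-< {x} {h ∷ w} x∈ with x ≟ h
... | yes refl rewrite pos-here h w = s≤s z≤n
pos-< {x} {h ∷ w} (here p) | no ne = ⊥-elim (ne p)
pos-< {x} {h ∷ w} (there p) | no ne rewrite pos-there {x} {h} w ne = s≤s (pos-< p)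

pos-++ˡ : ∀ {x xs} ys → x ∈ xs → pos x (xs ++ ys) ≡ pos x xs
pos-++ˡ {x} {h ∷ xs} ys x∈ with x ≟ h
... | yes refl = trans (pos-here h (xs ++ ys)) (sym (pos-here h xs))
pos-++ˡ {x} {h ∷ xs} ys (here p) | no ne = ⊥-elim (ne p)
pos-++ˡ {x} {h ∷ xs} ys (there p) | no ne =
  trans (pos-there (xs ++ ys) ne) (trans (cong suc (pos-++ˡ ys p)) (sym (pos-there xs ne)))

pos-++ʳ : ∀ {x} xs ys → x ∉ xs → pos x (xs ++ ys) ≡ length xs + pos x ys
pos-++ʳ [] ys x∉ = refl
pos-++ʳ {x} (h ∷ xs) ys x∉ =
  trans (pos-there (xs ++ ys) (λ { refl → x∉ (here refl) })) (cong suc (pos-++ʳ xs ys (x∉ ∘ there)))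

words-from-pos : ∀ {u w} → Unique u → length u ≡ length w → (∀ {x} → x ∈ u → pos x u ≡ pos x w) → u ≡ w
words-from-pos {[]} {[]} _ _ _ = refl
words-from-pos {a ∷ u} {b ∷ w} (a∉ ∷ U) l f with a ≟ b
... | no ne = case trans (sym (pos-here a u)) (trans (f (here refl)) (pos-there w ne)) of λ ()
... | yes refl = cong (a ∷_) (words-from-pos U (suc-injective l) λ {x} x∈ →
  let ne : x ≢ a
      ne = λ { refl → All.lookup a∉ x∈ refl }
  in suc-injective (trans (sym (pos-there u ne)) (trans (f (there x∈)) (pos-there w ne))))

swap-eqˡ : ∀ a b → swapV a b a ≡ b
swap-eqˡ a b rewrite ≡ᵇ-refl a = refl

swap-eqʳ : ∀ a b → swapV a b b ≡ a
swap-eqʳ a b with b ≡ᵇ a in e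
... | true = ≡ᵇ-true⁻¹ e
... | false rewrite ≡ᵇ-refl b = refl

swap-other : ∀ {a b x} → x ≢ a → x ≢ b → swapV a b x ≡ x
swap-other p q rewrite ≡ᵇ-false p | ≡ᵇ-false q = refl

swap-invol : ∀ a b x → swapV a b (swapV a b x) ≡ x
swap-invol a b x with x ≟ a | x ≟ b
... | yes refl | _ = trans (cong (swapV a b) (swap-eqˡ a b)) (swap-eqʳ a b)
... | no _ | yes refl = trans (cong (swapV a b) (swap-eqʳ a b)) (swap-eqˡ a b)
... | no p | no q = trans (cong (swapV a b) (swap-other p q)) (swap-other p q)

pos-map : ∀ {ρ : ℕ → ℕ} → (∀ x → ρ (ρ x) ≡ x) → ∀ x w → pos x (map ρ w) ≡ pos (ρ x) w
pos-map inv x [] = refl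
pos-map {ρ} inv x (h ∷ w) with ρ x ≟ h
... | yes refl = trans (cong (λ y → pos x (y ∷ map ρ w)) (inv x)) (trans (pos-here x (map ρ w)) (sym (pos-here (ρ x) w)))
... | no ne = trans (pos-there (map ρ w) λ { refl → ne (inv h) })
              (trans (cong suc (pos-map inv x w)) (sym (pos-there w ne)))

data DCase (i : ℕ) (w : List ℕ) : Set where
  moves-none : between (pos (i ∸ 1) w) (pos i w) (pos (i + 1) w) ≡ true → (∀ x → dVal i w x ≡ x) → DCase i w
  moves-upper : between (pos (i ∸ 1) w) (pos i w) (pos (i + 1) w) ≡ false →
          between (pos i w) (pos (i ∸ 1) w) (pos (i + 1) w) ≡ true →
          (∀ x → dVal i w x ≡ swapV i (i + 1) x) → DCase i w
  moves-lower : between (pos (i ∸ 1) w) (pos i w) (pos (i + 1) w) ≡ false →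
          between (pos i w) (pos (i ∸ 1) w) (pos (i + 1) w) ≡ false →
          (∀ x → dVal i w x ≡ swapV (i ∸ 1) i x) → DCase i w

-- `dVal` with the three positions as variables, so that an equation for one position can be
-- substituted without disturbing the others.
dsel : ℕ → ℕ → ℕ → ℕ → ℕ → ℕ
dsel i p q r x = (if between p q r then (λ x → x)
                  else (if between q p r then swapV i (i + 1) else swapV (i ∸ 1) i)) x

dsel-fixed : ∀ i {p q r} x → between p q r ≡ true → dsel i p q r x ≡ x
dsel-fixed i x e rewrite e = refl

dsel-upper : ∀ i {p q r} x → between p q r ≡ false → between q p r ≡ true → dsel i p q r x ≡ swapV i (i + 1) x
dsel-upper i x e e' rewrite e | e' = refl

dsel-lower : ∀ i {p q r} x → between p q r ≡ false → between q p r ≡ false → dsel i p q r x ≡ swapV (i ∸ 1) i x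
dsel-lower i x e e' rewrite e | e' = refl

private
  dcase' : ∀ i w p q r → p ≡ pos (i ∸ 1) w → q ≡ pos i w → r ≡ pos (i + 1) w →
           ∀ b c → between p q r ≡ b → between q p r ≡ c → DCase i w
  dcase' i w p q r refl refl refl true c e e' = moves-none e (λ x → dsel-fixed i {p} {q} {r} x e)
  dcase' i w p q r refl refl refl false true e e' = moves-upper e e' (λ x → dsel-upper i {p} {q} {r} x e e')
  dcase' i w p q r refl refl refl false false e e' = moves-lower e e' (λ x → dsel-lower i {p} {q} {r} x e e')

dcase : ∀ i w → DCase i w
dcase i w = dcase' i w _ _ _ refl refl refl _ _ refl refl

dVal-invol : ∀ i w x → dVal i w (dVal i w x) ≡ x
dVal-invol i w x with dcase i w
... | moves-none _ f = trans (f _) (f x)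
... | moves-upper _ _ f = trans (f _) (trans (cong (swapV i (i + 1)) (f x)) (swap-invol i (i + 1) x))
... | moves-lower _ _ f = trans (f _) (trans (cong (swapV (i ∸ 1) i) (f x)) (swap-invol (i ∸ 1) i x))

pos-dWord : ∀ i w x → pos x (dWord i w) ≡ pos (dVal i w x) w
pos-dWord i w x = pos-map (dVal-invol i w) x w

dVal-other : ∀ i w x → x ≢ i ∸ 1 → x ≢ i → x ≢ i + 1 → dVal i w x ≡ x
dVal-other i w x p q r with dcase i w
... | moves-none _ f = f x
... | moves-upper _ _ f = trans (f x) (swap-other q r)
... | moves-lower _ _ f = trans (f x) (swap-other p q)

between⁻¹ : ∀ {x y z} → between x y z ≡ true → Btw x y z
between⁻¹ {x} {y} {z} e with <-cmp x y | <-cmp y z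
... | tri< a _ _ | tri< b _ _ = inj₁ (a , b)
... | tri> _ _ a | tri> _ _ b = inj₂ (b , a)
... | tri< a _ _ | tri≈ ¬b _ ¬c rewrite <ᵇ-false {y} {z} (≮⇒≥ ¬b) | <ᵇ-false {y} {x} (<⇒≤ a) | <ᵇ-false {z} {y} (≮⇒≥ ¬c) with x <ᵇ y | e
... | true | ()
... | false | ()
between⁻¹ {x} {y} {z} e | tri< a _ _ | tri> _ _ b rewrite <ᵇ-false {y} {z} (<⇒≤ b) | <ᵇ-false {y} {x} (<⇒≤ a) with x <ᵇ y | z <ᵇ y | e
... | true | true | ()
... | true | false | ()
... | false | true | ()
... | false | false | ()
between⁻¹ {x} {y} {z} e | tri≈ ¬a _ ¬b | _ rewrite <ᵇ-false {x} {y} (≮⇒≥ ¬a) | <ᵇ-false {y} {x} (≮⇒≥ ¬b) with z <ᵇ y | e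
... | true | ()
... | false | ()
between⁻¹ {x} {y} {z} e | tri> _ _ a | tri< b _ _ rewrite <ᵇ-false {x} {y} (<⇒≤ a) | <ᵇ-false {z} {y} (<⇒≤ b) with e
... | ()
between⁻¹ {x} {y} {z} e | tri> _ _ a | tri≈ _ _ ¬b rewrite <ᵇ-false {x} {y} (<⇒≤ a) | <ᵇ-false {z} {y} (≮⇒≥ ¬b) with e
... | ()

private
  cong₃ : ∀ (g : ℕ → ℕ → ℕ → ℕ) {a a' b b' c c'} → a ≡ a' → b ≡ b' → c ≡ c' → g a b c ≡ g a' b' c'
  cong₃ g refl refl refl = refl

-- After an exchange the positions of i ∸ 1, i, i + 1 are permuted so that the same
-- exchange is selected again.
dVal-dWord : ∀ i w → 1 ≤ i → ∀ x → dVal i (dWord i w) x ≡ dVal i w x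
dVal-dWord (suc i) w _ x with dcase (suc i) w
... | moves-none e f = cong (λ u → dVal (suc i) u x) (trans (map-cong f w) (map-id w))
... | moves-upper e e' f =
  trans (cong₃ (λ p q r → dsel (suc i) p q r x)
    (trans (pos-dWord (suc i) w i) (cong (λ y → pos y w) (trans (f i) (swap-other (λ ()) λ q → <⇒≢ (m≤m+n (suc i) 1) q))))
    (trans (pos-dWord (suc i) w (suc i)) (cong (λ y → pos y w) (trans (f (suc i)) (swap-eqˡ (suc i) (suc i + 1)))))
    (trans (pos-dWord (suc i) w (suc i + 1)) (cong (λ y → pos y w) (trans (f (suc i + 1)) (swap-eqʳ (suc i) (suc i + 1))))))
  (let b = btw-sym (between⁻¹ {pos (suc i) w} {pos i w} {pos (suc i + 1) w} e') in
   trans (dsel-upper (suc i) {pos i w} {pos (suc i + 1) w} {pos (suc i) w} x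
    (btw-excl b) (btw-true b)) (sym (f x)))
... | moves-lower e e' f =
  trans (cong₃ (λ p q r → dsel (suc i) p q r x)
    (trans (pos-dWord (suc i) w i) (cong (λ y → pos y w) (trans (f i) (swap-eqˡ i (suc i)))))
    (trans (pos-dWord (suc i) w (suc i)) (cong (λ y → pos y w) (trans (f (suc i)) (swap-eqʳ i (suc i)))))
    (trans (pos-dWord (suc i) w (suc i + 1)) (cong (λ y → pos y w) (trans (f (suc i + 1))
      (swap-other (λ q → <⇒≢ (m≤m+n (suc i) 1) (sym q)) λ q → <⇒≢ (m<m+n (suc i) {1} (s≤s z≤n)) (sym q))))))
  (trans (dsel-lower (suc i) {pos (suc i) w} {pos i w} {pos (suc i + 1) w} x e' e) (sym (f x)))

readingWord-∷ : ∀ row T → readingWord (row ∷ T) ≡ readingWord T ++ row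
readingWord-∷ row T = trans (cong concat (unfold-reverse row T))
  (trans (sym (concat-++ (reverse T) (row ∷ []))) (cong (readingWord T ++_) (++-identityʳ row)))

readingWord-map : ∀ f T → readingWord (map (map f) T) ≡ map f (readingWord T)
readingWord-map f T = trans (cong concat (sym (reverse-map (map f) T))) (concat-map (reverse T))

dTab-word : ∀ i T → readingWord (dTab i T) ≡ dWord i (readingWord T)
dTab-word i T = readingWord-map _ T

map-map-id : ∀ {f : ℕ → ℕ} → (∀ x → f x ≡ x) → ∀ T → map (map f) T ≡ T
map-map-id e T = trans (map-cong (λ r → trans (map-cong e r) (map-id r)) T) (map-id T)

dTab-invol : ∀ i T → 1 ≤ i → dTab i (dTab i T) ≡ T
dTab-invol i T l = trans (sym (map-∘ T)) (map-map-id' λ x →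
    trans (cong (λ u → dVal i u (dVal i w x)) (dTab-word i T)) (trans (dVal-dWord i w l (dVal i w x)) (dVal-invol i w x)))
  where
  w = readingWord T
  map-map-id' : ∀ {f g : ℕ → ℕ} → (∀ x → f (g x) ≡ x) → map (map f ∘ map g) T ≡ T
  map-map-id' e = trans (map-cong (λ r → trans (sym (map-∘ r)) (trans (map-cong e r) (map-id r))) T) (map-id T)

tab-from-word : ∀ T U → map length T ≡ map length U → readingWord T ≡ readingWord U → T ≡ U
tab-from-word [] [] _ _ = refl
tab-from-word (r ∷ T) (r' ∷ U) l e = cong₂ _∷_ (proj₂ q) (tab-from-word T U (cong (λ { [] → [] ; (_ ∷ x) → x }) l) (proj₁ q))
  where
  len : ∀ T U → map length T ≡ map length U → length (readingWord T) ≡ length (readingWord U)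
  len [] [] _ = refl
  len (r ∷ T) (r' ∷ U) l = trans (cong length (readingWord-∷ r T)) (trans (length-++ (readingWord T))
    (trans (cong₂ _+_ (len T U (cong (λ { [] → [] ; (_ ∷ x) → x }) l)) (cong (λ { [] → 0 ; (x ∷ _) → x }) l))
    (trans (sym (length-++ (readingWord U))) (sym (cong length (readingWord-∷ r' U))))))
  ++-inj : ∀ (a b : List ℕ) {c d} → length a ≡ length b → a ++ c ≡ b ++ d → a ≡ b × c ≡ d
  ++-inj [] [] _ e = refl , e
  ++-inj (x ∷ a) (y ∷ b) l e with ++-inj a b (suc-injective l) (cong (λ { [] → [] ; (_ ∷ x) → x }) e)
  ... | p , q = cong₂ _∷_ (cong (λ { [] → 0 ; (x ∷ _) → x }) e) p , q
  q = ++-inj (readingWord T) (readingWord U) (len T U (cong (λ { [] → [] ; (_ ∷ x) → x }) l))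
        (trans (sym (readingWord-∷ r T)) (trans e (readingWord-∷ r' U)))

at-∈ : ∀ {row : List ℕ} {c a} → at row c ≡ just a → a ∈ row
at-∈ {x ∷ row} {zero} refl = here refl
at-∈ {x ∷ row} {suc c} e = there (at-∈ e)

∈-at : ∀ {row : List ℕ} {a} → a ∈ row → ∃[ c ] at row c ≡ just a
∈-at (here refl) = 0 , refl
∈-at (there p) = let c , e = ∈-at p in suc c , e

entry-∈ : ∀ T {r c a} → entry T r c ≡ just a → a ∈ readingWord T
entry-∈ (row ∷ T) {zero} {c} e rewrite readingWord-∷ row T = ∈-++⁺ʳ (readingWord T) (at-∈ e)
entry-∈ (row ∷ T) {suc r} {c} e rewrite readingWord-∷ row T = ∈-++⁺ˡ (entry-∈ T {r} {c} e)

∈-entry : ∀ T {a} → a ∈ readingWord T → ∃[ r ] ∃[ c ] entry T r c ≡ just a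
∈-entry (row ∷ T) p rewrite readingWord-∷ row T with ∈-++⁻ (readingWord T) p
... | inj₁ q = let r , c , e = ∈-entry T q in suc r , c , e
... | inj₂ q = let c , e = ∈-at q in 0 , c , e

cellPos : Tab → ℕ → ℕ → ℕ
cellPos []        r       c = 0
cellPos (row ∷ T) zero    c = length (readingWord T) + c
cellPos (row ∷ T) (suc r) c = cellPos T r c

unique-++ : ∀ (xs : List ℕ) {ys} → Unique (xs ++ ys) → Unique xs × Unique ys × (∀ {a} → a ∈ xs → a ∈ ys → ⊥)
unique-++ [] U = [] , U , λ ()
unique-++ (x ∷ xs) (x∉ ∷ U) with unique-++ xs U
... | p , q , d = AllP.++⁻ˡ xs x∉ ∷ p , q ,
  λ { (here refl) m → All.lookup x∉ (∈-++⁺ʳ xs m) refl ; (there l) m → d l m }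

pos-at : ∀ {row : List ℕ} {c a} → Unique row → at row c ≡ just a → pos a row ≡ c
pos-at {x ∷ row} {zero} U refl = pos-here x row
pos-at {x ∷ row} {suc c} (x∉ ∷ U) e =
  trans (pos-there row (λ { refl → All.lookup x∉ (at-∈ e) refl })) (cong suc (pos-at U e))

pos-cell : ∀ T {r c a} → Unique (readingWord T) → entry T r c ≡ just a → pos a (readingWord T) ≡ cellPos T r c
pos-cell (row ∷ T) {zero} {c} U e rewrite readingWord-∷ row T with unique-++ (readingWord T) U
... | U₁ , U₂ , d = trans (pos-++ʳ (readingWord T) row (λ m → d m (at-∈ e))) (cong (length (readingWord T) +_) (pos-at U₂ e))
pos-cell (row ∷ T) {suc r} {c} U e rewrite readingWord-∷ row T with unique-++ (readingWord T) U
... | U₁ , U₂ , d = trans (pos-++ˡ row (entry-∈ T {r} {c} e)) (pos-cell T {r} {c} U₁ e)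

CellBefore : ℕ → ℕ → ℕ → ℕ → Set
CellBefore r c r' c' = r' < r ⊎ (r ≡ r' × c < c')

cell-order : ∀ T {r c a r' c' b} → Unique (readingWord T) → entry T r c ≡ just a → entry T r' c' ≡ just b →
  CellBefore r c r' c' → pos a (readingWord T) < pos b (readingWord T)
cell-order T {r} {c} {a} {r'} {c'} {b} U e e' o
  rewrite pos-cell T {r} {c} U e | pos-cell T {r'} {c'} U e' = go T {r} {c} {r'} {c'} U e e' o
  where
  go : ∀ T {r c r' c'} → Unique (readingWord T) → entry T r c ≡ just a → entry T r' c' ≡ just b →
       CellBefore r c r' c' → cellPos T r c < cellPos T r' c'
  go (row ∷ T) {suc r} {c} {zero} {c'} U e e' (inj₁ _) =
    ≤-trans (subst (_< length (readingWord T)) (pos-cell T {r} {c} U' e) (pos-< (entry-∈ T {r} {c} e))) (m≤m+n _ c')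
    where U' = proj₁ (unique-++ (readingWord T) (subst Unique (readingWord-∷ row T) U))
  go (row ∷ T) {suc r} {c} {suc r'} {c'} U e e' (inj₁ (s≤s l)) =
    go T {r} {c} {r'} {c'} (proj₁ (unique-++ (readingWord T) (subst Unique (readingWord-∷ row T) U))) e e' (inj₁ l)
  go (row ∷ T) {zero} {c} {zero} {c'} U e e' (inj₂ (refl , l)) = +-monoʳ-< (length (readingWord T)) l
  go (row ∷ T) {suc r} {c} {suc r'} {c'} U e e' (inj₂ (refl , l)) =
    go T {r} {c} {r'} {c'} (proj₁ (unique-++ (readingWord T) (subst Unique (readingWord-∷ row T) U))) e e' (inj₂ (refl , l))

data CellCmp (r c r' c' : ℕ) : Set where
  precedes : CellBefore r c r' c' → CellCmp r c r' c'
  coincides   : r ≡ r' → c ≡ c' → CellCmp r c r' c'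
  follows  : CellBefore r' c' r c → CellCmp r c r' c'

cellCmp : ∀ r c r' c' → CellCmp r c r' c'
cellCmp r c r' c' with <-cmp r r' | <-cmp c c'
... | tri< l _ _ | _ = follows (inj₁ l)
... | tri> _ _ l | _ = precedes (inj₁ l)
... | tri≈ _ e _ | tri< l _ _ = precedes (inj₂ (e , l))
... | tri≈ _ e _ | tri≈ _ e' _ = coincides e e'
... | tri≈ _ e _ | tri> _ _ l = follows (inj₂ (sym e , l))

cell-order⁻¹ : ∀ T {r c a r' c' b} → Unique (readingWord T) → entry T r c ≡ just a → entry T r' c' ≡ just b →
  pos a (readingWord T) < pos b (readingWord T) → CellBefore r c r' c'
cell-order⁻¹ T {r} {c} {a} {r'} {c'} U e e' l with cellCmp r c r' c'
... | precedes o = o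
... | coincides refl refl with trans (sym e) e'
... | refl = ⊥-elim (<-irrefl refl l)
cell-order⁻¹ T {r} {c} {a} {r'} {c'} U e e' l | follows o = ⊥-elim (<-asym l (cell-order T {r'} {c'} {_} {r} {c} U e' e o))

same-cell : ∀ T {r c r' c' a} → Unique (readingWord T) → entry T r c ≡ just a → entry T r' c' ≡ just a → (r ≡ r') × (c ≡ c')
same-cell T {r} {c} {r'} {c'} U e e' with cellCmp r c r' c'
... | precedes o = ⊥-elim (<-irrefl refl (cell-order T {r} {c} {_} {r'} {c'} U e e' o))
... | coincides p q = p , q
... | follows o = ⊥-elim (<-irrefl refl (cell-order T {r'} {c'} {_} {r} {c} U e' e o))

at-map : ∀ (f : ℕ → ℕ) row c → at (map f row) c ≡ Maybe.map f (at row c)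
at-map f [] c = refl
at-map f (x ∷ row) zero = refl
at-map f (x ∷ row) (suc c) = at-map f row c

entry-map : ∀ (f : ℕ → ℕ) T r c → entry (map (map f) T) r c ≡ Maybe.map f (entry T r c)
entry-map f [] r c = refl
entry-map f (row ∷ T) zero c = at-map f row c
entry-map f (row ∷ T) (suc r) c = entry-map f T r c

map-just⁻¹ : ∀ {f : ℕ → ℕ} {m : Maybe ℕ} {b} → Maybe.map f m ≡ just b → ∃[ a ] (m ≡ just a) × (b ≡ f a)
map-just⁻¹ {m = just a} refl = a , refl , refl

at-before : ∀ (row : List ℕ) {c c' a} → at row c ≡ just a → c' ≤ c → ∃[ b ] at row c' ≡ just b
at-before (x ∷ row) {c} {zero} e l = x , refl
at-before (x ∷ row) {suc c} {suc c'} e (s≤s l) = at-before row e l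

at-<-length : ∀ (row : List ℕ) {c a} → at row c ≡ just a → c < length row
at-<-length (x ∷ row) {zero} e = s≤s z≤n
at-<-length (x ∷ row) {suc c} e = s≤s (at-<-length row e)

<-length-at : ∀ (row : List ℕ) {c} → c < length row → ∃[ a ] at row c ≡ just a
<-length-at (x ∷ row) {zero} l = x , refl
<-length-at (x ∷ row) {suc c} (s≤s l) = <-length-at row l

entry-left : ∀ T {r c c' a} → entry T r c ≡ just a → c' ≤ c → ∃[ b ] entry T r c' ≡ just b
entry-left (row ∷ T) {zero} e l = at-before row e l
entry-left (row ∷ T) {suc r} e l = entry-left T {r} e l

entry-below : ∀ T {r c a} → Decr (map length T) → entry T (suc r) c ≡ just a → ∃[ b ] entry T r c ≡ just b
entry-below (row ∷ row' ∷ T) {zero} (l ∷ D) e = <-length-at row (≤-trans (at-<-length row' e) l)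
entry-below (row ∷ row' ∷ T) {suc r} (l ∷ D) e = entry-below (row' ∷ T) {r} D e

-- Elementary dual equivalences preserve standardness

module SYT {sizes T} (part : IsPartition sizes) (syt : IsSYT sizes T) where
  private
    w = readingWord T
    n = sum sizes
  lens = proj₁ syt
  rows = proj₁ (proj₂ syt)
  cols = proj₁ (proj₂ (proj₂ syt))
  perm = proj₂ (proj₂ (proj₂ syt))

  uniq : Unique w
  uniq = unique-letters perm

  mem : ∀ {x} → 1 ≤ x → x ≤ n → x ∈ w
  mem p q = ∈-resp-↭ (↭-sym perm) (∈-letters⁺ p q)

  row-mono : ∀ {r c c' a b} → entry T r c ≡ just a → entry T r c' ≡ just b → c < c' → a < b
  row-mono {r} {c} {suc c'} e e' (s≤s l) with m≤n⇒m<n∨m≡n l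
  ... | inj₂ refl = rows r c _ _ e e'
  ... | inj₁ l' = let x , q = entry-left T {r} {suc c'} {c'} e' (n≤1+n c') in
        <-trans (row-mono {r} e q l') (rows r c' _ _ q e')

  Between : ℕ → ℕ → ℕ → Set
  Between a x b = Btw (pos a w) (pos x w) (pos b w)

  module _ {k : ℕ} where

    -- Horizontally adjacent cells are consecutive in reading order.
    not-in-row : ∀ {x} → x ∈ w → Between k x (suc k) → ∀ {r c} → entry T r c ≡ just k → entry T r (suc c) ≡ just (suc k) → ⊥
    not-in-row x∈ bt {r} {c} e e' with ∈-entry T x∈ | cell-order T {r} {c} {_} {r} {suc c} uniq e e' (inj₂ (refl , ≤-refl)) | bt
    ... | _ | l | inj₂ (p , q) = <-asym l (<-trans p q)
    ... | r' , c' , ex | _ | inj₁ (p , q) with cell-order⁻¹ T {r} {c} {_} {r'} {c'} uniq e ex p | cell-order⁻¹ T {r'} {c'} {_} {r} {suc c} uniq ex e' q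
    ... | inj₁ l | inj₁ l' = <-asym l l'
    ... | inj₁ l | inj₂ (refl , _) = <-irrefl refl l
    ... | inj₂ (refl , _) | inj₁ l = <-irrefl refl l
    ... | inj₂ (_ , l) | inj₂ (_ , l') = <⇒≱ l (≤-pred l')

    -- With `k` directly below `k + 1`, a letter read between them lies to the right of `k + 1` in
    -- the upper row or to the left of `k` in the lower one. In the first case it is `k + 2`, and
    -- the cell below it holds a letter strictly between `k` and `k + 2`; in the second it is
    -- `k − 1`, and the cell above it holds one strictly between `k − 1` and `k + 1`. So `k + 1` or
    -- `k` would occupy a second cell.
    not-in-col : ∀ {x} → x ∈ w → suc x ≡ k ⊎ x ≡ suc (suc k) → Between k x (suc k) → ∀ {r c} → entry T r c ≡ just k → entry T (suc r) c ≡ just (suc k) → ⊥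
    not-in-col {x} x∈ x≡ bt {r} {c} e e' with ∈-entry T x∈ | cell-order T {suc r} {c} {_} {r} {c} uniq e' e (inj₁ ≤-refl) | bt
    ... | _ | l | inj₁ (p , q) = <-asym l (<-trans p q)
    ... | r' , c' , ex | _ | inj₂ (p , q) with cell-order⁻¹ T {suc r} {c} {_} {r'} {c'} uniq e' ex p | cell-order⁻¹ T {r'} {c'} {_} {r} {c} uniq ex e q
    ... | inj₁ l | inj₁ l' = <⇒≱ l' (≤-pred l)
    ... | inj₂ (refl , l) | inj₂ (() , _)
    ... | inj₂ (refl , l) | inj₁ _ with x≡ | row-mono {suc r} {c} {c'} e' ex l
    ...   | inj₁ refl | m = <⇒≱ m (≤-trans (n≤1+n x) (n≤1+n _))
    ...   | inj₂ refl | _ with entry-below T {r} {c'} (subst Decr (sym lens) (proj₁ part)) ex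
    ...     | b , eb with row-mono {r} {c} {c'} e eb l | cols r c' _ _ eb ex
    ...       | k<b | s≤s b≤ with ≤-antisym b≤ k<b
    ...         | refl = <-irrefl (proj₁ (same-cell T {r} {c'} {suc r} {c} uniq eb e')) (n<1+n r)
    not-in-col {x} x∈ x≡ bt {r} {c} e e' | r' , c' , ex | _ | inj₂ (p , q) | inj₁ _ | inj₂ (refl , l) with x≡ | row-mono {r} {c'} {c} ex e l
    ...   | inj₂ refl | m = <⇒≱ m (≤-trans (n≤1+n k) (n≤1+n _))
    ...   | inj₁ refl | _ with entry-left T {suc r} {c} {c'} e' (<⇒≤ l)
    ...     | b , eb with row-mono {suc r} {c'} {c} eb e' l | cols r c' _ _ ex eb
    ...       | s≤s b≤ | x<b with ≤-antisym b≤ x<b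
    ...         | refl = <-irrefl (proj₁ (same-cell T {r} {c} {suc r} {c'} uniq e eb)) (n<1+n r)

    swap-< : ∀ {a b} → a < b → ¬ (a ≡ k × b ≡ suc k) → swapV k (suc k) a < swapV k (suc k) b
    swap-< {a} {b} l ne with a ≟ k | a ≟ suc k | b ≟ k | b ≟ suc k
    ... | yes refl | _ | yes refl | _ = ⊥-elim (<-irrefl refl l)
    ... | yes refl | _ | _ | yes refl = ⊥-elim (ne (refl , refl))
    ... | yes refl | _ | no p | no q = subst₂ _<_ (sym (swap-eqˡ k (suc k))) (sym (swap-other p q)) (≤∧≢⇒< l (q ∘ sym))
    ... | no _ | yes refl | yes refl | _ = ⊥-elim (<-asym l (n<1+n b))
    ... | no _ | yes refl | _ | yes refl = ⊥-elim (<-irrefl refl l)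
    ... | no _ | yes refl | no p | no q = subst₂ _<_ (sym (swap-eqʳ k (suc k))) (sym (swap-other p q)) (<-trans (n<1+n k) l)
    ... | no p | no q | yes refl | _ = subst₂ _<_ (sym (swap-other p q)) (sym (swap-eqˡ k (suc k))) (<-trans l (n<1+n k))
    ... | no p | no q | no _ | yes refl = subst₂ _<_ (sym (swap-other p q)) (sym (swap-eqʳ k (suc k))) (≤∧≢⇒< (≤-pred l) p)
    ... | no p | no q | no p' | no q' = subst₂ _<_ (sym (swap-other p q)) (sym (swap-other p' q')) l

    swap-perm : k ∈ w → suc k ∈ w → map (swapV k (suc k)) w ↭ w
    swap-perm k∈ k∈' with ∈-∃++ k∈
    ... | u , v , e with ∈-resp-↭ (↭-trans (↭-reflexive e) (shift k u v)) k∈'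
    ...   | here q = ⊥-elim (1+n≢n q)
    ...   | there m with ∈-∃++ m
    ...     | u' , v' , e' =
      ↭-trans (↭-map⁺ (swapV k (suc k)) w↭)
      (↭-trans (↭-reflexive (cong₂ _∷_ (swap-eqˡ k (suc k)) (cong₂ _∷_ (swap-eqʳ k (suc k)) (fix (u' ++ v') (tail₂ (unique-↭ w↭ uniq))))))
      (↭-trans (swap (suc k) k ↭-refl) (↭-sym w↭)))
      where
      w↭ : w ↭ k ∷ suc k ∷ (u' ++ v')
      w↭ = ↭-trans (↭-trans (↭-reflexive e) (shift k u v)) (prep k (↭-trans (↭-reflexive e') (shift (suc k) u' v')))
      tail₂ : ∀ {xs} → Unique (k ∷ suc k ∷ xs) → All (λ y → y ≢ k × y ≢ suc k) xs
      tail₂ ((_ ∷ a) ∷ (b ∷ _)) = All.zipWith (λ (p , q) → (p ∘ sym) , (q ∘ sym)) (a , b)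
      fix : ∀ xs → All (λ y → y ≢ k × y ≢ suc k) xs → map (swapV k (suc k)) xs ≡ xs
      fix [] [] = refl
      fix (y ∷ xs) ((p , q) ∷ ps) = cong₂ _∷_ (swap-other p q) (fix xs ps)

    swap-SYT : ∀ {x} → x ∈ w → suc x ≡ k ⊎ x ≡ suc (suc k) → Between k x (suc k) → k ∈ w → suc k ∈ w → IsSYT sizes (map (map (swapV k (suc k))) T)
    swap-SYT x∈ x≡ bt k∈ k∈' =
      trans (trans (sym (map-∘ T)) (map-cong (λ r → length-map (swapV k (suc k)) r) T)) lens ,
      (λ r c a b e e' → let
          a' , ea , qa = map-just⁻¹ (trans (sym (entry-map _ T r c)) e)
          b' , eb , qb = map-just⁻¹ (trans (sym (entry-map _ T r (suc c))) e')
        in subst₂ _<_ (sym qa) (sym qb) (swap-< (rows r c a' b' ea eb)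
             λ (p , q) → not-in-row x∈ bt {r} {c} (trans ea (cong just p)) (trans eb (cong just q)))) ,
      (λ r c a b e e' → let
          a' , ea , qa = map-just⁻¹ (trans (sym (entry-map _ T r c)) e)
          b' , eb , qb = map-just⁻¹ (trans (sym (entry-map _ T (suc r) c)) e')
        in subst₂ _<_ (sym qa) (sym qb) (swap-< (cols r c a' b' ea eb)
             λ (p , q) → not-in-col x∈ x≡ bt {r} {c} (trans ea (cong just p)) (trans eb (cong just q)))) ,
      ↭-trans (↭-reflexive (readingWord-map _ T)) (↭-trans (swap-perm k∈ k∈') perm)

  pos-≢ : ∀ {x y} → x ∈ w → x ≢ y → pos x w ≢ pos y w
  pos-≢ x∈ ne e = ne (pos-injective x∈ e)

  tri-pos : ∀ i → 1 < i → i < n → Between (i ∸ 1) i (suc i) ⊎ Between i (i ∸ 1) (suc i) ⊎ Between (i ∸ 1) (suc i) i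
  tri-pos (suc (suc i)) (s≤s (s≤s _)) l = btw-tri
    (pos-≢ (mem (s≤s z≤n) (≤-trans (n≤1+n _) (<⇒≤ l))) (1+n≢n ∘ sym))
    (pos-≢ (mem (s≤s z≤n) (<⇒≤ l)) (1+n≢n ∘ sym))
    (pos-≢ (mem (s≤s z≤n) (≤-trans (n≤1+n _) (<⇒≤ l))) λ q → <⇒≢ (m<n+m (suc i) {2} (s≤s z≤n)) q)

  -- The letter that stays in place is read between the two exchanged ones, which are therefore
  -- adjacent neither in a row nor in a column.
  dTab-SYT : ∀ i → 1 < i → i < n → IsSYT sizes (dTab i T)
  dTab-SYT i@(suc j) p@(s≤s 1≤j) l with dcase i w
  ... | moves-none _ f = subst (IsSYT sizes) (sym (map-map-id f T)) syt
  ... | moves-upper e e' f = subst (IsSYT sizes) (map-cong (map-cong (λ x → trans (cong (λ y → swapV i y x) (sym (+-comm i 1))) (sym (f x)))) T)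
        (swap-SYT {i} {j} (mem 1≤j (≤-trans (n≤1+n j) (<⇒≤ l))) (inj₁ refl)
          (subst (λ y → Btw (pos i w) (pos j w) (pos y w)) (+-comm i 1) (between⁻¹ e'))
          (mem (s≤s z≤n) (<⇒≤ l)) (mem (s≤s z≤n) l))
  ... | moves-lower e e' f = subst (IsSYT sizes) (map-cong (map-cong (λ x → sym (f x))) T)
        (swap-SYT {j} {suc i} (mem (s≤s z≤n) l) (inj₂ refl) bt
          (mem 1≤j (≤-trans (n≤1+n j) (<⇒≤ l))) (mem (s≤s z≤n) (<⇒≤ l)))
    where
    bt : Between j (suc i) i
    bt with tri-pos i p l
    ... | inj₁ b = ⊥-elim (true≢false (btw-true (subst (λ y → Btw (pos j w) (pos i w) (pos y w)) (+-comm 1 i) b)) e)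
    ... | inj₂ (inj₁ b) = ⊥-elim (true≢false (btw-true (subst (λ y → Btw (pos i w) (pos j w) (pos y w)) (+-comm 1 i) b)) e')
    ... | inj₂ (inj₂ b) = b

  moved : ∀ i → 1 < i → i < n → between (pos (i ∸ 1) w) (pos i w) (pos (i + 1) w) ≡ false → dTab i T ≢ T
  moved i@(suc j) (s≤s 1≤j) l e q with dcase i w
  ... | moves-none e' _ = true≢false e' e
  ... | moves-upper _ _ f = pos-≢ (mem (s≤s z≤n) (<⇒≤ l)) (λ r → <⇒≢ (m<m+n i {1} (s≤s z≤n)) r)
        (trans (cong (pos i ∘ readingWord) (sym q)) (trans (cong (pos i) (dTab-word i T)) (trans (pos-dWord i w i) (cong (λ y → pos y w) (trans (f i) (swap-eqˡ i (i + 1)))))))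
  ... | moves-lower _ _ f = pos-≢ (mem (s≤s z≤n) (<⇒≤ l)) 1+n≢n
        (trans (cong (pos i ∘ readingWord) (sym q)) (trans (cong (pos i) (dTab-word i T)) (trans (pos-dWord i w i) (cong (λ y → pos y w) (trans (f i) (swap-eqʳ j i))))))

-- Neighbours in a signed colored graph

neqS : Sgn → Sgn → Bool
neqS plus  plus  = false
neqS plus  minus = true
neqS minus plus  = true
neqS minus minus = false

neqS-true : ∀ {a b} → neqS a b ≡ true → a ≡ negS b
neqS-true {plus} {minus} _ = refl
neqS-true {minus} {plus} _ = refl

neqS-true' : ∀ {a b} → a ≡ negS b → neqS a b ≡ true
neqS-true' {b = plus} refl = refl
neqS-true' {b = minus} refl = refl

negS-invol : ∀ a → negS (negS a) ≡ a
negS-invol plus = refl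
negS-invol minus = refl

module Vert (G : SCG) (ax1 : Ax1 G) where
  open SCG G

  adm : ℕ → Fin size → Bool
  adm i v = neqS (σ v (i ∸ 1)) (σ v i)

  InR : ℕ → Set
  InR = InRange G

  edge-range : ∀ {i v w} → Edge G i v w → InR i
  edge-range {i} {v} {w} = E-range i v w

  edge-sym : ∀ {i v w} → Edge G i v w → Edge G i w v
  edge-sym {i} {v} {w} e = trans (E-sym i w v) e

  opaque
    -- The E_i-neighbour of v, or v itself when there is none.
    nb : ℕ → Fin size → Fin size
    nb i v with m <? i | i <? n | bool-dec (adm i v)
    ... | yes p | yes q | inj₁ a = proj₁ (Equivalence.to (proj₁ (ax1 i (p , q)) v) (neqS-true a))
    ... | _ | _ | _ = v

    nb-edge : ∀ {i v} → InR i → adm i v ≡ true → Edge G i v (nb i v)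
    nb-edge {i} {v} (p , q) a with m <? i | i <? n | bool-dec (adm i v)
    ... | yes p' | yes q' | inj₁ a' = proj₂ (Equivalence.to (proj₁ (ax1 i (p' , q')) v) (neqS-true a'))
    ... | no ¬p | _ | _ = ⊥-elim (¬p p)
    ... | yes _ | no ¬q | _ = ⊥-elim (¬q q)
    ... | yes _ | yes _ | inj₂ b = ⊥-elim (true≢false a b)

    nb-fix : ∀ {i v} → adm i v ≡ false → nb i v ≡ v
    nb-fix {i} {v} a with m <? i | i <? n | bool-dec (adm i v)
    ... | yes _ | yes _ | inj₁ a' = ⊥-elim (true≢false a' a)
    ... | yes _ | yes _ | inj₂ _ = refl
    ... | yes _ | no _ | _ = refl
    ... | no _ | _ | _ = refl

    nb-out : ∀ {i v} → ¬ InR i → nb i v ≡ v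
    nb-out {i} {v} ¬r with m <? i | i <? n | bool-dec (adm i v)
    ... | yes p | yes q | inj₁ _ = ⊥-elim (¬r (p , q))
    ... | yes _ | yes _ | inj₂ _ = refl
    ... | yes _ | no _ | _ = refl
    ... | no _ | _ | _ = refl

  edge-adm : ∀ {i v w} → Edge G i v w → adm i v ≡ true
  edge-adm {i} {v} {w} e = neqS-true' (Equivalence.from (proj₁ (ax1 i (edge-range {i} {v} {w} e)) v) (w , e))

  edge-nb : ∀ {i v w} → Edge G i v w → nb i v ≡ w
  edge-nb {i} {v} {w} e = proj₂ (ax1 i r) v (nb i v) w (nb-edge r (edge-adm {i} {v} {w} e)) e
    where r = edge-range {i} {v} {w} e

  nb-cases : ∀ i v → (InR i × adm i v ≡ true × Edge G i v (nb i v)) ⊎ (nb i v ≡ v)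
  nb-cases i v = go (bool-dec (adm i v)) (m <? i) (i <? n)
    where
    go : adm i v ≡ true ⊎ adm i v ≡ false → Dec (m < i) → Dec (i < n) →
         (InR i × adm i v ≡ true × Edge G i v (nb i v)) ⊎ (nb i v ≡ v)
    go (inj₂ a) _ _ = inj₂ (nb-fix a)
    go (inj₁ a) (yes p) (yes q) = inj₁ ((p , q) , a , nb-edge (p , q) a)
    go (inj₁ a) (no ¬p) _ = inj₂ (nb-out (¬p ∘ proj₁))
    go (inj₁ a) (yes _) (no ¬q) = inj₂ (nb-out (¬q ∘ proj₂))

  nb-invol : ∀ i v → nb i (nb i v) ≡ v
  nb-invol i v with nb-cases i v
  ... | inj₁ (_ , _ , e) = edge-nb (edge-sym {i} {v} e)
  ... | inj₂ e = trans (cong (nb i) e) e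

  adm-nb : ∀ {i v} → InR i → adm i (nb i v) ≡ adm i v
  adm-nb {i} {v} r with nb-cases i v
  ... | inj₁ (_ , a , e) = trans (edge-adm (edge-sym {i} {v} e)) (sym a)
  ... | inj₂ e = cong (adm i) e

  nb-conn : ∀ {C : ℕ → Set} {i v} → (InR i → C i) → Conn G C v (nb i v)
  nb-conn {C} {i} {v} c with nb-cases i v
  ... | inj₁ (r , _ , e) = (i , c r , e) ◅ ε
  ... | inj₂ e = subst (Conn G C v) (sym e) ε

  conn-sym : ∀ {C v w} → Conn G C v w → Conn G C w v
  conn-sym ε = ε
  conn-sym {C} {v} (_◅_ {j = x} (i , c , e) p) = conn-sym p ◅◅ ((i , c , edge-sym {i} {v} {x} e) ◅ ε)

  conn-mono : ∀ {C D : ℕ → Set} {v w} → (∀ {j} → InR j → C j → D j) → Conn G C v w → Conn G D v w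
  conn-mono f ε = ε
  conn-mono {v = v} f (_◅_ {j = x} (i , c , e) p) = (i , f (edge-range {i} {v} {x} e) c , e) ◅ conn-mono f p

  -- Words are read from the largest letter `i + 1` downwards, so depth `t` belongs to colour
  -- `i ∸ t`.
  vrun : ℕ → List ℕ → Fin size → Fin size
  vrun i []       v = v
  vrun i (t ∷ ts) v = vrun i ts (nb (i ∸ t) v)

  -- What Axiom 4 gives on windows of four and of five consecutive letters.
  Double : ℕ → Set
  Double i = ∀ v → adm i v ≡ true → adm (i ∸ 1) v ≡ true →
    (adm i (nb (i ∸ 1) v) ≡ true ⊎ adm (i ∸ 1) (nb i v) ≡ true) → nb i v ≡ nb (i ∸ 1) v

  Square : ℕ → Set
  Square i = ∀ v → adm i v ≡ true → adm (i ∸ 2) v ≡ true →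
    adm i (nb (i ∸ 2) v) ≡ true → adm (i ∸ 2) (nb i v) ≡ true →
    (adm (i ∸ 1) (nb (i ∸ 2) v) ∧ adm i (nb (i ∸ 1) (nb (i ∸ 2) v))) ≡ false →
    nb i (nb (i ∸ 2) v) ≡ nb (i ∸ 2) (nb i v)

  module Far (ax2 : Ax2 G) (ax5 : Ax5 G) where

    σ-far : ∀ {i h v} → Defd G h → (h + 2 < i ⊎ i + 1 < h) → σ (nb i v) h ≡ σ v h
    σ-far {i} {h} {v} d o with nb-cases i v
    ... | inj₁ (_ , _ , e) = sym (proj₂ (proj₂ (ax2 i v (nb i v) e)) h d o)
    ... | inj₂ e = cong (λ x → σ x h) e

    σ-flip : ∀ {i v} → InR i → adm i v ≡ true → σ (nb i v) i ≡ negS (σ v i) × σ (nb i v) (i ∸ 1) ≡ negS (σ v (i ∸ 1))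
    σ-flip {i} {v} r a with ax2 i v (nb i v) (nb-edge r a)
    ... | p , q , _ = sym (trans (cong negS p) (negS-invol _)) , sym (trans (cong negS q) (negS-invol _))

    adm-far : ∀ {i j v} → InR j → (j + 2 < i ⊎ i + 2 < j) → adm j (nb i v) ≡ adm j v
    adm-far {i} {suc j} {v} (p , q) o = cong₂ neqS (σ-far {i} {j} {v} d₁ o₁) (σ-far {i} {suc j} {v} d₂ o₂)
      where
      d₁ : Defd G j
      d₁ = ≤-trans m-pos (≤-pred p) , ≤-trans (<⇒≤ q) n≤N
      d₂ : Defd G (suc j)
      d₂ = s≤s z≤n , ≤-trans q n≤N
      near : (suc j + 2 < i ⊎ i + 2 < suc j) → (j + 2 < i ⊎ i + 1 < j) × (suc j + 2 < i ⊎ i + 1 < suc j)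
      near (inj₁ l) = inj₁ (≤-trans (n≤1+n _) l) , inj₁ l
      near (inj₂ l) = let l' = ≤-pred (subst (_≤ suc j) (cong suc (+-suc i 1)) l) in
        inj₂ l' , inj₂ (≤-trans l' (n≤1+n j))
      o₁ = proj₁ (near o)
      o₂ = proj₂ (near o)

    -- Axiom 5 closes the square when both edges exist. An edge missing at `v` is missing at the
    -- other neighbour as well, since Axiom 2 keeps the relevant signs, and both sides then reduce
    -- to the same vertex.
    nb-comm : ∀ i j v → 2 < ∣ i - j ∣ → (j + 2 < i ⊎ i + 2 < j) → nb j (nb i v) ≡ nb i (nb j v)
    nb-comm i j v d o with nb-cases i v | nb-cases j v
    ... | inj₂ e | inj₂ e' = trans (cong (nb j) e) (trans e' (sym (trans (cong (nb i) e') e)))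
    ... | inj₁ (r , a , e) | inj₂ e' with nb-cases j (nb i v)
    ...   | inj₂ e'' = trans e'' (cong (nb i) (sym e'))
    ...   | inj₁ (r' , a' , _) = ⊥-elim (true≢false
            (subst (Edge G j v) e' (nb-edge r' (trans (sym (adm-far {i} {j} {v} r' o)) a'))) (E-irr j v))
    nb-comm i j v d o | inj₂ e | inj₁ (r , a , _) with nb-cases i (nb j v)
    ... | inj₂ e'' = trans (cong (nb j) e) (sym e'')
    ... | inj₁ (r' , a' , _) = ⊥-elim (true≢false
            (subst (Edge G i v) e (nb-edge r' (trans (sym (adm-far {j} {i} {v} r' (flip o))) a'))) (E-irr i v))
      where
      flip : (j + 2 < i ⊎ i + 2 < j) → (i + 2 < j ⊎ j + 2 < i)
      flip (inj₁ x) = inj₂ x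
      flip (inj₂ x) = inj₁ x
    nb-comm i j v d o | inj₁ (r , a , e) | inj₁ (r' , a' , e')
      with ax5 i j v (nb i v) (nb j (nb i v)) d e (nb-edge r' (trans (adm-far {i} {j} {v} r' o) a'))
    ... | y , f , g = trans (sym (edge-nb (edge-sym {i} {nb j (nb i v)} g))) (cong (nb i) (sym (edge-nb f)))

-- Local structure from Axioms 4 and 4⁺

active : ℕ → List ℕ → Bool
active zero    (z ∷ y ∷ x ∷ _) = not (between x y z)
active zero    _               = false
active (suc t) []              = false
active (suc t) (c ∷ w)         = active t w

∈-dd : ∀ t w {a} → a ∈ dd t w → a ∈ w
∈-dd zero (_ ∷ []) m = m
∈-dd zero (_ ∷ _ ∷ []) m = m
∈-dd zero (z ∷ y ∷ x ∷ u) m with between x y z | between y x z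
... | true | _ = m
∈-dd zero (z ∷ y ∷ x ∷ u) (here p) | false | true = there (here p)
∈-dd zero (z ∷ y ∷ x ∷ u) (there (here p)) | false | true = here p
∈-dd zero (z ∷ y ∷ x ∷ u) (there (there m)) | false | true = there (there m)
∈-dd zero (z ∷ y ∷ x ∷ u) (here p) | false | false = here p
∈-dd zero (z ∷ y ∷ x ∷ u) (there (here p)) | false | false = there (there (here p))
∈-dd zero (z ∷ y ∷ x ∷ u) (there (there (here p))) | false | false = there (here p)
∈-dd zero (z ∷ y ∷ x ∷ u) (there (there (there m))) | false | false = there (there (there m))
∈-dd (suc t) (c ∷ w) (here p) = here p
∈-dd (suc t) (c ∷ w) (there m) = there (∈-dd t w m)

∈-run : ∀ ts w {a} → a ∈ run ts w → a ∈ w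
∈-run [] w m = m
∈-run (t ∷ ts) w m = ∈-dd t w (∈-run ts (dd t w) m)

-- Order-preserving relabelling, standardization and finite enumeration

Mono : (ℕ → ℕ) → List ℕ → Set
Mono f w = ∀ {a b} → a ∈ w → b ∈ w → (f a <ᵇ f b) ≡ (a <ᵇ b)

between-cong : ∀ {f w x y z} → Mono f w → x ∈ w → y ∈ w → z ∈ w → between (f x) (f y) (f z) ≡ between x y z
between-cong m x y z = cong₂ _∨_ (cong₂ _∧_ (m x y) (m y z)) (cong₂ _∧_ (m z y) (m y x))

dd-map : ∀ {f} t w → Mono f w → dd t (map f w) ≡ map f (dd t w)
dd-map zero [] m = refl
dd-map zero (_ ∷ []) m = refl
dd-map zero (_ ∷ _ ∷ []) m = refl
dd-map {f} zero w@(z ∷ y ∷ x ∷ u) m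
  rewrite between-cong {f} {w} {x} {y} {z} m (there (there (here refl))) (there (here refl)) (here refl)
        | between-cong {f} {w} {y} {x} {z} m (there (here refl)) (there (there (here refl))) (here refl)
  with between x y z | between y x z
... | true | _ = refl
... | false | true = refl
... | false | false = refl
dd-map (suc t) [] m = refl
dd-map (suc t) (c ∷ w) m = cong (_ ∷_) (dd-map t w (λ p q → m (there p) (there q)))

run-map : ∀ {f} ts w → Mono f w → run ts (map f w) ≡ map f (run ts w)
run-map [] w m = refl
run-map (t ∷ ts) w m = trans (cong (run ts) (dd-map t w m)) (run-map ts (dd t w) (λ p q → m (∈-dd t w p) (∈-dd t w q)))

active-map : ∀ {f} t w → Mono f w → active t (map f w) ≡ active t w
active-map zero [] m = refl
active-map zero (_ ∷ []) m = refl
active-map zero (_ ∷ _ ∷ []) m = refl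
active-map {f} zero w@(z ∷ y ∷ x ∷ u) m = cong not (between-cong {f} {w} m (there (there (here refl))) (there (here refl)) (here refl))
active-map (suc t) [] m = refl
active-map (suc t) (c ∷ w) m = active-map t w (λ p q → m (there p) (there q))

mono-run : ∀ {f} ts w → Mono f w → Mono f (run ts w)
mono-run ts w m p q = m (∈-run ts w p) (∈-run ts w q)

-- On a word with distinct entries this is standardization. It turns a list of positions into a
-- permutation of `0, …, s − 1`, the range of the finite checks.
rank : List ℕ → ℕ → ℕ
rank []      p = 0
rank (q ∷ w) p = if q <ᵇ p then suc (rank w p) else rank w p

rank-mono : ∀ w {p p'} → p ≤ p' → rank w p ≤ rank w p'
rank-mono [] l = z≤n
rank-mono (q ∷ w) {p} {p'} l with q <? p
... | yes a rewrite <ᵇ-true a | <ᵇ-true (≤-trans a l) = s≤s (rank-mono w l)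
... | no a rewrite <ᵇ-false (≮⇒≥ a) with q <ᵇ p'
...   | true = ≤-trans (rank-mono w l) (n≤1+n _)
...   | false = rank-mono w l

rank-< : ∀ w {p p'} → p ∈ w → p < p' → rank w p < rank w p'
rank-< (q ∷ w) {p} {p'} (here refl) l rewrite <ᵇ-false (≤-refl {p}) | <ᵇ-true l = s≤s (rank-mono w (<⇒≤ l))
rank-< (q ∷ w) {p} {p'} (there m) l with q <? p
... | yes a rewrite <ᵇ-true a | <ᵇ-true (<-trans a l) = s≤s (rank-< w m l)
... | no a rewrite <ᵇ-false (≮⇒≥ a) with q <ᵇ p'
...   | true = ≤-trans (rank-< w m l) (n≤1+n _)
...   | false = rank-< w m l

rank-≤ : ∀ w p → rank w p ≤ length w
rank-≤ [] p = z≤n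
rank-≤ (q ∷ w) p with q <ᵇ p
... | true = s≤s (rank-≤ w p)
... | false = ≤-trans (rank-≤ w p) (n≤1+n _)

rank-bound : ∀ w {p} → p ∈ w → rank w p < length w
rank-bound (q ∷ w) {p} (here refl) rewrite <ᵇ-false (≤-refl {p}) = s≤s (rank-≤ w p)
rank-bound (q ∷ w) {p} (there m) with q <ᵇ p
... | true = s≤s (rank-bound w m)
... | false = ≤-trans (rank-bound w m) (n≤1+n _)

rank-Mono : ∀ w → Mono (rank w) w
rank-Mono w {a} {b} m m' with a <? b
... | yes l = trans (<ᵇ-true (rank-< w m l)) (sym (<ᵇ-true l))
... | no ¬l = trans (<ᵇ-false (rank-mono w (≮⇒≥ ¬l))) (sym (<ᵇ-false (≮⇒≥ ¬l)))

Mono-inj : ∀ {f w a b} → Mono f w → a ∈ w → b ∈ w → f a ≡ f b → a ≡ b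
Mono-inj {f} {w} {a} {b} m p q e = ≤-antisym (≮⇒≥ λ l → no-lt q p (sym e) l) (≮⇒≥ λ l → no-lt p q e l)
  where
  no-lt : ∀ {a b} → a ∈ w → b ∈ w → f a ≡ f b → ¬ a < b
  no-lt {a} {b} p q e l = true≢false (trans (m p q) (<ᵇ-true l)) (<ᵇ-false (≤-reflexive (sym e)))

map-inj : ∀ {f : ℕ → ℕ} {w} u v → (∀ {a} → a ∈ u → a ∈ w) → (∀ {a} → a ∈ v → a ∈ w) → Mono f w → map f u ≡ map f v → u ≡ v
map-inj [] [] _ _ _ _ = refl
map-inj (a ∷ u) (b ∷ v) iu iv m e =
  cong₂ _∷_ (Mono-inj m (iu (here refl)) (iv (here refl)) (cong (λ { [] → 0 ; (x ∷ _) → x }) e))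
    (map-inj u v (iu ∘ there) (iv ∘ there) m (cong (λ { [] → [] ; (_ ∷ x) → x }) e))

unique-map : ∀ {f : ℕ → ℕ} {w} → (∀ {a b} → a ∈ w → b ∈ w → f a ≡ f b → a ≡ b) → Unique w → Unique (map f w)
unique-map {f} {w} inj U = go w (λ p → p) U
  where
  go : ∀ u → (∀ {a} → a ∈ u → a ∈ w) → Unique u → Unique (map f u)
  go [] i [] = []
  go (a ∷ u) i (x ∷ U) = AllP.map⁺ (All.tabulate λ {b} b∈ e → All.lookup x b∈ (inj (i (here refl)) (i (there b∈)) e)) ∷ go u (i ∘ there) U

picks : List ℕ → List (ℕ × List ℕ)
picks []       = []
picks (x ∷ xs) = (x , xs) ∷ map (λ (y , r) → y , x ∷ r) (picks xs)

perms : ℕ → List ℕ → List (List ℕ)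
perms zero    xs = [] ∷ []
perms (suc k) xs = concatMap (λ (x , r) → map (x ∷_) (perms k r)) (picks xs)

pick : ∀ {x xs} → x ∈ xs → ∃[ r ] ((x , r) ∈ picks xs) × (∀ {y} → y ∈ xs → y ≢ x → y ∈ r)
pick {xs = x ∷ xs} (here refl) = xs , here refl , λ { (here p) ne → ⊥-elim (ne p) ; (there m) _ → m }
pick {xs = z ∷ xs} (there p) with pick p
... | r , m , f = z ∷ r , there (∈-map⁺ _ m) , λ { (here p) _ → here p ; (there q) ne → there (f q ne) }

∈-perms : ∀ {w} k xs → length w ≡ k → Unique w → (∀ {a} → a ∈ w → a ∈ xs) → w ∈ perms k xs
∈-perms {[]} zero xs l U i = here refl
∈-perms {a ∷ w} (suc k) xs l (x ∷ U) i with pick (i (here refl))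
... | r , m , f = ∈-concatMap⁺ (λ (x , r) → map (x ∷_) (perms k r))
  (Any.map (λ { refl → ∈-map⁺ (a ∷_) (∈-perms k r (suc-injective l) U λ b∈ → f (i (there b∈)) λ { refl → All.lookup x b∈ refl }) }) m)

eqL : List ℕ → List ℕ → Bool
eqL []      []      = true
eqL (a ∷ u) (b ∷ v) = (a ≡ᵇ b) ∧ eqL u v
eqL _       _       = false

∧-elim : ∀ {a b} → (a ∧ b) ≡ true → a ≡ true × b ≡ true
∧-elim {true} {true} _ = refl , refl

∧-intro : ∀ {a b} → a ≡ true → b ≡ true → (a ∧ b) ≡ true
∧-intro refl refl = refl

eqL-sound : ∀ u v → eqL u v ≡ true → u ≡ v
eqL-sound [] [] _ = refl
eqL-sound (a ∷ u) (b ∷ v) e = let p , q = ∧-elim e in cong₂ _∷_ (≡ᵇ-true⁻¹ p) (eqL-sound u v q)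

imp : Bool → Bool → Bool
imp a b = not a ∨ b

imp-elim : ∀ {a b} → imp a b ≡ true → a ≡ true → b ≡ true
imp-elim e refl = e

eqB : Bool → Bool → Bool
eqB true  b = b
eqB false b = not b

eqB-refl : ∀ {a b} → a ≡ b → eqB a b ≡ true
eqB-refl {true} refl = refl
eqB-refl {false} refl = refl

all-elim : ∀ {P : List ℕ → Bool} {xs x} → all P xs ≡ true → x ∈ xs → P x ≡ true
all-elim {xs = x ∷ xs} e (here refl) = proj₁ (∧-elim e)
all-elim {P} {xs = x ∷ xs} e (there m) = all-elim {P} {xs} (proj₂ (∧-elim {P x} e)) m

-- On four letters, a vertex with both colours has a neighbour with both colours only in the double
-- edge of shape (2,2), not in the three-vertex paths of (3,1) and (2,1,1). On five letters, the
-- outer two colours fail to commute at one vertex each of the components of (3,2) and (2,2,1); the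
-- last premise of `squareCheck` excludes it.
doubleCheck squareCheck : List ℕ → Bool
doubleCheck p = imp (active 0 p ∧ (active 1 p ∧ (active 0 (dd 1 p) ∨ active 1 (dd 0 p)))) (eqL (dd 0 p) (dd 1 p))
squareCheck p = imp (active 0 p ∧ (active 2 p ∧ (active 0 (dd 2 p) ∧ (active 2 (dd 0 p) ∧ not (active 1 (dd 2 p) ∧ active 0 (dd 1 (dd 2 p)))))))
                    (eqL (dd 0 (dd 2 p)) (dd 2 (dd 0 p)))

-- All that the graph reveals along a walk is which colours move a vertex, so words are compared
-- through activity alone, at the four depths of a six-letter word.
agree : List ℕ → List ℕ → List ℕ → Bool
agree []       w w' = true
agree (t ∷ ts) w w' = (eqB (active 0 w) (active 0 w') ∧ (eqB (active 1 w) (active 1 w') ∧ (eqB (active 2 w) (active 2 w') ∧ eqB (active 3 w) (active 3 w'))))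
                      ∧ agree ts (dd t w) (dd t w')

-- A closed walk of dual equivalences in SYT(3,2,1) whose largest letter visits all three corners.
loop : List ℕ
loop = 0 ∷ 2 ∷ 1 ∷ 3 ∷ 2 ∷ 0 ∷ 2 ∷ 3 ∷ 1 ∷ 0 ∷ 3 ∷ 1 ∷ 3 ∷ 2 ∷ []

loopCheck : List ℕ → List ℕ → Bool
loopCheck w p = imp (agree loop p w) (eqL (run loop p) p)

-- Fillings of the shape (3,2,1), up to the undetermined order of the contents of its cells (0,0) and (1,1).
staircases : List (List ℕ)
staircases = (0 ∷ 2 ∷ 1 ∷ 4 ∷ 3 ∷ 2 ∷ []) ∷ (0 ∷ 2 ∷ 1 ∷ 5 ∷ 4 ∷ 3 ∷ []) ∷ (0 ∷ 3 ∷ 1 ∷ 5 ∷ 4 ∷ 2 ∷ []) ∷ []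

-- Evaluation on 24 and 120 permutations here and below, and then on 720 permutations for each of
-- the three staircase fillings.
doubleCheck-all : all doubleCheck (perms 4 (upTo 4)) ≡ true
doubleCheck-all = refl

squareCheck-all : all squareCheck (perms 5 (upTo 5)) ≡ true
squareCheck-all = refl

loopCheck-all : all (λ w → all (loopCheck w) (perms 6 (upTo 6))) staircases ≡ true
loopCheck-all = refl

-- Position lists of consecutive letters

window : ℕ → ℕ → List ℕ
window a zero    = []
window a (suc s) = a ∷ window (a ∸ 1) s

length-window : ∀ a s → length (window a s) ≡ s
length-window a zero = refl
length-window a (suc s) = cong suc (length-window (a ∸ 1) s)

window-≤ : ∀ a s {b} → b ∈ window a s → b ≤ a
window-≤ a (suc s) (here refl) = ≤-refl
window-≤ a (suc s) (there m) = ≤-trans (window-≤ (a ∸ 1) s m) (m∸n≤m a 1)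

window-pos : ∀ a s {b} → s ≤ a → b ∈ window a s → 1 ≤ b
window-pos (suc a) (suc s) l (here refl) = s≤s z≤n
window-pos (suc a) (suc s) (s≤s l) (there m) = window-pos a s l m

window-unique : ∀ a s → s ≤ a → Unique (window a s)
window-unique a zero l = []
window-unique (suc a) (suc s) (s≤s l) =
  All.tabulate (λ {b} m e → <⇒≱ (s≤s (window-≤ a s m)) (≤-reflexive e)) ∷ window-unique a s l

∈-window : ∀ a s k → k < s → a ∸ k ∈ window a s
∈-window a (suc s) zero l = here refl
∈-window a (suc s) (suc k) (s≤s l) = there (subst (_∈ window (a ∸ 1) s) (∸-+-assoc a 1 k) (∈-window (a ∸ 1) s k l))

-- This list takes the role of a content word: the dual equivalences on reading words act on it by
-- `dd`.
positions : ℕ → ℕ → List ℕ → List ℕ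
positions a s w = map (λ b → pos b w) (window a s)

between-suc : ∀ (g : ℕ → ℕ) i b → between (g (i ∸ 1)) (g i) (g (i + 1)) ≡ b → between (g (i ∸ 1)) (g i) (g (suc i)) ≡ b
between-suc g i b = subst (λ j → between (g (i ∸ 1)) (g i) (g j) ≡ b) (+-comm i 1)

-- The letters moved by colour `i ∸ t` stand at depths `t`, `t + 1`, `t + 2` of the window headed by
-- `i + 1`. The bound `s ≤ suc i` keeps the truncated subtraction in `window` from producing the
-- letter 0.
positions-dd : ∀ t i s w → t + 3 ≤ s → s ≤ suc i →
  positions (suc i) s (dWord (i ∸ t) w) ≡ dd t (positions (suc i) s w)
positions-dd zero (suc (suc i)) (suc (suc (suc s))) w l (s≤s (s≤s (s≤s l')))
  = trans (cong₄ (λ p q r u → p ∷ q ∷ r ∷ u) (pos-dWord j w (suc j)) (pos-dWord j w j) (pos-dWord j w (suc i)) low) (main (dcase j w))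
  where
  j = suc (suc i)
  g = λ b → pos b w
  cong₄ : ∀ {A B C D E : Set} (f : A → B → C → D → E) {a a' b b' c c' d d'} → a ≡ a' → b ≡ b' → c ≡ c' → d ≡ d' → f a b c d ≡ f a' b' c' d'
  cong₄ f refl refl refl refl = refl
  rest = positions i s w
  low : positions i s (dWord j w) ≡ rest
  low = map-cong-local (All.tabulate λ {b} m → trans (pos-dWord j w b) (cong g (dVal-other j w b
    (<⇒≢ (s≤s (window-≤ i s m)))
    (<⇒≢ (≤-trans (s≤s (window-≤ i s m)) (n≤1+n _)))
    (<⇒≢ (≤-trans (s≤s (window-≤ i s m)) (≤-trans (n≤1+n _) (m≤m+n j 1)))))))
  main : DCase j w → g (dVal j w (suc j)) ∷ g (dVal j w j) ∷ g (dVal j w (suc i)) ∷ rest ≡ dd₃ (g (suc j)) (g j) (g (suc i)) rest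
  j+1 = +-comm j 1
  main (moves-none e f) =
    trans (cong₄ (λ p q r u → p ∷ q ∷ r ∷ u) (cong g (f (suc j))) (cong g (f j)) (cong g (f (suc i))) refl)
      (sym (dd-y rest (between⁻¹ {g (suc i)} {g j} {g (suc j)} (between-suc g j true e))))
  main (moves-upper e e' f) =
    trans (cong₄ (λ p q r u → p ∷ q ∷ r ∷ u)
            (cong g (trans (f' (suc j)) (swap-eqʳ j (suc j)))) (cong g (trans (f' j) (swap-eqˡ j (suc j))))
            (cong g (trans (f' (suc i)) (swap-other {j} {suc j} {suc i} (<⇒≢ ≤-refl) (<⇒≢ (s≤s (n≤1+n (suc i))))))) refl)
      (sym (dd-x rest (between⁻¹ {g j} {g (suc i)} {g (suc j)} (subst (λ k → between (g j) (g (suc i)) (g k) ≡ true) j+1 e'))))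
    where
    f' : ∀ x → dVal j w x ≡ swapV j (suc j) x
    f' x = trans (f x) (cong (λ k → swapV j k x) j+1)
  main (moves-lower e e' f) =
    trans (cong₄ (λ p q r u → p ∷ q ∷ r ∷ u)
            (cong g (trans (f (suc j)) (swap-other {suc i} {j} {suc j} (λ q → <⇒≢ {suc i} {suc j} (s≤s (n≤1+n (suc i))) (sym q)) 1+n≢n)))
            (cong g (trans (f j) (swap-eqʳ (suc i) j))) (cong g (trans (f (suc i)) (swap-eqˡ (suc i) j))) refl)
      (sym (dd₃-lower rest (between-suc g j false e) (subst (λ k → between (g j) (g (suc i)) (g k) ≡ false) j+1 e')))
    where
    dd₃-lower : ∀ {z y x} u → between x y z ≡ false → between y x z ≡ false → dd₃ z y x u ≡ z ∷ x ∷ y ∷ u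
    dd₃-lower u e e' rewrite e | e' = refl
positions-dd zero i (suc zero) w (s≤s ()) _
positions-dd zero i (suc (suc zero)) w (s≤s (s≤s ())) _
positions-dd zero zero (suc (suc (suc s))) w _ (s≤s ())
positions-dd zero (suc zero) (suc (suc (suc s))) w _ (s≤s (s≤s ()))
positions-dd (suc t) zero (suc zero) w (s≤s l) _ = ⊥-elim (n≮0 (subst (_≤ 0) (+-suc t 2) l))
positions-dd (suc t) zero (suc (suc s)) w _ (s≤s ())
positions-dd (suc t) (suc i) (suc s) w (s≤s l) (s≤s l') =
  cong₂ _∷_ (trans (pos-dWord (i ∸ t) w (suc (suc i))) (cong (λ b → pos b w) (dVal-other (i ∸ t) w (suc (suc i))
    (λ e → <⇒≢ (s≤s (≤-trans (≤-trans (m∸n≤m (i ∸ t) 1) (m∸n≤m i t)) (n≤1+n i))) (sym e))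
    (λ e → <⇒≢ (s≤s (≤-trans (m∸n≤m i t) (n≤1+n i))) (sym e))
    (λ e → <⇒≢ (s≤s (≤-trans (+-monoˡ-≤ 1 (m∸n≤m i t)) (≤-reflexive (+-comm i 1)))) (sym e)))))
  (positions-dd t i s w l l')

active-positions : ∀ t i s w → t + 3 ≤ s → s ≤ suc i →
  active t (positions (suc i) s w) ≡ not (between (pos (i ∸ t ∸ 1) w) (pos (i ∸ t) w) (pos (i ∸ t + 1) w))
active-positions zero (suc (suc i)) (suc (suc (suc s))) w l _ =
  cong (λ b → not (between (pos (suc i) w) (pos (suc (suc i)) w) (pos (suc (suc b)) w))) (+-comm 1 i)
active-positions zero i (suc zero) w (s≤s ()) _
active-positions zero i (suc (suc zero)) w (s≤s (s≤s ())) _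
active-positions zero zero (suc (suc (suc s))) w _ (s≤s ())
active-positions zero (suc zero) (suc (suc (suc s))) w _ (s≤s (s≤s ()))
active-positions (suc t) zero (suc zero) w (s≤s l) _ = ⊥-elim (n≮0 (subst (_≤ 0) (+-suc t 2) l))
active-positions (suc t) zero (suc (suc s)) w _ (s≤s ())
active-positions (suc t) (suc i) (suc s) w (s≤s l) (s≤s l') = active-positions t i s w l l'

-- The position list of a one-row tableau, on which no move is active; it models a component without
-- edges in the window.
descending : ℕ → List ℕ
descending zero    = []
descending (suc s) = s ∷ descending s

descending-< : ∀ s {a} → a ∈ descending s → a < s
descending-< (suc s) (here refl) = ≤-refl
descending-< (suc s) (there m) = ≤-trans (descending-< s m) (n≤1+n s)

descending-perm : ∀ s → descending s ∈ perms s (upTo s)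
descending-perm s = ∈-perms s (upTo s) (len s) (uni s) (λ m → ∈-upTo⁺ (descending-< s m))
  where
  len : ∀ s → length (descending s) ≡ s
  len zero = refl
  len (suc s) = cong suc (len s)
  uni : ∀ s → Unique (descending s)
  uni zero = []
  uni (suc s) = All.tabulate (λ m e → <⇒≢ (descending-< s m) (sym e)) ∷ uni s

private
  desc₃ : ∀ s → Btw s (suc s) (suc (suc s))
  desc₃ s = inj₁ (≤-refl , ≤-refl)

dd-descending : ∀ t s → dd t (descending s) ≡ descending s
dd-descending zero zero = refl
dd-descending zero (suc zero) = refl
dd-descending zero (suc (suc zero)) = refl
dd-descending zero (suc (suc (suc s))) = dd-y (descending s) (desc₃ s)
dd-descending (suc t) zero = refl
dd-descending (suc t) (suc s) = cong (s ∷_) (dd-descending t s)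

active-descending : ∀ t s → active t (descending s) ≡ false
active-descending zero zero = refl
active-descending zero (suc zero) = refl
active-descending zero (suc (suc zero)) = refl
active-descending zero (suc (suc (suc s))) = cong not (btw-true (desc₃ s))
active-descending (suc t) zero = refl
active-descending (suc t) (suc s) = active-descending t s

run-descending : ∀ ts s → run ts (descending s) ≡ descending s
run-descending [] s = refl
run-descending (t ∷ ts) s = trans (cong (run ts) (dd-descending t s)) (run-descending ts s)

gconn-SYT : ∀ {sizes C T U} → IsSYT sizes T → GConn sizes C T U → IsSYT sizes U
gconn-SYT s ε = s
gconn-SYT s ((j , c , inj₁ (_ , _ , _ , t , _)) ◅ p) = gconn-SYT t p
gconn-SYT s ((j , c , inj₂ (_ , _ , t , _ , _)) ◅ p) = gconn-SYT t p

Fits : ℕ → List ℕ → Set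
Fits s = All (λ t → t + 3 ≤ s)

module _ (G : SCG) (ax1 : Ax1 G) where
  open SCG G
  open Vert G ax1

  -- What is retained of an isomorphism from Axiom 4: a permutation on which the same colours are
  -- active along every walk from `v₀`, and such that walks meeting on the permutation meet in the
  -- graph.
  record Sim (i s : ℕ) (v₀ : Fin size) : Set where
    field
      π      : List ℕ
      π∈     : π ∈ perms s (upTo s)
      status : ∀ ts t → Fits s ts → t + 3 ≤ s → adm (i ∸ t) (vrun i ts v₀) ≡ active t (run ts π)
      close  : ∀ ts ts' → Fits s ts → Fits s ts' → run ts π ≡ run ts' π → vrun i ts v₀ ≡ vrun i ts' v₀

  module _ (ax3 : Ax3 G) {C : ℕ → Set} {i s : ℕ} {v₀ : Fin size} (3≤s : 3 ≤ s) (s≤ : s ≤ suc i)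
           (colors : ∀ t → t + 3 ≤ s → InR (i ∸ t) × C (i ∸ t)) where

    private
      vrun-conn : ∀ ts {v} → Fits s ts → Conn G C v₀ v → Conn G C v₀ (vrun i ts v)
      vrun-conn [] [] c = c
      vrun-conn (t ∷ ts) (p ∷ ps) c = vrun-conn ts ps (c ◅◅ nb-conn (λ _ → proj₂ (colors t p)))

      still-sim : (∀ t {v} → t + 3 ≤ s → Conn G C v₀ v → adm (i ∸ t) v ≡ false) → Sim i s v₀
      still-sim none = record
        { π = descending s ; π∈ = descending-perm s
        ; status = λ ts t f l → trans (none t l (vrun-conn ts f ε))
                     (sym (trans (cong (active t) (run-descending ts s)) (active-descending t s)))
        ; close = λ ts ts' f f' _ → trans (still ts f) (sym (still ts' f')) }
        where
        still : ∀ ts → Fits s ts → vrun i ts v₀ ≡ v₀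
        still [] _ = refl
        still (t ∷ ts) (p ∷ ps) = trans (cong (vrun i ts) (nb-fix (none t p ε))) (still ts ps)

    -- The permutation is the standardized list of positions of the letters `i + 1, …, i + 2 − s` in
    -- the reading word of `f v₀`. Colours of the window leave all other letters in place, so equal
    -- position lists give equal tableaux, and `g` makes the vertices equal.
    local-sim : CompIso G C v₀ → Sim i s v₀
    local-sim (sizes , T₀ , part , syt₀ , f , g , F , K , Ed) = decide (i <? sum sizes)
      where
      module _ (big : i < sum sizes) where
        syt : ∀ {v} → Conn G C v₀ v → IsSYT sizes (f v)
        syt c = gconn-SYT syt₀ (proj₁ (F _ c))

        w : Fin size → List ℕ
        w v = readingWord (f v)

        btwAt : ℕ → Fin size → Bool
        btwAt j v = between (pos (j ∸ 1) (w v)) (pos j (w v)) (pos (j + 1) (w v))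

        step : ∀ {j v} → InR j → C j → j < sum sizes → Conn G C v₀ v →
               f (nb j v) ≡ dTab j (f v) × adm j v ≡ not (btwAt j v)
        step {j} {v} r cj l c = go (bool-dec (adm j v)) (bool-dec (btwAt j v))
          where
          1<j : 1 < j
          1<j = ≤-trans (s≤s m-pos) (proj₁ r)
          fixes : btwAt j v ≡ true → dTab j (f v) ≡ f v
          fixes e = map-map-id (λ x → dsel-fixed j {pos (j ∸ 1) (w v)} {pos j (w v)} {pos (j + 1) (w v)} x e) (f v)
          go : adm j v ≡ true ⊎ adm j v ≡ false → btwAt j v ≡ true ⊎ btwAt j v ≡ false →
               f (nb j v) ≡ dTab j (f v) × adm j v ≡ not (btwAt j v)
          go (inj₂ a) (inj₁ b) = trans (cong f (nb-fix a)) (sym (fixes b)) , trans a (cong not (sym b))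
          go (inj₁ a) _ = eq , trans a (cong not (sym (¬-not λ t → proj₂ (unify ge) (trans eq (fixes t)))))
            where
            e : Edge G j v (nb j v)
            e = nb-edge r a
            ge : GEdge sizes j (f v) (f (nb j v))
            ge = Equivalence.to (Ed j v (nb j v) cj c (c ◅◅ ((j , cj , e) ◅ ε))) e
            unify : GEdge sizes j (f v) (f (nb j v)) → f (nb j v) ≡ dTab j (f v) × f (nb j v) ≢ f v
            unify (inj₁ (_ , _ , _ , _ , e , ne)) = e , ne
            unify (inj₂ (p , _ , _ , _ , e , ne)) =
              trans (sym (dTab-invol j (f (nb j v)) (<⇒≤ p))) (cong (dTab j) (sym e)) , ne ∘ sym
            eq = proj₁ (unify ge)
          -- A tableau that moves has its neighbour in the image component, and `g` carries this
          -- edge back to an edge at `v`.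
          go (inj₂ a) (inj₂ b) = ⊥-elim (true≢false (edge-adm {j} {v} {proj₁ (at' ge)} (proj₂ (at' ge))) a)
            where
            module Y = SYT part (syt c)
            ge : GEdge sizes j (f v) (dTab j (f v))
            ge = inj₁ (1<j , l , syt c , Y.dTab-SYT j 1<j l , refl , Y.moved j 1<j l b)
            at' : GEdge sizes j (f v) (dTab j (f v)) → ∃[ x ] Edge G j v x
            at' ge with K (dTab j (f v)) (proj₁ (F v c) ◅◅ ((j , cj , ge) ◅ ε))
            ... | c' , e = g (dTab j (f v)) , Equivalence.from (Ed j v _ cj c c') (subst (GEdge sizes j (f v)) (sym e) ge)

        P : Fin size → List ℕ
        P v = positions (suc i) s (w v)

        small : ∀ t → i ∸ t < sum sizes
        small t = ≤-trans (s≤s (m∸n≤m i t)) big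

        P-run : ∀ ts {v} → Fits s ts → Conn G C v₀ v → P (vrun i ts v) ≡ run ts (P v)
        P-run [] _ _ = refl
        P-run (t ∷ ts) {v} (p ∷ ps) c =
          let r , cj = colors t p in
          trans (P-run ts ps (c ◅◅ nb-conn (λ _ → cj)))
            (cong (run ts) (trans (cong (positions (suc i) s)
              (trans (cong readingWord (proj₁ (step r cj (small t) c))) (dTab-word (i ∸ t) (f v))))
              (positions-dd t i s (w v) p s≤)))

        pos-outside : ∀ ts {v x} → Fits s ts → Conn G C v₀ v → x ∉ window (suc i) s → pos x (w (vrun i ts v)) ≡ pos x (w v)
        pos-outside [] _ _ _ = refl
        pos-outside (t ∷ ts) {v} {x} (p ∷ ps) c x∉ =
          let r , cj = colors t p in
          trans (pos-outside ts ps (c ◅◅ nb-conn (λ _ → cj)) x∉)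
          (trans (cong (pos x ∘ readingWord) (proj₁ (step r cj (small t) c)))
          (trans (cong (pos x) (dTab-word (i ∸ t) (f v)))
          (trans (pos-dWord (i ∸ t) (w v) x)
          (cong (λ y → pos y (w v)) (dVal-other (i ∸ t) (w v) x
            (λ { refl → x∉ (subst (_∈ window (suc i) s) (sym (∸-1-suc (suc t))) (∈-window (suc i) s (suc (suc t)) (≤-trans (≤-reflexive (+-comm 3 t)) p))) })
            (λ { refl → x∉ (∈-window (suc i) s (suc t) (≤-trans (n≤1+n _) (≤-trans (≤-reflexive (+-comm 3 t)) p))) })
            (λ { refl → x∉ (subst (_∈ window (suc i) s) (sym (∸-+1 t p)) (∈-window (suc i) s t (≤-trans (≤-trans (n≤1+n _) (n≤1+n _)) (≤-trans (≤-reflexive (+-comm 3 t)) p)))) }))))))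
          where
          ∸-1-suc : ∀ k → suc i ∸ k ∸ 1 ≡ suc i ∸ suc k
          ∸-1-suc k = trans (∸-+-assoc (suc i) k 1) (cong (suc i ∸_) (+-comm k 1))
          ∸-+1 : ∀ t → t + 3 ≤ s → i ∸ t + 1 ≡ suc i ∸ t
          ∸-+1 t p = trans (+-comm (i ∸ t) 1) (sym (+-∸-assoc 1 (≤-pred (≤-trans (≤-trans (≤-trans (s≤s (m≤m+n t 2)) (≤-reflexive (sym (+-suc t 2)))) p) s≤))))

        P₀ = P v₀
        r₀ = rank P₀

        mono₀ : Mono r₀ P₀
        mono₀ = rank-Mono P₀

        unique₀ : Unique P₀
        unique₀ = unique-map (λ a∈ _ e → pos-injective (Y.mem (window-pos (suc i) s s≤ a∈) (≤-trans (window-≤ (suc i) s a∈) big)) e)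
                    (window-unique (suc i) s s≤)
          where module Y = SYT part (syt ε)

        length₀ : length P₀ ≡ s
        length₀ = trans (length-map _ (window (suc i) s)) (length-window (suc i) s)

        sim : Sim i s v₀
        sim = record
          { π = map r₀ P₀
          ; π∈ = ∈-perms s (upTo s) (trans (length-map r₀ P₀) length₀) (unique-map (Mono-inj {r₀} {P₀} mono₀) unique₀)
                   λ m → let b , b∈ , e = ∈-map⁻ r₀ m in
                     ∈-upTo⁺ (subst₂ _<_ (sym e) length₀ (rank-bound P₀ b∈))
          ; status = λ ts t fs l → let r , cj = colors t l ; c = vrun-conn ts fs ε in
              trans (proj₂ (step r cj (small t) c))
              (trans (sym (active-positions t i s (w (vrun i ts v₀)) l s≤))
              (trans (cong (active t) (P-run ts fs ε))
              (trans (sym (active-map t (run ts P₀) (mono-run {r₀} ts P₀ mono₀)))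
              (cong (active t) (sym (run-map ts P₀ mono₀))))))
          ; close = λ ts ts' fs fs' e → let
                c = vrun-conn ts fs ε ; c' = vrun-conn ts' fs' ε
                eP : P (vrun i ts v₀) ≡ P (vrun i ts' v₀)
                eP = trans (P-run ts fs ε) (trans
                       (map-inj (run ts P₀) (run ts' P₀) (∈-run ts P₀) (∈-run ts' P₀) mono₀
                         (trans (sym (run-map ts P₀ mono₀)) (trans e (run-map ts' P₀ mono₀))))
                       (sym (P-run ts' fs' ε)))
                ew : w (vrun i ts v₀) ≡ w (vrun i ts' v₀)
                ew = words-from-pos (unique-letters (proj₂ (proj₂ (proj₂ (syt c)))))
                       (trans (↭-length (proj₂ (proj₂ (proj₂ (syt c))))) (sym (↭-length (proj₂ (proj₂ (proj₂ (syt c')))))))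
                       (λ {x} _ → same-pos x (mem? x (window (suc i) s)) ts ts' fs fs' eP)
              in trans (sym (proj₂ (F _ c))) (trans (cong g (tab-from-word _ _ (trans (proj₁ (syt c)) (sym (proj₁ (syt c')))) ew)) (proj₂ (F _ c')))
          }
          where
          lookup-eq : ∀ {h k : ℕ → ℕ} {xs x} → map h xs ≡ map k xs → x ∈ xs → h x ≡ k x
          lookup-eq {xs = x ∷ xs} e (here refl) = cong (λ { [] → 0 ; (y ∷ _) → y }) e
          lookup-eq {xs = x ∷ xs} e (there m) = lookup-eq {xs = xs} (cong (λ { [] → [] ; (_ ∷ y) → y }) e) m
          same-pos : ∀ x → Dec (x ∈ window (suc i) s) → ∀ ts ts' → Fits s ts → Fits s ts' →
                     P (vrun i ts v₀) ≡ P (vrun i ts' v₀) → pos x (w (vrun i ts v₀)) ≡ pos x (w (vrun i ts' v₀))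
          same-pos x (yes m) ts ts' fs fs' eP = lookup-eq {xs = window (suc i) s} eP m
          same-pos x (no ¬m) ts ts' fs fs' eP = trans (pos-outside ts fs ε ¬m) (sym (pos-outside ts' fs' ε ¬m))

      -- Tableaux too small for the window have no i-edges; Axiom 3 then excludes all lower colours of the window.
      none : ¬ (i < sum sizes) → ∀ t {v} → t + 3 ≤ s → Conn G C v₀ v → adm (i ∸ t) v ≡ false
      none ¬big t {v} l c = ¬-not (go t l c)
        where
        go : ∀ t {v} → t + 3 ≤ s → Conn G C v₀ v → adm (i ∸ t) v ≡ true → ⊥
        go t {v} l c a with colors t l
        go zero {v} l c a | r , cj = ¬big (bound (Equivalence.to (Ed i v (nb i v) cj c (c ◅◅ ((i , cj , e) ◅ ε))) e))
          where
          e = nb-edge r a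
          bound : ∀ {T U} → GEdge sizes i T U → i < sum sizes
          bound (inj₁ (_ , q , _)) = q
          bound (inj₂ (_ , q , _)) = q
        go (suc t) {v} l c a | r , cj with colors t (≤-trans (n≤1+n _) l)
        ... | r' , _ = again (proj₂ (ax3 (i ∸ suc t) v (nb (i ∸ suc t) v) (nb-edge r a)) defd)
          where
          t<i : suc t ≤ i
          t<i = ≤-pred (≤-trans (≤-trans (≤-trans (s≤s (s≤s (m≤m+n t 1))) (≤-reflexive (cong suc (sym (+-suc t 1))))) (≤-trans (s≤s (+-monoʳ-≤ t (n≤1+n 2))) l)) s≤)
          up : i ∸ suc t + 1 ≡ i ∸ t
          up = trans (+-comm _ 1) (sym (+-∸-assoc 1 t<i))
          defd : Defd G (i ∸ suc t + 1)
          defd = subst (λ j → (1 ≤ j) × (j < N)) (sym up) (≤-trans m-pos (<⇒≤ (proj₁ r')) , ≤-trans (proj₂ r') n≤N)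
          again : Admits G (i ∸ suc t + 1) v ⊎ Admits G (i ∸ suc t + 1) (nb (i ∸ suc t) v) → ⊥
          again (inj₁ x) = go t (≤-trans (n≤1+n _) l) c (neqS-true' (subst (λ j → Admits G j v) up x))
          again (inj₂ x) = go t (≤-trans (n≤1+n _) l) (c ◅◅ nb-conn (λ _ → cj))
                             (neqS-true' (subst (λ j → Admits G j (nb (i ∸ suc t) v)) up x))

      decide : Dec (i < sum sizes) → Sim i s v₀
      decide (yes big) = sim big
      decide (no ¬big) = still-sim (none ¬big)

  sim-double : ∀ {i} → (∀ v → Sim i 4 v) → Double i
  sim-double {i} sim v a₀ a₁ o = close (0 ∷ []) (1 ∷ []) (f₀ ∷ []) (f₁ ∷ [])
      (eqL-sound _ _ (imp-elim (all-elim {doubleCheck} {perms 4 (upTo 4)} doubleCheck-all π∈)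
        (∧-intro (trans (sym (status [] 0 [] f₀)) a₀) (∧-intro (trans (sym (status [] 1 [] f₁)) a₁) (either o)))))
    where
    open Sim (sim v)
    f₀ : 3 ≤ 4
    f₀ = s≤s (s≤s (s≤s z≤n))
    f₁ : 4 ≤ 4
    f₁ = ≤-refl
    either : adm i (nb (i ∸ 1) v) ≡ true ⊎ adm (i ∸ 1) (nb i v) ≡ true → (active 0 (dd 1 π) ∨ active 1 (dd 0 π)) ≡ true
    either (inj₁ x) rewrite trans (sym (status (1 ∷ []) 0 (f₁ ∷ []) f₀)) x = refl
    either (inj₂ x) rewrite trans (sym (status (0 ∷ []) 1 (f₀ ∷ []) f₁)) x = ∨-zeroʳ _

  sim-square : ∀ {i} → (∀ v → Sim i 5 v) → Square i
  sim-square {i} sim v a₀ a₂ a₂₀ a₀₂ ne = close (2 ∷ 0 ∷ []) (0 ∷ 2 ∷ []) (f₂ ∷ f₀ ∷ []) (f₀ ∷ f₂ ∷ [])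
      (eqL-sound _ _ (imp-elim (all-elim {squareCheck} {perms 5 (upTo 5)} squareCheck-all π∈)
        (∧-intro (trans (sym (status [] 0 [] f₀)) a₀)
        (∧-intro (trans (sym (status [] 2 [] f₂)) a₂)
        (∧-intro (trans (sym (status (2 ∷ []) 0 (f₂ ∷ []) f₀)) a₂₀)
        (∧-intro (trans (sym (status (0 ∷ []) 2 (f₀ ∷ []) f₂)) a₀₂)
          (cong not (trans (sym (cong₂ _∧_ (status (2 ∷ []) 1 (f₂ ∷ []) f₁) (status (2 ∷ 1 ∷ []) 0 (f₂ ∷ f₁ ∷ []) f₀))) ne))))))))
    where
    open Sim (sim v)
    f₀ : 3 ≤ 5
    f₀ = s≤s (s≤s (s≤s z≤n))
    f₁ : 4 ≤ 5
    f₁ = s≤s (s≤s (s≤s (s≤s z≤n)))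
    f₂ : 5 ≤ 5
    f₂ = ≤-refl

  -- The permutation supplied by the `Sim` need not be `w`. The check therefore covers every
  -- permutation whose activities along `loop` are those of `w`.
  sim-loop : ∀ {i v w} → Sim i 6 v → w ∈ staircases →
    (∀ ts t → Fits 6 ts → t + 3 ≤ 6 → adm (i ∸ t) (vrun i ts v) ≡ active t (run ts w)) → vrun i loop v ≡ v
  sim-loop {i} {v} {w} sim w∈ h = close loop [] fits [] (eqL-sound _ _ (imp-elim
      (all-elim {loopCheck w} {perms 6 (upTo 6)} (all-elim {λ w → all (loopCheck w) (perms 6 (upTo 6))} loopCheck-all w∈) π∈)
      (agrees [] loop [] fits)))
    where
    open Sim sim
    f₀ : 3 ≤ 6
    f₀ = s≤s (s≤s (s≤s z≤n))
    f₁ : 4 ≤ 6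
    f₁ = s≤s (s≤s (s≤s (s≤s z≤n)))
    f₂ : 5 ≤ 6
    f₂ = n≤1+n 5
    f₃ : 6 ≤ 6
    f₃ = ≤-refl
    fits : Fits 6 loop
    fits = f₀ ∷ f₂ ∷ f₁ ∷ f₃ ∷ f₂ ∷ f₀ ∷ f₂ ∷ f₃ ∷ f₁ ∷ f₀ ∷ f₃ ∷ f₁ ∷ f₃ ∷ f₂ ∷ []
    agrees : ∀ ps ts → Fits 6 ps → Fits 6 ts → agree ts (run ps π) (run ps w) ≡ true
    agrees ps [] _ _ = refl
    agrees ps (t ∷ ts) fp (f ∷ fs) =
      ∧-intro (∧-intro (eq 0 f₀) (∧-intro (eq 1 f₁) (∧-intro (eq 2 f₂) (eq 3 f₃))))
        (subst₂ (λ x y → agree ts x y ≡ true) (run-++ ps (t ∷ []) π) (run-++ ps (t ∷ []) w)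
          (agrees (ps ++ t ∷ []) ts (AllP.++⁺ fp (f ∷ [])) fs))
      where
      eq : ∀ k → k + 3 ≤ 6 → eqB (active k (run ps π)) (active k (run ps w)) ≡ true
      eq k l = eqB-refl (trans (sym (status ps k fp l)) (h ps k fp l))

-- Covers and their extension by one letter

neq-sgn : ∀ {x y z} → x ≢ y → y ≢ z → neqS (sgn x y) (sgn y z) ≡ not (between x y z)
neq-sgn {x} {y} {z} xy yz with <-cmp x y | <-cmp y z
... | tri≈ _ e _ | _ = ⊥-elim (xy e)
... | _ | tri≈ _ e _ = ⊥-elim (yz e)
... | tri< a _ _ | tri< b _ _ rewrite sgn-plus a | sgn-plus b | btw-true (inj₁ (a , b)) = refl
... | tri> _ _ a | tri> _ _ b rewrite sgn-minus (<⇒≤ a) | sgn-minus (<⇒≤ b) | btw-true (inj₂ (b , a)) = refl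
... | tri< a _ _ | tri> _ _ b rewrite sgn-plus a | sgn-minus (<⇒≤ b) | <ᵇ-false (<⇒≤ b) | <ᵇ-false (<⇒≤ a) | <ᵇ-true a | <ᵇ-true b = refl
... | tri> _ _ a | tri< b _ _ rewrite sgn-minus (<⇒≤ a) | sgn-plus b | <ᵇ-false (<⇒≤ b) | <ᵇ-false (<⇒≤ a) = refl

hd : List ℕ → ℕ
hd []      = 0
hd (c ∷ _) = c

tl : List ℕ → List ℕ
tl []      = []
tl (_ ∷ w) = w

last-true : ∀ (s : ℕ → Bool) p → s 0 ≡ true → s p ≡ false →
  ∃[ c ] (c < p) × s c ≡ true × (∀ q → c < q → q ≤ p → s q ≡ false)
last-true s zero a b = ⊥-elim (true≢false a b)
last-true s (suc p) a b with bool-dec (s p)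
... | inj₁ t = p , ≤-refl , t , λ q l l' → subst (λ q → s q ≡ false) (≤-antisym l l') b
... | inj₂ f with last-true s p a f
... | c , l , t , h = c , m≤n⇒m≤1+n l , t , λ q l₁ l₂ → case' q l₁ l₂ (m≤n⇒m<n∨m≡n l₂)
  where
  case' : ∀ q → c < q → q ≤ suc p → q < suc p ⊎ q ≡ suc p → s q ≡ false
  case' q l₁ l₂ (inj₁ (s≤s l₃)) = h q l₁ l₃
  case' q l₁ l₂ (inj₂ refl) = b

module Rigid (M : ℕ) where
  open Words M

  -- The tails agree by induction. Every removable corner of the tail can be brought next to the
  -- last letter, where the sign at depth 0 compares it with `c` and with `c'`; `add-separated` then
  -- gives `c ≡ c'`.
  rigid : ∀ u u' → Valid u → Valid u' → length u ≡ length u' →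
    (∀ ts t → suc (suc t) ≤ length u → signAt t (run ts u) ≡ signAt t (run ts u')) → u ≡ u'
  rigid [] [] _ _ _ _ = refl
  rigid (c ∷ w) (c' ∷ w') (A ∷ v) (A' ∷ v') l h
    with rigid w w' v v' (suc-injective l) (λ ts t b →
           trans (sym (cong (signAt (suc t)) (run-suc ts c w))) (trans (h (map suc ts) (suc t) (s≤s b)) (cong (signAt (suc t)) (run-suc ts c' w'))))
  ... | refl = cong (_∷ w) (add-separated A A' (λ x r → compare x r (same x r)) (λ x r → compare x r (sym (same x r))))
    where
    long : ∀ {x} w → Rem x (sh w) → 2 ≤ suc (length w)
    long [] r = ⊥-elim (vacuum-rem r)
    long (_ ∷ _) r = s≤s (s≤s z≤n)
    same : ∀ x → Rem x (sh w) → sgn x c ≡ sgn x c'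
    same x r with run-to-last v r
    ... | ts , u , e , _ =
      trans (sym (cong (signAt 0) (trans (run-suc ts c w) (cong (c ∷_) e))))
        (trans (h (map suc ts) 0 (long w r)) (cong (signAt 0) (trans (run-suc ts c' w) (cong (c' ∷_) e))))
    compare : ∀ {c c'} x → Rem x (sh w) → sgn x c ≡ sgn x c' → x < c → x < c'
    compare x r e l = sgn-plus⁻¹ (trans (sym e) (sgn-plus l))

module Covers (G : SCG) (ax1 : Ax1 G) (ax2 : Ax2 G) (ax3 : Ax3 G) (ax5 : Ax5 G) where
  open SCG G
  open Vert G ax1
  open Far ax2 ax5
  open Words n
  open Rigid n

  Upto : ℕ → ℕ → Set
  Upto i j = (m < j) × (j ≤ i)

  Comp : ℕ → Fin size → Fin size → Set
  Comp i = Conn G (Upto i)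

  -- A vertex map to content words of length i ∸ m + 2 (the letters m, …, i + 1) that matches
  -- signatures and colours m + 1, …, i ∸ 1; for a cover it also matches the colour i.
  record PreCover (i : ℕ) : Set where
    field
      φ     : Fin size → List ℕ
      len   : ∀ v → length (φ v) ≡ 2 + (i ∸ m)
      valid : ∀ v → Valid (φ v)
      sign  : ∀ t v → t ≤ i ∸ m → σ v (i ∸ t) ≡ signAt t (φ v)
      move  : ∀ t v → φ (nb (i ∸ suc t) v) ≡ dd (suc t) (φ v)

    Top : Set
    Top = ∀ v → φ (nb i v) ≡ dd 0 (φ v)

    moves : Top → ∀ t v → φ (nb (i ∸ t) v) ≡ dd t (φ v)
    moves top zero v = top v
    moves top (suc t) v = move t v

    φ-run : Top → ∀ ts v → φ (vrun i ts v) ≡ run ts (φ v)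
    φ-run top [] v = refl
    φ-run top (t ∷ ts) v = trans (φ-run top ts (nb (i ∸ t) v)) (cong (run ts) (moves top t v))

    φ-run-suc : ∀ ts v → φ (vrun i (map suc ts) v) ≡ run (map suc ts) (φ v)
    φ-run-suc [] v = refl
    φ-run-suc (t ∷ ts) v = trans (φ-run-suc ts (nb (i ∸ suc t) v)) (cong (run (map suc ts)) (move t v))

    adm-active : ∀ t v → t + 3 ≤ length (φ v) → adm (i ∸ t) v ≡ active t (φ v)
    adm-active t v l = trans (cong₂ neqS (trans (cong (σ v) (trans (∸-+-assoc i t 1) (cong (i ∸_) (+-comm t 1)))) (sign (suc t) v b)) (sign t v (≤-trans (n≤1+n t) b)))
                     (go t (φ v) (valid v) l)
      where
      b : suc t ≤ i ∸ m
      b = ≤-pred (≤-pred (subst₂ _≤_ (+-comm t 3) (len v) l))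
      go : ∀ t w → Valid w → t + 3 ≤ length w → neqS (signAt (suc t) w) (signAt t w) ≡ active t w
      go zero (z ∷ y ∷ x ∷ u) v l = let a , b , _ = distinct v in neq-sgn a b
      go zero (_ ∷ []) v (s≤s ())
      go zero (_ ∷ _ ∷ []) v (s≤s (s≤s ()))
      go (suc t) (c ∷ w) (_ ∷ v) (s≤s l) = go t w v l

  open PreCover public using (Top)

  Inj : ∀ {i} → PreCover i → ℕ → Set
  Inj c j = ∀ v w → Comp j v w → PreCover.φ c v ≡ PreCover.φ c w → v ≡ w

  run-comp : ∀ i ts v → Comp i v (vrun i ts v)
  run-comp i [] v = ε
  run-comp i (t ∷ ts) v = nb-conn (λ r → proj₁ r , m∸n≤m i t) ◅◅ run-comp i ts (nb (i ∸ t) v)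

  run-comp-suc : ∀ i ts v → Comp i v (vrun (suc i) (map suc ts) v)
  run-comp-suc i [] v = ε
  run-comp-suc i (t ∷ ts) v = nb-conn (λ r → proj₁ r , m∸n≤m i t) ◅◅ run-comp-suc i ts (nb (i ∸ t) v)

  cover-shape : ∀ {i} (c : PreCover i) → Top c → ∀ {v w} → Comp i v w → sh (PreCover.φ c v) ≗ sh (PreCover.φ c w)
  cover-shape c top ε p = refl
  cover-shape {i} c top {v} (_◅_ {j = x} (j , (_ , j≤i) , e) q) = ≗-trans
    (≗-sym (subst (λ u → sh u ≗ sh (φ v)) (trans (sym (moves top (i ∸ j) v)) (cong φ (trans (cong (λ k → nb k v) (m∸[m∸n]≡n j≤i)) (edge-nb e))))
      (proj₂ (dd-valid (i ∸ j) (valid v)))))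
    (cover-shape c top q)
    where open PreCover c hiding (Top)

  module Extend {i} (c : PreCover i) (top : Top c) (inj : Inj c i) (m≤i : m ≤ i) (I<n : suc i < n) where
    open PreCover c

    comp-shape : ∀ {v w} → Comp i v w → sh (φ v) ≗ sh (φ w)
    comp-shape = cover-shape c top

    lift : ∀ v w → Valid w → length (φ v) ≡ length w → sh (φ v) ≗ sh w → ∃[ v' ] Comp i v v' × φ v' ≡ w
    lift v w vw l e = let ts , q = same-shape-connected (φ v) w (valid v) vw l e in
      vrun i ts v , run-comp i ts v , trans (φ-run top ts v) q

    defd : Defd G (suc i)
    defd = s≤s z≤n , ≤-trans I<n n≤N

    opaque
      -- The tails have the same shape, so moves of depth at least 1 join them. Their colours are at
      -- most `i − 1` and leave the sign at `i + 1` unchanged by Axiom 2, and injectivity identifies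
      -- the endpoint of the walk with `w`.
      same-head : ∀ {v w x u u'} → Comp i v w → φ v ≡ x ∷ u → φ w ≡ x ∷ u' → σ v (suc i) ≡ σ w (suc i)
      same-head {v} {w} {x} {u} {u'} cvw e e'
        with same-shape-connected u u' (tailV {x} (subst Valid e (valid v))) (tailV {x} (subst Valid e' (valid w)))
               (suc-injective (trans (cong length (sym e)) (trans (trans (len v) (sym (len w))) (cong length e'))))
               (tail-≗ {x} {u} {u'} (subst Valid e (valid v)) (subst Valid e' (valid w)) (subst₂ (λ a b → sh a ≗ sh b) e e' (comp-shape cvw)))
      ... | ts , q = trans (keeps ts v) (cong (λ a → σ a (suc i)) (inj (vrun i (map suc ts) v) w
              (conn-sym (run-comp i (map suc ts) v) ◅◅ cvw)
              (trans (φ-run-suc ts v) (trans (cong (run (map suc ts)) e) (trans (run-suc ts x u) (trans (cong (x ∷_) q) (sym e')))))))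
        where
        keeps : ∀ ts v → σ v (suc i) ≡ σ (vrun i (map suc ts) v) (suc i)
        keeps [] v = refl
        keeps (t ∷ ts) v = trans (sym (σ-far {i ∸ suc t} {suc i} {v} defd (inj₂ (s≤s (≤-trans (≤-reflexive (+-comm _ 1)) (low i t (≤-trans m-pos m≤i))))))) (keeps ts (nb (i ∸ suc t) v))
          where
          low : ∀ i t → 1 ≤ i → suc (i ∸ suc t) ≤ i
          low (suc i) t _ = s≤s (m∸n≤m i t)

      -- The edge of colour `i` exchanging the corners `x` and `y` has sign minus at `i` on the `x`
      -- side and plus on the `y` side. By Axiom 3 one end admits an `(i + 1)`-neighbour, so its
      -- sign at `i + 1` is the opposite one. Hence a minus at a corner persists at all larger
      -- corners.
      heads-mono : ∀ {v w x y u u'} → Comp i v w → φ v ≡ x ∷ u → φ w ≡ y ∷ u' → x < y →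
        σ v (suc i) ≡ plus ⊎ σ w (suc i) ≡ minus
      heads-mono {v} {w} {x} {y} {u} {u'} cvw e e' x<y
        with two-corners (valid v) (subst (λ a → Rem x (sh a)) (sym e) (remHead {x} {u}))
               (rem-cong (≗-sym (comp-shape cvw)) (subst (λ a → Rem y (sh a)) (sym e') (remHead {y} {u'}))) (<⇒≢ x<y)
      ... | z , t , bz , vt , lt , et with lift v (x ∷ y ∷ z ∷ t) vt lt (≗-sym et)
      ... | v₁ , c₁ , φ₁ =
        conclude (proj₂ (ax3 i v₁ v₂ edge) (subst (Defd G) (+-comm 1 i) defd))
             (trans (sign 0 v₁ z≤n) (trans (cong (signAt 0) φ₁) (sgn-minus (<⇒≤ x<y))))
             (trans (sign 0 v₂ z≤n) (trans (cong (signAt 0) φ₂) (sgn-plus x<y)))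
             (same-head c₁ e φ₁)
             (same-head (conn-sym cvw ◅◅ (c₁ ◅◅ nb-conn (λ r → proj₁ r , ≤-refl))) e' φ₂)
        where
        v₂ : Fin size
        v₂ = nb i v₁
        φ₂ : φ v₂ ≡ y ∷ x ∷ z ∷ t
        φ₂ = trans (top v₁) (trans (cong (dd 0) φ₁) (dd-x t (btw-sym bz)))
        m<i : m < i
        m<i = m∸n≢0⇒n<m λ q → 0≢1+n (suc-injective (suc-injective (trans (sym (trans (len v₁) (cong (2 +_) q))) (cong length φ₁))))
        a₁ : adm i v₁ ≡ true
        a₁ = trans (adm-active 0 v₁ (subst (3 ≤_) (sym (cong length φ₁)) (s≤s (s≤s (s≤s z≤n)))))
               (trans (cong (active 0) φ₁) (cong not (btw-excl (btw-sym bz))))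
        edge : Edge G i v₁ v₂
        edge = nb-edge {i} {v₁} (m<i , <-trans (n<1+n i) I<n) a₁
        flip : ∀ {a b} → a ≡ negS b → b ≡ negS a
        flip {a} {b} e = trans (sym (negS-invol b)) (cong negS (sym e))
        conclude : Admits G (i + 1) v₁ ⊎ Admits G (i + 1) v₂ → σ v₁ i ≡ minus → σ v₂ i ≡ plus →
                   σ v (suc i) ≡ σ v₁ (suc i) → σ w (suc i) ≡ σ v₂ (suc i) → σ v (suc i) ≡ plus ⊎ σ w (suc i) ≡ minus
        conclude (inj₁ a) s₁ s₂ q q' = inj₁ (trans q (trans (flip (subst (λ j → σ v₁ (j ∸ 1) ≡ negS (σ v₁ j)) (+-comm i 1) a)) (cong negS s₁)))
        conclude (inj₂ a) s₁ s₂ q q' = inj₂ (trans q' (trans (flip (subst (λ j → σ v₂ (j ∸ 1) ≡ negS (σ v₂ j)) (+-comm i 1) a)) (cong negS s₂)))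

    cons : ∀ v → φ v ≡ hd (φ v) ∷ tl (φ v)
    cons v = go (φ v) (len v)
      where
      go : ∀ w → length w ≡ 2 + (i ∸ m) → w ≡ hd w ∷ tl w
      go (x ∷ w) _ = refl

    head-rem : ∀ {v w} → Comp i v w → Rem (hd (φ w)) (sh (φ v))
    head-rem {v} {w} cvw = rem-cong (≗-sym (comp-shape cvw)) (subst (λ a → Rem (hd (φ w)) (sh a)) (sym (cons w)) (remHead {hd (φ w)} {tl (φ w)}))

    at-head : ∀ v x → Rem x (sh (φ v)) → ∃[ w ] Comp i v w × hd (φ w) ≡ x
    at-head v x r with bring-last (φ v) x (valid v) r
    ... | u , vu , lu , eu with lift v (x ∷ u) vu lu (≗-sym eu)
    ... | w , cw , φw = w , cw , cong hd φw

    -- The sign at `i + 1` compares the letter `i + 1`, whose content is the head of `φ`, with the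
    -- next letter. Here `c` is the content of that letter consistent with the signs on the whole
    -- component.
    Last : Fin size → ℕ → Set
    Last v c = Add c (sh (φ v)) × (∀ w → Comp i v w → σ w (suc i) ≡ sgn (hd (φ w)) c)

    private
      two-signs : ∀ a → a ≡ plus ⊎ a ≡ minus
      two-signs plus = inj₁ refl
      two-signs minus = inj₂ refl

      plus≢minus : ∀ {a} → a ≡ plus → a ≡ minus → ⊥
      plus≢minus refl ()

      bound : 2 + (i ∸ m) ≤ n
      bound = ≤-trans (s≤s (≤-trans (+-monoˡ-≤ (i ∸ m) m-pos) (≤-reflexive (m+[n∸m]≡n m≤i)))) (<⇒≤ I<n)

      left-end : ∀ v → sh (φ v) 0 ≡ true
      left-end v = sh-left (valid v) 0 (subst (_≤ n) (sym (len v)) bound)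

      AllPlus : Fin size → ℕ → Set
      AllPlus v x = ∀ w → Comp i v w → hd (φ w) ≡ x → σ w (suc i) ≡ plus

      same-head' : ∀ {v w} → Comp i v w → hd (φ v) ≡ hd (φ w) → σ v (suc i) ≡ σ w (suc i)
      same-head' {v} {w} c e = same-head c (cons v) (trans (cons w) (cong (_∷ tl (φ w)) (sym e)))

      heads-mono' : ∀ {v w} → Comp i v w → hd (φ v) < hd (φ w) → σ v (suc i) ≡ minus → σ w (suc i) ≡ minus
      heads-mono' {v} {w} c l e with heads-mono c (cons v) (cons w) l
      ... | inj₁ p = ⊥-elim (plus≢minus p e)
      ... | inj₂ q = q

      -- Here `p` is the smallest corner carrying a minus, or the end of the boundary. No removable
      -- corner lies between `p` and the last `true` step `c` before it, so `c` separates the plus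
      -- signs from the minus signs.
      stop : ∀ v p c → c < p → sh (φ v) c ≡ true → (∀ q → c < q → q ≤ p → sh (φ v) q ≡ false) →
             (∀ x → x < p → Rem x (sh (φ v)) → AllPlus v x) →
             (∀ w → Comp i v w → p ≤ hd (φ w) → σ w (suc i) ≡ minus) → Last v c
      stop v p c c<p ec gap' ps ms = A , λ w cw → sgn-at w cw (head-rem cw)
        where
        A : Add c (sh (φ v))
        A = ec , gap' (suc c) ≤-refl c<p
        sgn-at : ∀ w → Comp i v w → Rem (hd (φ w)) (sh (φ v)) → σ w (suc i) ≡ sgn (hd (φ w)) c
        sgn-at w cw r with <-cmp (hd (φ w)) c
        ... | tri< l _ _ = trans (ps (hd (φ w)) (<-trans l c<p) r w cw refl) (sym (sgn-plus l))
        ... | tri≈ _ e _ = ⊥-elim (add≢rem A (subst (λ x → Rem x (sh (φ v))) e r))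
        ... | tri> _ _ l with p ≤? hd (φ w)
        ...   | yes q = trans (ms w cw q) (sym (sgn-minus (<⇒≤ l)))
        ...   | no q = ⊥-elim (true≢false (Rem.stepʳ r) (gap' (suc (hd (φ w))) (≤-trans l (n≤1+n _)) (≰⇒> q)))

      widen : ∀ {v p} → (∀ x → x < p → Rem x (sh (φ v)) → AllPlus v x) → (Rem p (sh (φ v)) → AllPlus v p) →
              ∀ x → x < suc p → Rem x (sh (φ v)) → AllPlus v x
      widen {v} {p} ps new x l = cases (m≤n⇒m<n∨m≡n (≤-pred l))
        where
        cases : x < p ⊎ x ≡ p → Rem x (sh (φ v)) → AllPlus v x
        cases (inj₁ l') = ps x l'
        cases (inj₂ refl) = new

      scan : ∀ v p → (∀ x → x < p → Rem x (sh (φ v)) → AllPlus v x) ⊎ ∃ (Last v)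
      scan v zero = inj₁ λ x ()
      scan v (suc p) with scan v p
      ... | inj₂ r = inj₂ r
      ... | inj₁ ps with bool-dec (sh (φ v) p) | bool-dec (sh (φ v) (suc p))
      ...   | inj₁ a | _ = inj₁ (widen ps λ r → ⊥-elim (true≢false a (Rem.stepˡ r)))
      ...   | inj₂ _ | inj₂ b = inj₁ (widen ps λ r → ⊥-elim (true≢false (Rem.stepʳ r) b))
      ...   | inj₂ a | inj₁ b with at-head v p (a , b)
      ...     | w , cw , hw with two-signs (σ w (suc i))
      ...       | inj₁ s = inj₁ (widen ps λ _ w' cw' hw' → trans (sym (same-head' (conn-sym cw ◅◅ cw') (trans hw (sym hw')))) s)
      ...       | inj₂ s with last-true (sh (φ v)) p (left-end v) a
      ...         | c , c<p , ec , gap' = inj₂ (c , stop v p c c<p ec gap' ps λ w' cw' l → right w' cw' (m≤n⇒m<n∨m≡n l))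
        where
        right : ∀ w' → Comp i v w' → p < hd (φ w') ⊎ p ≡ hd (φ w') → σ w' (suc i) ≡ minus
        right w' cw' (inj₁ l) = heads-mono' (conn-sym cw ◅◅ cw') (subst (_< hd (φ w')) (sym hw) l) s
        right w' cw' (inj₂ e) = trans (sym (same-head' (conn-sym cw ◅◅ cw') (trans hw e))) s

      -- A word of length `ℓ` leaves the boundary `false` beyond `n + ℓ`, so neither a `true` step
      -- nor a corner occurs from here on.
      end : ℕ
      end = suc (n + (2 + (i ∸ m)))

      right-end : ∀ v q → end ≤ q → sh (φ v) q ≡ false
      right-end v q l = sh-right (valid v) q (subst (λ k → n + k < q) (sym (len v)) l)

    opaque
      last-letter : ∀ v → ∃ (Last v)
      last-letter v with scan v end
      ... | inj₂ r = r
      -- Without any minus sign the next letter goes to the rightmost addable corner.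
      ... | inj₁ ps with last-true (sh (φ v)) end (left-end v) (right-end v end ≤-refl)
      ... | c , c<p , ec , gap' = c , stop v end c c<p ec gap' ps λ w cw l →
              ⊥-elim (true≢false (Rem.stepʳ (head-rem cw)) (right-end v _ (≤-trans l (n≤1+n _))))

    lastc : Fin size → ℕ
    lastc v = proj₁ (last-letter v)

    lastc-const : ∀ {v w} → Comp i v w → lastc v ≡ lastc w
    lastc-const {v} {w} cvw = add-separated (proj₁ lv) (add-cong (≗-sym (comp-shape cvw)) (proj₁ lw))
        (λ x r l → sgn-plus⁻¹ (trans (sym (same x r)) (sgn-plus l)))
        (λ x r l → sgn-plus⁻¹ (trans (same x r) (sgn-plus l)))
      where
      lv = proj₂ (last-letter v)
      lw = proj₂ (last-letter w)
      same : ∀ x → Rem x (sh (φ v)) → sgn x (lastc v) ≡ sgn x (lastc w)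
      same x r with at-head v x r
      ... | u , cu , refl = trans (sym (proj₂ lv u cu)) (proj₂ lw u (conn-sym cvw ◅◅ cu))

    extension : PreCover (suc i)
    extension = record
      { φ     = λ v → lastc v ∷ φ v
      ; len   = λ v → trans (cong suc (len v)) (cong (2 +_) (sym (+-∸-assoc 1 m≤i)))
      ; valid = λ v → proj₁ (proj₂ (last-letter v)) ∷ valid v
      ; sign  = sign'
      ; move  = λ t v → cong₂ _∷_ (sym (lastc-const {v} {nb (i ∸ t) v} (nb-conn λ r → proj₁ r , m∸n≤m i t))) (moves top t v)
      }
      where
      sign' : ∀ t v → t ≤ suc i ∸ m → σ v (suc i ∸ t) ≡ signAt t (lastc v ∷ φ v)
      sign' zero v _ = trans (proj₂ (proj₂ (last-letter v)) v ε) (cong (λ w → signAt 0 (lastc v ∷ w)) (sym (cons v)))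
      sign' (suc t) v l = sign t v (≤-pred (subst (suc t ≤_) (+-∸-assoc 1 m≤i) l))

    extension-inj : Inj extension i
    extension-inj v w cvw e = inj v w cvw (cong tl e)

-- The moves of the top colour

btw-unique : ∀ {x y z} → Btw y x z → Btw y z x → ⊥
btw-unique {x} {y} {z} b b' = true≢false (btw-true b') (btw-excl₃ {y} {x} {z} b)

btw-unique' : ∀ {x y z} → Btw y x z → Btw x y z → ⊥
btw-unique' b b' = true≢false (btw-true b') (btw-excl b)

≡₃ : ∀ {z y x z' y' x' : ℕ} {u u'} → _≡_ {A = List ℕ} (z ∷ y ∷ x ∷ u) (z' ∷ y' ∷ x' ∷ u') → z ≡ z' × y ≡ y' × x ≡ x' × u ≡ u'
≡₃ e with ∷-injective e
... | p , e' with ∷-injective e'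
... | q , e'' with ∷-injective e''
... | r , s = p , q , r , s

word-eq : ∀ {z y x z' y' x' : ℕ} {u u'} → z ≡ z' → y ≡ y' → x ≡ x' → u ≡ u' → _≡_ {A = List ℕ} (z ∷ y ∷ x ∷ u) (z' ∷ y' ∷ x' ∷ u')
word-eq refl refl refl refl = refl

nested : ∀ {q x y z} → q ≢ x → between x q y ≡ false → Btw y x z → Btw y q z → Btw q x y
nested {q} {x} {y} ne b (inj₁ (a , _)) (inj₁ (c , _)) with <-cmp q x
... | tri< l _ _ = ⊥-elim (true≢false (btw-true {x} {q} {y} (inj₂ (c , l))) b)
... | tri≈ _ e _ = ⊥-elim (ne e)
... | tri> _ _ l = inj₂ (a , l)
nested {q} {x} {y} ne b (inj₂ (_ , a)) (inj₂ (_ , c)) with <-cmp q x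
... | tri< l _ _ = inj₁ (l , a)
... | tri≈ _ e _ = ⊥-elim (ne e)
... | tri> _ _ l = ⊥-elim (true≢false (btw-true {x} {q} {y} (inj₁ (l , c))) b)
nested ne b (inj₁ (a , a')) (inj₂ (c , c')) = ⊥-elim (<-asym (<-trans a a') (<-trans c c'))
nested ne b (inj₂ (a , a')) (inj₁ (c , c')) = ⊥-elim (<-asym (<-trans a a') (<-trans c c'))

module Windows (G : SCG) (ax1 : Ax1 G) (ax2 : Ax2 G) (ax3 : Ax3 G) (ax5 : Ax5 G) where
  open SCG G
  open Vert G ax1
  open Far ax2 ax5
  open Words n
  open Rigid n
  open Covers G ax1 ax2 ax3 ax5

  module TopMove {i} (c : PreCover (suc i)) (m≤i : m ≤ i) (I<n : suc i < n)
                 (double : m < i → Double (suc i)) (square : suc m < i → Square (suc i)) where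
    open PreCover c hiding (Top)

    I : ℕ
    I = suc i

    in-range : ∀ t {v w} → φ v ≡ w → t + 3 ≤ length w → InR (I ∸ t)
    in-range t {v} e l = lower , ≤-trans (s≤s (m∸n≤m I t)) I<n
      where
      b : suc t ≤ I ∸ m
      b = ≤-pred (≤-pred (subst₂ _≤_ (+-comm t 3) (trans (cong length (sym e)) (len v)) l))
      lower : m < I ∸ t
      lower = m+n≤o⇒m≤o∸n (suc m) (subst (_≤ I) (trans (+-comm m (suc t)) (trans (cong suc (+-comm t m)) refl)) (≤-trans (+-monoʳ-≤ m b) (≤-reflexive (m+[n∸m]≡n (≤-trans m≤i (n≤1+n i))))))

    adm-word : ∀ t {v w} → φ v ≡ w → t + 3 ≤ length w → adm (I ∸ t) v ≡ active t w
    adm-word t {v} e l = trans (adm-active t v (subst (λ w → t + 3 ≤ length w) (sym e) l)) (cong (active t) e)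

    3≤ : ∀ {k} → 3 ≤ suc (suc (suc k))
    3≤ = s≤s (s≤s (s≤s z≤n))

    4≤ : ∀ {k} → 4 ≤ suc (suc (suc (suc k)))
    4≤ = s≤s 3≤

    5≤ : ∀ {k} → 5 ≤ suc (suc (suc (suc (suc k))))
    5≤ = s≤s 4≤

    valid-word : ∀ {v w} → φ v ≡ w → Valid w
    valid-word {v} e = subst Valid e (valid v)

    -- Colours at most `I − 3`: they act on the tail behind the top three letters only, and commute
    -- with `nb I` by Axiom 5.
    deep : List ℕ → Fin size → Fin size
    deep ts = vrun I (map (3 +_) ts)

    φ-deep : ∀ ts {v z y x u} → φ v ≡ z ∷ y ∷ x ∷ u → φ (deep ts v) ≡ z ∷ y ∷ x ∷ run ts u
    φ-deep [] e = e
    φ-deep (t ∷ ts) {v} e = φ-deep ts (trans (move (2 + t) v) (cong (dd (3 + t)) e))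

    deep-comp : ∀ ts v → Comp i v (deep ts v)
    deep-comp [] v = ε
    deep-comp (t ∷ ts) v = nb-conn (λ r → proj₁ r , m∸n≤m i (2 + t)) ◅◅ deep-comp ts (nb (i ∸ (2 + t)) v)

    comm-low : ∀ t v → nb I (nb (I ∸ (3 + t)) v) ≡ nb (I ∸ (3 + t)) (nb I v)
    comm-low t v with 3 + t ≤? I
    ... | yes l = nb-comm (I ∸ (3 + t)) I v
                    (subst (2 <_) (sym (trans (∣-∣-comm (I ∸ (3 + t)) I) (trans (m≤n⇒∣n-m∣≡n∸m (m∸n≤m I (3 + t))) (m∸[m∸n]≡n l)))) 3≤)
                    (inj₂ (≤-trans (≤-reflexive (sym (+-suc (I ∸ (3 + t)) 2))) (≤-trans (+-monoʳ-≤ (I ∸ (3 + t)) (3≤ {t})) (≤-reflexive (m∸n+n≡m l)))))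
    ... | no ¬l = trans (cong (nb I) out) (sym out)
      where
      out : ∀ {v} → nb (I ∸ (3 + t)) v ≡ v
      out {v} = nb-out λ r → n≮0 (subst (m <_) (m≤n⇒m∸n≡0 (<⇒≤ (≰⇒> ¬l))) (proj₁ r))

    nb-deep : ∀ ts v → nb I (deep ts v) ≡ deep ts (nb I v)
    nb-deep [] v = refl
    nb-deep (t ∷ ts) v = trans (nb-deep ts (nb (I ∸ (3 + t)) v)) (cong (deep ts) (comm-low t v))

    split : ∀ v → ∃[ z ] ∃[ y ] ∃[ x ] ∃[ u ] φ v ≡ z ∷ y ∷ x ∷ u
    split v = go (φ v) (trans (len v) (cong (2 +_) (+-∸-assoc 1 m≤i)))
      where
      go : ∀ w → length w ≡ 3 + (i ∸ m) → ∃[ z ] ∃[ y ] ∃[ x ] ∃[ u ] w ≡ z ∷ y ∷ x ∷ u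
      go (z ∷ y ∷ x ∷ u) _ = z , y , x , u , refl

    -- An I-edge commutes with the colours acting on u and preserves their signs, so u is unchanged by rigidity.
    partner : ∀ {v z y x u} → φ v ≡ z ∷ y ∷ x ∷ u → ∃[ z' ] ∃[ y' ] ∃[ x' ] φ (nb I v) ≡ z' ∷ y' ∷ x' ∷ u
    partner {v} {z} {y} {x} {u} e with split (nb I v)
    ... | z' , y' , x' , u' , e' = z' , y' , x' , trans e' (cong (λ u → z' ∷ y' ∷ x' ∷ u) (sym
        (rigid u u' (tailV (tailV (tailV (valid-word e)))) (tailV (tailV (tailV (valid-word e')))) lens signs)))
      where
      lens : length u ≡ length u'
      lens = suc-injective (suc-injective (suc-injective (trans (cong length (sym e)) (trans (len v) (trans (sym (len (nb I v))) (cong length e'))))))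
      I∸m : I ∸ m ≡ suc (length u)
      I∸m = suc-injective (suc-injective (trans (sym (len v)) (cong length e)))
      signs : ∀ ts t → suc (suc t) ≤ length u → signAt t (run ts u) ≡ signAt t (run ts u')
      signs ts t l =
        trans (sym (cong (signAt (3 + t)) (φ-deep ts e)))
        (trans (sym (sign (3 + t) (deep ts v) l'))
        (trans (sym (σ-far {I} {I ∸ (3 + t)} {deep ts v} (≤-trans m-pos (proj₁ low) , ≤-trans (s≤s (m∸n≤m I (3 + t))) (≤-trans I<n n≤N)) (inj₁ (proj₂ low))))
        (trans (cong (λ a → σ a (I ∸ (3 + t))) (nb-deep ts v))
        (trans (sign (3 + t) (deep ts (nb I v)) l')
        (cong (signAt (3 + t)) (φ-deep ts e'))))))
        where
        l' : 3 + t ≤ I ∸ m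
        l' = subst (3 + t ≤_) (sym I∸m) (s≤s l)
        l'' : 3 + t ≤ I
        l'' = ≤-trans l' (m∸n≤m I m)
        low : m ≤ I ∸ (3 + t) × I ∸ (3 + t) + 2 < I
        low = m+n≤o⇒m≤o∸n m (≤-trans (+-monoʳ-≤ m l') (≤-reflexive (m+[n∸m]≡n (≤-trans m≤i (n≤1+n i))))) ,
              ≤-trans (≤-reflexive (sym (+-suc (I ∸ (3 + t)) 2))) (≤-trans (+-monoʳ-≤ (I ∸ (3 + t)) (3≤ {t})) (≤-reflexive (m∸n+n≡m l'')))

    -- Since deep moves commute with `nb I`, rewriting the tail at `v` rewrites it in the same way
    -- at the `I`-neighbour.
    record Moved (v : Fin size) (z y x : ℕ) (u u' : List ℕ) : Set where
      field
        vert     : Fin size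
        word     : φ vert ≡ z ∷ y ∷ x ∷ u'
        comp     : Comp i v vert
        comp-nb  : Comp i (nb I v) (nb I vert)
        partner-word : ∀ {z' y' x'} → φ (nb I v) ≡ z' ∷ y' ∷ x' ∷ u → φ (nb I vert) ≡ z' ∷ y' ∷ x' ∷ u'

    shift-tail : ∀ {v z y x u u'} ts → run ts u ≡ u' → φ v ≡ z ∷ y ∷ x ∷ u → Moved v z y x u u'
    shift-tail {v} {z} {y} {x} {u} {u'} ts r e = record
      { vert = deep ts v
      ; word = trans (φ-deep ts e) (cong (λ u → z ∷ y ∷ x ∷ u) r)
      ; comp = deep-comp ts v
      ; comp-nb = subst (Comp i (nb I v)) (sym (nb-deep ts v)) (deep-comp ts (nb I v))
      ; partner-word = λ {z'} {y'} {x'} e' → trans (cong φ (nb-deep ts v)) (trans (φ-deep ts e') (cong (λ u → z' ∷ y' ∷ x' ∷ u) r))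
      }

    expose : ∀ {v z y x u q} → φ v ≡ z ∷ y ∷ x ∷ u → Rem q (sh u) → ∃[ t ] Moved v z y x u (q ∷ t)
    expose {u = u} {q} e r with run-to-last {u} {q} (tailV (tailV (tailV (valid-word e)))) r
    ... | ts , t , re , _ = t , shift-tail ts re e

    opaque
      -- A removable corner strictly between x and y makes the moves of colours I ∸ 1 and I coincide.
      z-middle : ∀ {v z y x u} → φ v ≡ z ∷ y ∷ x ∷ u → Btw x z y → φ (nb I v) ≡ z ∷ x ∷ y ∷ u × Comp i v (nb I v)
      z-middle {v} {z} {y} {x} {u} e b with valid-word e
      ... | Z ∷ (Y ∷ (X ∷ vu)) with gap-btw X (add-swap₁ Y (btw-apart b)) (proj₁ (btw-apart b))
      ... | q , bq , rq with expose e rq | partner e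
      ... | t , m' | z' , y' , x' , e' = result (≡₃ (trans (sym (Moved.partner-word m' e')) (trans (cong φ same) moved)))
        where
        open Moved m' renaming (vert to v₁; word to e₁)
        moved : φ (nb i v₁) ≡ z ∷ x ∷ y ∷ q ∷ t
        moved = trans (move 0 v₁) (trans (cong (dd 1) e₁) (cong (z ∷_) (dd-x t bq)))
        same : nb I v₁ ≡ nb i v₁
        same = double (proj₁ (in-range 1 e₁ 4≤)) v₁
          (trans (adm-word 0 e₁ 3≤) (cong not (btw-excl₃ {x} {z} {y} b)))
          (trans (adm-word 1 e₁ 4≤) (cong not (btw-excl bq)))
          (inj₁ (trans (adm-word 0 moved 3≤) (cong not (btw-excl₃ {y} {z} {x} (btw-sym b)))))
        result : z' ≡ z × y' ≡ x × x' ≡ y × (q ∷ t ≡ q ∷ t) → φ (nb I v) ≡ z ∷ x ∷ y ∷ u × Comp i v (nb I v)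
        result (p , p' , p'' , _) = trans e' (word-eq p p' p'' refl) ,
          (comp ◅◅ (nb-conn (λ r → proj₁ r , ≤-refl) ◅◅ (subst (λ a → Comp i a (nb I v)) same (conn-sym comp-nb))))

    record Edge₃ (v : Fin size) (z y x z' y' x' : ℕ) (u : List ℕ) : Set where
      constructor edge₃
      field
        src  : φ v ≡ z ∷ y ∷ x ∷ u
        tgt  : φ (nb I v) ≡ z' ∷ y' ∷ x' ∷ u
        midˢ : Btw y x z
        midᵗ : Btw y' x' z'
        turn : sgn y' z' ≢ sgn y z

    flip : ∀ {v z y x z' y' x' u} → Edge₃ v z y x z' y' x' u → Edge₃ (nb I v) z' y' x' z y x u
    flip {v} (edge₃ s t a b c) = edge₃ t (trans (cong φ (nb-invol I v)) s) b a (c ∘ sym)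

    top-range : ∀ {v z y x u} → φ v ≡ z ∷ y ∷ x ∷ u → InR I
    top-range e = in-range 0 e 3≤

    turns : ∀ {v z y x z' y' x' u u'} → φ v ≡ z ∷ y ∷ x ∷ u → φ (nb I v) ≡ z' ∷ y' ∷ x' ∷ u' → adm I v ≡ true → sgn y' z' ≢ sgn y z
    turns {v} e e' a q with proj₁ (σ-flip (top-range e) a)
    ... | f = neg≢ (trans (sym q) (trans (sym (trans (sign 0 (nb I v) z≤n) (cong (signAt 0) e')))
                (trans f (cong negS (trans (sign 0 v z≤n) (cong (signAt 0) e))))))
      where
      neg≢ : ∀ {a} → a ≡ negS a → ⊥
      neg≢ {plus} ()
      neg≢ {minus} ()

    -- The neighbour is again of this kind: with `y'` in the middle it would not admit colour `I`,
    -- and with `z'` in the middle `z-middle` would lead back to a word in which `z` lies between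
    -- `x` and `y`.
    x-middle : ∀ {v z y x z' y' x' u} → φ v ≡ z ∷ y ∷ x ∷ u → Btw y x z → φ (nb I v) ≡ z' ∷ y' ∷ x' ∷ u → Edge₃ v z y x z' y' x' u
    x-middle {v} {z} {y} {x} {z'} {y'} {x'} {u} e b e' = edge₃ e e' b (mid (valid-tri (valid-word e'))) (turns e e' a)
      where
      a : adm I v ≡ true
      a = trans (adm-word 0 e 3≤) (cong not (btw-excl b))
      mid : Btw x' y' z' ⊎ Btw y' x' z' ⊎ Btw x' z' y' → Btw y' x' z'
      mid (inj₁ b') = ⊥-elim (true≢false (trans (adm-nb (top-range e)) a) (trans (adm-word 0 e' 3≤) (cong not (btw-true b'))))
      mid (inj₂ (inj₁ b')) = b'
      mid (inj₂ (inj₂ b')) with ≡₃ (trans (sym e) (trans (cong φ (sym (nb-invol I v))) (proj₁ (z-middle e' b'))))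
      ... | refl , refl , refl , _ = ⊥-elim (btw-unique b b')

    move-edge : ∀ {v z y x z' y' x' u u'} → Edge₃ v z y x z' y' x' u → (m' : Moved v z y x u u') → Edge₃ (Moved.vert m') z y x z' y' x' u'
    move-edge (edge₃ s t a b c) m' = edge₃ (Moved.word m') (Moved.partner-word m' t) a b c

    module _ {v z y x z' y' x' q t} (E : Edge₃ v z y x z' y' x' (q ∷ t)) where
      open Edge₃ E

      not-both : between q x y ≡ false → between q x' y' ≡ false → ⊥
      not-both a a' = cases (valid-tri (tailV (valid-word src)))
        where
        same : nb I v ≡ nb i v
        same = double (proj₁ (in-range 1 src 4≤)) v
          (trans (adm-word 0 src 3≤) (cong not (btw-excl midˢ)))
          (trans (adm-word 1 src 4≤) (cong not a))
          (inj₂ (trans (adm-word 1 tgt 4≤) (cong not a')))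
        word : z' ∷ y' ∷ x' ∷ q ∷ t ≡ z ∷ dd₃ y x q t
        word = trans (sym tgt) (trans (cong φ same) (trans (move 0 v) (cong (dd 1) src)))
        cases : Btw q x y ⊎ Btw x q y ⊎ Btw q y x → ⊥
        cases (inj₁ b) = true≢false (btw-true b) a
        cases (inj₂ (inj₁ b)) with ≡₃ (trans word (cong (z ∷_) (dd-x t b)))
        ... | refl , refl , refl , _ = btw-unique' midˢ midᵗ
        cases (inj₂ (inj₂ b)) with ≡₃ (trans word (cong (z ∷_) (dd-z t b)))
        ... | refl , refl , _ = turn refl

      -- This is Axiom 3 for the lower adjacent colour. Together with `not-both`, exactly one end
      -- admits colour `I − 1`.
      not-neither : between q x y ≡ true → between q x' y' ≡ true → ⊥
      not-neither a a' = cases (proj₁ (ax3 I v (nb I v) (nb-edge (top-range src) adm-v)) defd)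
        where
        adm-v : adm I v ≡ true
        adm-v = trans (adm-word 0 src 3≤) (cong not (btw-excl midˢ))
        defd : Defd G (i ∸ 1)
        defd = ≤-trans m-pos (≤-pred-∸ (proj₁ (in-range 1 src 4≤))) , ≤-trans (s≤s (m∸n≤m i 1)) (≤-trans (<⇒≤ I<n) n≤N)
          where
          ≤-pred-∸ : ∀ {a b} → a < b → a ≤ b ∸ 1
          ≤-pred-∸ (s≤s l) = l
        cases : Admits G i v ⊎ Admits G i (nb I v) → ⊥
        cases (inj₁ p) = true≢false (neqS-true' p) (trans (adm-word 1 src 4≤) (cong not a))
        cases (inj₂ p) = true≢false (neqS-true' p) (trans (adm-word 1 tgt 4≤) (cong not a'))

    record Oriented (z y x z' y' x' : ℕ) : Set where
      constructor oriented
      field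
        y<x   : y < x
        x<z   : x < z
        z'<x' : z' < x'
        x'<y' : x' < y'

    orient : ∀ {v z y x z' y' x' u} → Edge₃ v z y x z' y' x' u → Oriented z y x z' y' x' ⊎ Oriented z' y' x' z y x
    orient (edge₃ _ _ (inj₁ (a , b)) (inj₂ (a' , b')) _) = inj₁ (oriented a b a' b')
    orient (edge₃ _ _ (inj₂ (a , b)) (inj₁ (a' , b')) _) = inj₂ (oriented a' b' a b)
    orient (edge₃ _ _ (inj₁ (a , b)) (inj₁ (a' , b')) c) = ⊥-elim (c (trans (sgn-plus (<-trans a' b')) (sym (sgn-plus (<-trans a b)))))
    orient (edge₃ _ _ (inj₂ (a , b)) (inj₂ (a' , b')) c) = ⊥-elim (c (trans (sgn-minus (<⇒≤ (<-trans a' b'))) (sym (sgn-minus (<⇒≤ (<-trans a b))))))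

    not-btw-low : ∀ {q x y} → q < x → y < x → between q x y ≡ false
    not-btw-low a b rewrite <ᵇ-true a | <ᵇ-true b | <ᵇ-false (<⇒≤ a) | <ᵇ-false (<⇒≤ b) = refl

    not-btw-high : ∀ {q x y} → x < q → x < y → between q x y ≡ false
    not-btw-high {q} {x} {y} a b rewrite <ᵇ-true a | <ᵇ-true b | <ᵇ-false (<⇒≤ a) | <ᵇ-false (<⇒≤ b) = refl

    -- Each removable corner `q` of the tail can be exposed next to `x` and `x'`. Exactly one of
    -- "`x` between `q` and `y`" and "`x'` between `q` and `y'`" then holds; given `y < x` and
    -- `x' < y'`, this says that `q < x` exactly when `q < x'`.
    same-x : ∀ {v z y x z' y' x' u} → Edge₃ v z y x z' y' x' u → Oriented z y x z' y' x' → x ≡ x'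
    same-x {v} {z} {y} {x} {z'} {y'} {x'} {u} E (oriented y<x x<z z'<x' x'<y') =
      add-separated Ax Ax' up down
      where
      open Edge₃ E
      Ax : Add x (sh u)
      Ax = headA (tailV (tailV (valid-word src)))
      Ax' : Add x' (sh u)
      Ax' = headA (tailV (tailV (valid-word tgt)))
      up : ∀ q → Rem q (sh u) → q < x → q < x'
      up q r l with <-cmp q x'
      ... | tri< l' _ _ = l'
      ... | tri≈ _ refl _ = ⊥-elim (add≢rem Ax' r)
      ... | tri> _ _ l' = let t , m' = expose src r in
            ⊥-elim (not-both (move-edge E m') (not-btw-low l y<x) (not-btw-high l' x'<y'))
      down : ∀ q → Rem q (sh u) → q < x' → q < x
      down q r l with <-cmp q x
      ... | tri< l' _ _ = l'
      ... | tri≈ _ refl _ = ⊥-elim (add≢rem Ax r)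
      ... | tri> _ _ l' = let t , m' = expose src r in
            ⊥-elim (not-neither (move-edge E m') (btw-true {q} {x} {y} (inj₂ (y<x , l'))) (btw-true {q} {x'} {y'} (inj₁ (l , x'<y'))))

    square-move : ∀ {v z y x q r t} → φ v ≡ z ∷ y ∷ x ∷ q ∷ r ∷ t → Btw q r x → Btw y x z → Btw y q z →
      ∀ {z' y'} → φ (nb I v) ≡ z' ∷ y' ∷ x ∷ q ∷ r ∷ t →
      φ (nb (I ∸ 2) v) ≡ z ∷ y ∷ q ∷ x ∷ r ∷ t × nb I (nb (I ∸ 2) v) ≡ nb (I ∸ 2) (nb I v)
    square-move {v} {z} {y} {x} {q} {r} {t} e br bx bq e' = e₂ ,
      square (≤-pred-∸ (proj₁ (in-range 2 e 5≤))) v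
        (trans (adm-word 0 e 3≤) (cong not (btw-excl bx)))
        (trans (adm-word 2 e 5≤) (cong not rq))
        (trans (adm-word 0 e₂ 3≤) (cong not (btw-excl bq)))
        (trans (adm-word 2 e' 5≤) (cong not rq))
        (side (between x q y) refl)
      where
      rq : between r q x ≡ false
      rq = btw-excl br
      ≤-pred-∸ : ∀ {a b} → a < b ∸ 1 → suc a < b
      ≤-pred-∸ {a} {suc b} l = s≤s l
      e₂ : φ (nb (I ∸ 2) v) ≡ z ∷ y ∷ q ∷ x ∷ r ∷ t
      e₂ = trans (move 1 v) (trans (cong (dd 2) e) (cong (λ w → z ∷ y ∷ w) (dd-x t br)))
      -- The exceptional configuration of `Square` does not occur. Either `q` lies between `x` and
      -- `y` and colour `I − 1` is idle, or colour `I − 1` puts `q` at depth 1, where it lies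
      -- between `y` and `z` and makes colour `I` idle.
      side : ∀ b → between x q y ≡ b → (adm (I ∸ 1) (nb (I ∸ 2) v) ∧ adm I (nb (I ∸ 1) (nb (I ∸ 2) v))) ≡ false
      side true b rewrite trans (adm-word 1 e₂ 4≤) (cong not b) = refl
      side false b = trans (cong (adm i (nb (I ∸ 2) v) ∧_) (trans (adm-word 0 e₃ 3≤) (cong not (btw-true bq)))) (∧-zeroʳ _)
        where
        e₃ : φ (nb i (nb (I ∸ 2) v)) ≡ z ∷ q ∷ y ∷ x ∷ r ∷ t
        e₃ = trans (move 0 _) (trans (cong (dd 1) e₂) (cong (z ∷_) (dd-x (r ∷ t) (nested (proj₁ (btw-apart br)) b bx bq))))

    expose₂ : ∀ {v z y x u q} → φ v ≡ z ∷ y ∷ x ∷ u → Rem q (sh (x ∷ u)) → q ≢ x →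
      ∃[ r ] ∃[ t ] Btw q r x × Moved v z y x u (q ∷ r ∷ t)
    expose₂ {x = x} {u} {q} e rq ne with two-corners {x ∷ u} {x} {q} (tailV (tailV (valid-word e))) (remHead {x} {u}) rq (ne ∘ sym)
    ... | r , t , br , vt , lt , et with same-shape-connected u (q ∷ r ∷ t) (tailV (tailV (tailV (valid-word e)))) (tailV vt) (suc-injective lt)
                                          (≗-sym (tail-≗ {x} {q ∷ r ∷ t} {u} vt (tailV (tailV (valid-word e))) et))
    ... | ts , re = r , t , btw-sym br , shift-tail ts re e

    opaque
      -- Colour `I − 2` replaces `x` by `q` at both ends, and by `Square` the results are again
      -- joined by an `I`-edge. Applying `x-middle` to that edge places `q` between `y'` and `z'`.
      spread : ∀ {v z y x z' y' u} → Edge₃ v z y x z' y' x u → ∀ q → Rem q (sh (x ∷ u)) → q ≢ x → Btw y q z → Btw y' q z'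
      spread {v} {z} {y} {x} {z'} {y'} {u} E q rq ne bq with expose₂ {u = u} (Edge₃.src E) rq ne
      ... | r , t , br , m' = Edge₃.midᵗ (x-middle (proj₁ sq) bq (trans (cong φ (proj₂ sq))
              (trans (move 1 _) (trans (cong (dd 2) (Edge₃.tgt E')) (cong (λ w → z' ∷ y' ∷ w) (dd-x t br))))))
        where
        E' : Edge₃ (Moved.vert m') z y x z' y' x (q ∷ r ∷ t)
        E' = move-edge E m'
        sq : φ (nb (I ∸ 2) (Moved.vert m')) ≡ z ∷ y ∷ q ∷ x ∷ r ∷ t ×
             nb I (nb (I ∸ 2) (Moved.vert m')) ≡ nb (I ∸ 2) (nb I (Moved.vert m'))
        sq = square-move (Edge₃.src E') br (Edge₃.midˢ E') bq (Edge₃.tgt E')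

    -- By `spread` from both ends, a removable corner other than `x` lies between `y` and `z`
    -- exactly when it lies between `z'` and `y'`. As `x` lies in both intervals, the lower ends are
    -- separated by no corner, nor are the upper ends.
    swapped : ∀ {v z y x z' y' u} → Edge₃ v z y x z' y' x u → Oriented z y x z' y' x → y ≡ z' × z ≡ y'
    swapped {v} {z} {y} {x} {z'} {y'} {u} E (oriented y<x x<z z'<x x<y') =
      add-separated Ay Az' f₁ g₁ , add-separated Az Ay' f₂ g₂
      where
      open Edge₃ E
      Ay : Add y (sh (x ∷ u))
      Ay = headA (tailV (valid-word src))
      Ay' : Add y' (sh (x ∷ u))
      Ay' = headA (tailV (valid-word tgt))
      Az : Add z (sh (x ∷ u))
      Az = add-swap₁ (headA (valid-word src)) (btw-apart midˢ)
      Az' : Add z' (sh (x ∷ u))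
      Az' = add-swap₁ (headA (valid-word tgt)) (btw-apart midᵗ)
      there' : ∀ q → Rem q (sh (x ∷ u)) → q ≢ x → Btw y q z → z' < q × q < y'
      there' q r ne b with spread E q r ne b
      ... | inj₂ p = p
      ... | inj₁ (a , a') = ⊥-elim (<-asym (<-trans z'<x x<y') (<-trans a a'))
      back : ∀ q → Rem q (sh (x ∷ u)) → q ≢ x → Btw y' q z' → y < q × q < z
      back q r ne b with spread (flip E) q r ne b
      ... | inj₁ p = p
      ... | inj₂ (a , a') = ⊥-elim (<-asym (<-trans y<x x<z) (<-trans a a'))
      f₁ : ∀ q → Rem q (sh (x ∷ u)) → q < y → q < z'
      f₁ q r l with <-cmp q z'
      ... | tri< l' _ _ = l'
      ... | tri≈ _ refl _ = ⊥-elim (add≢rem Az' r)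
      ... | tri> _ _ l' = ⊥-elim (<-asym l (proj₁ (back q r (<⇒≢ (<-trans l y<x)) (inj₂ (l' , <-trans l (<-trans y<x x<y'))))))
      g₁ : ∀ q → Rem q (sh (x ∷ u)) → q < z' → q < y
      g₁ q r l with <-cmp q y
      ... | tri< l' _ _ = l'
      ... | tri≈ _ refl _ = ⊥-elim (add≢rem Ay r)
      ... | tri> _ _ l' = ⊥-elim (<-asym l (proj₁ (there' q r (<⇒≢ (<-trans l z'<x)) (inj₁ (l' , <-trans l (<-trans z'<x x<z))))))
      f₂ : ∀ q → Rem q (sh (x ∷ u)) → q < z → q < y'
      f₂ q r l with <-cmp q y'
      ... | tri< l' _ _ = l'
      ... | tri≈ _ refl _ = ⊥-elim (add≢rem Ay' r)
      ... | tri> _ _ l' = ⊥-elim (<-asym l' (proj₂ (there' q r (λ { refl → <-asym l' x<y' }) (inj₁ (<-trans y<x (<-trans x<y' l') , l)))))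
      g₂ : ∀ q → Rem q (sh (x ∷ u)) → q < y' → q < z
      g₂ q r l with <-cmp q z
      ... | tri< l' _ _ = l'
      ... | tri≈ _ refl _ = ⊥-elim (add≢rem Az r)
      ... | tri> _ _ l' = ⊥-elim (<-asym l' (proj₂ (back q r (λ { refl → <-asym l' x<z }) (inj₂ (<-trans z'<x (<-trans x<z l') , l)))))

    x-middle-move : ∀ {v z y x z' y' x' u} → Edge₃ v z y x z' y' x' u → z' ≡ y × y' ≡ z × x' ≡ x
    x-middle-move E with orient E
    ... | inj₁ o with same-x E o
    ...   | refl = let p , q = swapped E o in sym p , sym q , refl
    x-middle-move E | inj₂ o with same-x (flip E) o
    ...   | refl = let p , q = swapped (flip E) o in q , p , refl

    top-move : Top c
    top-move v with split v
    ... | z , y , x , u , e with valid-tri (valid-word e) | partner e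
    ... | inj₁ b | _ = trans (cong φ (nb-fix (trans (adm-word 0 e 3≤) (cong not (btw-true b))))) (trans e (trans (sym (dd-y u b)) (cong (dd 0) (sym e))))
    ... | inj₂ (inj₂ b) | _ = trans (proj₁ (z-middle e b)) (trans (sym (dd-z u b)) (cong (dd 0) (sym e)))
    ... | inj₂ (inj₁ b) | z' , y' , x' , e' with x-middle-move (x-middle e b e')
    ...   | p , q , r = trans e' (trans (word-eq p q r refl) (trans (sym (dd-x u b)) (cong (dd 0) (sym e))))

-- Injectivity of covers

nth : List ℕ → ℕ → ℕ
nth []      _       = 0
nth (x ∷ l) zero    = x
nth (x ∷ l) (suc k) = nth l k

nth-∈ : ∀ l {k} → k < length l → nth l k ∈ l
nth-∈ (x ∷ l) {zero} _ = here refl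
nth-∈ (x ∷ l) {suc k} (s≤s h) = there (nth-∈ l h)

nth-mono : ∀ {l j k} → AllPairs _<_ l → j < k → k < length l → nth l j < nth l k
nth-mono {x ∷ l} {zero} {suc k} (p ∷ _) _ (s≤s h) = All.lookup p (nth-∈ l h)
nth-mono {x ∷ l} {suc j} {suc k} (_ ∷ s) (s≤s q) (s≤s h) = nth-mono s q h

nth-Mono : ∀ {l w} → Linked _<_ l → All (_< length l) w → Mono (nth l) w
nth-Mono {l} {w} lk b {j} {k} j∈ k∈ with <-cmp j k
... | tri< q _ _ = trans (<ᵇ-true (nth-mono (Linked⇒AllPairs <-trans lk) q (All.lookup b k∈))) (sym (<ᵇ-true q))
... | tri≈ _ refl _ = trans (<ᵇ-false (≤-refl {nth l j})) (sym (<ᵇ-false (≤-refl {j})))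
... | tri> _ _ q = trans (<ᵇ-false (<⇒≤ (nth-mono (Linked⇒AllPairs <-trans lk) q (All.lookup b j∈)))) (sym (<ᵇ-false (<⇒≤ q)))

dd-++ : ∀ t w u → t + 3 ≤ length w → dd t (w ++ u) ≡ dd t w ++ u
dd-++ zero (z ∷ y ∷ x ∷ w) u _ with between x y z | between y x z
... | true  | _     = refl
... | false | true  = refl
... | false | false = refl
dd-++ zero (_ ∷ []) u (s≤s ())
dd-++ zero (_ ∷ _ ∷ []) u (s≤s (s≤s ()))
dd-++ (suc t) (c ∷ w) u (s≤s l) = cong (c ∷_) (dd-++ t w u l)

run-++ˡ : ∀ ts w u → Fits (length w) ts → run ts (w ++ u) ≡ run ts w ++ u
run-++ˡ [] w u _ = refl
run-++ˡ (t ∷ ts) w u (p ∷ ps) = trans (cong (run ts) (dd-++ t w u p))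
  (run-++ˡ ts (dd t w) u (subst (λ k → Fits k ts) (sym (length-dd t w)) ps))

length-run : ∀ ts w → length (run ts w) ≡ length w
length-run [] w = refl
length-run (t ∷ ts) w = trans (length-run ts (dd t w)) (length-dd t w)

active-++ : ∀ t w u → t + 3 ≤ length w → active t (w ++ u) ≡ active t w
active-++ zero (_ ∷ _ ∷ _ ∷ w) u _ = refl
active-++ zero (_ ∷ []) u (s≤s ())
active-++ zero (_ ∷ _ ∷ []) u (s≤s (s≤s ()))
active-++ (suc t) (c ∷ w) u (s≤s l) = active-++ t w u l

module Corners (M : ℕ) where
  open Words M

  opaque
    -- With `a`, `b`, `c` removed, corners `p` and `q` appear in the two gaps, and with these
    -- removed a corner `r` appears between them: the pattern of the cells of (3,2,1). The order of
    -- `r` and `b` is left open.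
    three-corners : ∀ {w a b c} → Valid w → Rem a (sh w) → Rem b (sh w) → Rem c (sh w) → a < b → b < c →
      ∃[ p ] ∃[ q ] ∃[ r ] ∃[ t ] (a < p × p < b) × (b < q × q < c) × (p < r × r < q) ×
        Valid (a ∷ b ∷ p ∷ c ∷ q ∷ r ∷ t) × length w ≡ 6 + length t × sh (a ∷ b ∷ p ∷ c ∷ q ∷ r ∷ t) ≗ sh w
    three-corners {w} {a} {b} {c} v ra rb rc a<b b<c with bring-last w a v ra
    ... | u₁ , v₁ , l₁ , e₁
      with bring-last u₁ b (tailV v₁) (rem-addc⁻¹ (rem-cong (≗-sym e₁) rb) (<⇒≢ a<b ∘ sym))
    ... | u₂ , v₂ , l₂ , e₂
      with bring-last u₂ c (tailV v₂) (rem-addc⁻¹ (rem-cong (≗-sym e₂) (rem-addc⁻¹ (rem-cong (≗-sym e₁) rc) (<⇒≢ (<-trans a<b b<c) ∘ sym))) (<⇒≢ b<c ∘ sym))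
    ... | u₃ , v₃ , l₃ , e₃ = finish (gap Aa Ab a<b) (gap Ab (headA v₃) b<c)
      where
      ab : Apart a b
      ab = rem-apart ra rb (<⇒≢ a<b)
      ac : Apart a c
      ac = rem-apart ra rc (<⇒≢ (<-trans a<b b<c))
      bc : Apart b c
      bc = rem-apart rb rc (<⇒≢ b<c)
      Ab₃ : Add b (sh (c ∷ u₃))
      Ab₃ = add-cong (≗-sym e₃) (headA v₂)
      Ab : Add b (sh u₃)
      Ab = add-swap₁ Ab₃ (apart-sym bc)
      Aa₃ : Add a (sh (b ∷ c ∷ u₃))
      Aa₃ = add-cong (≗-sym (≗-trans (addc-cong b e₃) e₂)) (headA v₁)
      Aa : Add a (sh u₃)
      Aa = add-swap₁ (add-swap₁ Aa₃ (apart-sym ab)) (apart-sym ac)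
      Result : Set
      Result = ∃[ p ] ∃[ q ] ∃[ r ] ∃[ t ] (a < p × p < b) × (b < q × q < c) × (p < r × r < q) ×
        Valid (a ∷ b ∷ p ∷ c ∷ q ∷ r ∷ t) × length w ≡ 6 + length t × sh (a ∷ b ∷ p ∷ c ∷ q ∷ r ∷ t) ≗ sh w
      finish : ∃[ p ] (a < p) × (p < b) × Rem p (sh u₃) → ∃[ q ] (b < q) × (q < c) × Rem q (sh u₃) → Result
      finish (p , a<p , p<b , rp) (q , b<q , q<c , rq)
        with two-corners (tailV v₃) rp rq (<⇒≢ (<-trans p<b b<q))
      ... | r , t , br , vt , lt , et
        -- Exchanging `c` and `p` makes `a`, `b`, `p` the top three letters, so that a move at depth
        -- 0 exchanges `a` and `b`.
        with swap-valid {c} {p} {q ∷ r ∷ t} (add-cong (≗-sym et) (headA v₃) ∷ vt) (btw-apart (inj₁ (p<b , b<c)))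
      ... | vp , ep =
        p , q , r , t , (a<p , p<b) , (b<q , q<c) , order br ,
        (add-cong (≗-sym eb) (headA v₁) ∷ (add-cong (≗-sym ec) (headA v₂) ∷ vp)) ,
        trans l₁ (cong suc (trans l₂ (cong suc (trans l₃ (cong suc lt))))) ,
        ≗-trans (addc-cong a eb) e₁
        where
        ec : sh (p ∷ c ∷ q ∷ r ∷ t) ≗ sh u₂
        ec = ≗-trans ep (≗-trans (addc-cong c et) e₃)
        eb : sh (b ∷ p ∷ c ∷ q ∷ r ∷ t) ≗ sh u₁
        eb = ≗-trans (addc-cong b ec) e₂
        order : Btw p r q → p < r × r < q
        order (inj₁ o) = o
        order (inj₂ (x , y)) = ⊥-elim (<-asym (<-trans x y) (<-trans p<b b<q))

-- Order-preserving coordinates for the top six letters a b p c q r of a word.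
record Frame (a b p c q r : ℕ) : Set where
  field
    f      : ℕ → ℕ
    w      : List ℕ
    w∈     : w ∈ staircases
    mono   : Mono f w
    start  : map f w ≡ a ∷ b ∷ p ∷ c ∷ q ∷ r ∷ []
    second : map f (run (0 ∷ 2 ∷ 1 ∷ 3 ∷ 2 ∷ []) w) ≡ b ∷ c ∷ q ∷ a ∷ p ∷ r ∷ []
    third  : map f (run (0 ∷ 2 ∷ 1 ∷ 3 ∷ 2 ∷ 0 ∷ 2 ∷ 3 ∷ 1 ∷ []) w) ≡ c ∷ a ∷ b ∷ p ∷ q ∷ r ∷ []
    final  : map f (run loop w) ≡ a ∷ b ∷ p ∷ c ∷ q ∷ r ∷ []

private
  lt : ∀ j k → {_ : _≤ᵇ_ (suc j) k ≡ true} → j < k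
  lt j k {e} = <ᵇ-true⁻¹ e

frame : ∀ {a b p c q r} → a < p → p < b → b < q → q < c → p < r → r < q → Frame a b p c q r
frame {a} {b} {p} {c} {q} {r} a<p p<b b<q q<c p<r r<q with <-cmp b r
... | tri≈ _ refl _ = record
  { f = nth (a ∷ p ∷ b ∷ q ∷ c ∷ []) ; w = 0 ∷ 2 ∷ 1 ∷ 4 ∷ 3 ∷ 2 ∷ [] ; w∈ = here refl
  ; mono = nth-Mono (a<p ∷ (p<b ∷ (b<q ∷ (q<c ∷ [-])))) (lt 0 5 {refl} ∷ lt 2 5 {refl} ∷ lt 1 5 {refl} ∷ lt 4 5 {refl} ∷ lt 3 5 {refl} ∷ lt 2 5 {refl} ∷ [])
  ; start = refl ; second = refl ; third = refl ; final = refl }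
... | tri< b<r _ _ = record
  { f = nth (a ∷ p ∷ b ∷ r ∷ q ∷ c ∷ []) ; w = 0 ∷ 2 ∷ 1 ∷ 5 ∷ 4 ∷ 3 ∷ [] ; w∈ = there (here refl)
  ; mono = nth-Mono (a<p ∷ (p<b ∷ (b<r ∷ (r<q ∷ (q<c ∷ [-]))))) (lt 0 6 {refl} ∷ lt 2 6 {refl} ∷ lt 1 6 {refl} ∷ lt 5 6 {refl} ∷ lt 4 6 {refl} ∷ lt 3 6 {refl} ∷ [])
  ; start = refl ; second = refl ; third = refl ; final = refl }
... | tri> _ _ r<b = record
  { f = nth (a ∷ p ∷ r ∷ b ∷ q ∷ c ∷ []) ; w = 0 ∷ 3 ∷ 1 ∷ 5 ∷ 4 ∷ 2 ∷ [] ; w∈ = there (there (here refl))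
  ; mono = nth-Mono (a<p ∷ (p<r ∷ (r<b ∷ (b<q ∷ (q<c ∷ [-]))))) (lt 0 6 {refl} ∷ lt 3 6 {refl} ∷ lt 1 6 {refl} ∷ lt 5 6 {refl} ∷ lt 4 6 {refl} ∷ lt 2 6 {refl} ∷ [])
  ; start = refl ; second = refl ; third = refl ; final = refl }

module Injectivity (G : SCG) (ax1 : Ax1 G) (ax2 : Ax2 G) (ax3 : Ax3 G) (ax5 : Ax5 G) where
  open SCG G
  open Vert G ax1
  open Far ax2 ax5
  open Words n
  open Corners n
  open Covers G ax1 ax2 ax3 ax5
  open Windows G ax1 ax2 ax3 ax5

  -- Axiom 6 for the colour `i`, the fact that the two implications obtain differently.
  Link : ℕ → Set
  Link i = ∀ v w → Comp i v w → ∃[ a ] ∃[ b ] (Conn G (Below G i) v a × (a ≡ b ⊎ Edge G i a b) × Conn G (Below G i) b w)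

  below : ∀ {i v w} → Conn G (Below G (suc i)) v w → Comp i v w
  below = conn-mono (λ _ (p , q) → p , ≤-pred q)

  upto : ∀ {i v w} → Comp i v w → Conn G (Below G (suc i)) v w
  upto = conn-mono (λ _ (p , q) → p , s≤s q)

  module _ {i} (c : PreCover (suc i)) (m≤i : m ≤ i) (I<n : suc i < n)
           (double : m < i → Double (suc i)) (square : suc m < i → Square (suc i)) (inj : Inj c i) where
    open PreCover c hiding (Top)
    open TopMove c m≤i I<n double square

    hd-dd : ∀ t w → hd (dd (suc t) w) ≡ hd w
    hd-dd t [] = refl
    hd-dd t (_ ∷ _) = refl

    private
      step-move : ∀ {v x j} → j ≤ i → Edge G j v x → φ x ≡ dd (suc (i ∸ j)) (φ v)
      step-move {v} {x} {j} l e = trans (cong φ (sym (edge-nb e))) (trans (cong (λ k → φ (nb k v)) (sym (m∸[m∸n]≡n l))) (move (i ∸ j) v))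

    comp-head : ∀ {v w} → Comp i v w → hd (φ v) ≡ hd (φ w)
    comp-head ε = refl
    comp-head {v} (_◅_ {j = x} (j , (_ , l) , e) p) =
      trans (sym (trans (cong hd (step-move {v} {x} l e)) (hd-dd (i ∸ j) (φ v)))) (comp-head p)

    comp-shape : ∀ {v w} → Comp i v w → sh (φ v) ≗ sh (φ w)
    comp-shape ε p = refl
    comp-shape {v} (_◅_ {j = x} (j , (_ , l) , e) q) =
      ≗-trans (≗-sym (subst (λ u → sh u ≗ sh (φ v)) (sym (step-move {v} {x} l e)) (proj₂ (dd-valid (suc (i ∸ j)) (valid v))))) (comp-shape q)

    opaque
      lift : ∀ {v w x u} → φ v ≡ x ∷ u → Valid (x ∷ w) → length u ≡ length w → sh (x ∷ u) ≗ sh (x ∷ w) → ∃[ v' ] Comp i v v' × φ v' ≡ x ∷ w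
      lift {v} {w} {x} {u} e vw l s
        with same-shape-connected u w (tailV (valid-word e)) (tailV vw) l (tail-≗ {x} {u} {w} (valid-word e) vw s)
      ... | ts , r = vrun I (map suc ts) v , run-comp-suc i ts v ,
                     trans (φ-run-suc ts v) (trans (cong (run (map suc ts)) e) (trans (run-suc ts x u) (cong (x ∷_) r)))

    -- Lower colours keep the last letter, while an `I`-edge either stays in its lower component or
    -- changes the last letter. Vertices with equal words joined through at most one `I`-edge
    -- therefore lie in one lower component, where the map is injective.
    link-inj : Link I → Inj c I
    link-inj link v w cvw e with link v w cvw
    ... | a , b , ca , o , cb = inj v w (close o) e
      where
      ends : hd (φ a) ≡ hd (φ b)
      ends = trans (sym (comp-head (below ca))) (trans (cong hd e) (comp-head (conn-sym (below cb))))
      close : a ≡ b ⊎ Edge G I a b → Comp i v w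
      close (inj₁ refl) = below ca ◅◅ below cb
      close (inj₂ ed) with split a
      ... | z , y , x , u , ea with valid-tri (valid-word ea)
      ... | inj₁ bt = ⊥-elim (true≢false (edge-adm {I} {a} {b} ed) (trans (adm-word 0 ea 3≤) (cong not (btw-true bt))))
      ... | inj₂ (inj₂ bt) = below ca ◅◅ (subst (Comp i a) (edge-nb ed) (proj₂ (z-middle ea bt)) ◅◅ below cb)
      ... | inj₂ (inj₁ bt) = ⊥-elim (proj₁ (btw-apart bt) (trans (sym (cong hd eb)) (trans (sym ends) (cong hd ea))))
        where
        eb : φ b ≡ y ∷ z ∷ x ∷ u
        eb = trans (cong φ (sym (edge-nb ed))) (trans (top-move a) (trans (cong (dd 0) ea) (dd-x u bt)))

    -- An `I`-edge that really moves the last letter, from the corner `z` to the corner `y`, links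
    -- the two lower components.
    record Joined (v w : Fin size) : Set where
      constructor joined
      field
        {from} : Fin size
        {z y x} : ℕ
        {u}   : List ℕ
        word  : φ from ≡ z ∷ y ∷ x ∷ u
        mid   : Btw y x z
        left  : Comp i v from
        right : Comp i (nb I from) w

    joined-target : ∀ {v z y x u} → φ v ≡ z ∷ y ∷ x ∷ u → Btw y x z → φ (nb I v) ≡ y ∷ z ∷ x ∷ u
    joined-target {v} {u = u} e b = trans (top-move v) (trans (cong (dd 0) e) (dd-x u b))

    joined-sym : ∀ {v w} → Joined v w → Joined w v
    joined-sym {v} (joined {p} e b l r) = joined (joined-target e b) (btw-sym b) (conn-sym r)
      (subst (λ a → Comp i a v) (sym (nb-invol I p)) (conn-sym l))

    joined-comp : ∀ {v v' w w'} → Comp i v' v → Joined v w → Comp i w w' → Joined v' w'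
    joined-comp a (joined e b l r) a' = joined e b (a ◅◅ l) (r ◅◅ a')

    private
      joined-same : ∀ {v w z y x u u'} → φ v ≡ z ∷ y ∷ x ∷ u → φ w ≡ z ∷ y ∷ x ∷ u' → Comp i v w → Comp i (nb I v) (nb I w)
      joined-same {v} {w} {z} {y} {x} {u} {u'} e e' cvw
        with same-shape-connected u u' (tailV (tailV (tailV (valid-word e)))) (tailV (tailV (tailV (valid-word e'))))
               (suc-injective (suc-injective (suc-injective (trans (cong length (sym e)) (trans (trans (len v) (sym (len w))) (cong length e'))))))
               (tail-≗ {x} {u} {u'} (tailV (tailV (valid-word e))) (tailV (tailV (valid-word e')))
               (tail-≗ {y} {x ∷ u} {x ∷ u'} (tailV (valid-word e)) (tailV (valid-word e'))
               (tail-≗ {z} {y ∷ x ∷ u} {y ∷ x ∷ u'} (valid-word e) (valid-word e')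
               (subst₂ (λ a b → sh a ≗ sh b) e e' (comp-shape cvw)))))
      ... | ts , r = subst (λ a → Comp i (nb I v) (nb I a)) (inj vert w (conn-sym comp ◅◅ cvw) (trans word (sym e'))) comp-nb
        where open Moved (shift-tail ts r e)

    opaque
      -- Two such edges may differ in the letter separating the corners. `Square` with colour
      -- `I − 2` replaces `x` by `x'`, after which both edges start at words with the same top three
      -- letters and `joined-same` applies.
      joined-unique : ∀ {v w w'} → Joined v w → Joined v w' → hd (φ w) ≡ hd (φ w') → Comp i w w'
      joined-unique {v} {w} {w'} (joined {p} {z} {y} {x} {u} e b l r) (joined {p'} {z'} {y'} {x'} {u'} e' b' l' r') h =
        conn-sym r ◅◅ (main z≡ y≡ (x ≟ x') ◅◅ r')
        where
        cpp : Comp i p p'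
        cpp = conn-sym l ◅◅ l'
        z≡ : z ≡ z'
        z≡ = trans (sym (cong hd e)) (trans (comp-head cpp) (cong hd e'))
        y≡ : y ≡ y'
        y≡ = trans (sym (cong hd (joined-target e b))) (trans (comp-head r) (trans h (trans (sym (comp-head r')) (cong hd (joined-target e' b')))))
        main : z ≡ z' → y ≡ y' → Dec (x ≡ x') → Comp i (nb I p) (nb I p')
        main refl refl (yes refl) = joined-same e e' cpp
        main refl refl (no ne) with expose₂ {u = u} {x'} e
               (rem-cong (≗-sym (tail-≗ {y} {x ∷ u} {x' ∷ u'} (tailV (valid-word e)) (tailV (valid-word e'))
                 (tail-≗ {z} {y ∷ x ∷ u} {y ∷ x' ∷ u'} (valid-word e) (valid-word e')
                 (subst₂ (λ a b → sh a ≗ sh b) e e' (comp-shape cpp))))) (remHead {x'} {u'})) (ne ∘ sym)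
        ... | s , t , bs , m' with square-move (Moved.word m') bs b b' (Moved.partner-word m' (joined-target e b))
        ... | e₂ , sq = Moved.comp-nb m' ◅◅ (low (nb I vert) ◅◅
                (subst (λ a → Comp i a (nb I p')) sq (joined-same e₂ e' (conn-sym (comp ◅◅ low vert) ◅◅ cpp))))
          where
          open Moved m'
          low : ∀ v → Comp i v (nb (I ∸ 2) v)
          low v = nb-conn λ r → proj₁ r , m∸n≤m i 1

    record Triangle (a b c : ℕ) : Set where
      field
        {A B C}  : Fin size
        hA : hd (φ A) ≡ a
        hB : hd (φ B) ≡ b
        hC : hd (φ C) ≡ c
        AB : Joined A B
        BC : Joined B C
        CA : Joined C A

    joined-head : ∀ {v z y x u} → φ v ≡ z ∷ y ∷ x ∷ u → Btw y x z → hd (φ (nb I v)) ≡ y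
    joined-head e b = cong hd (joined-target e b)

    opaque
      joined-rem : ∀ {v w} → Joined v w → Rem (hd (φ w)) (sh (φ v))
      joined-rem {v} {w} (joined {p} e b l r) =
        rem-cong (≗-sym (≗-trans (comp-shape l) (≗-trans (≗-sym (subst (λ u → sh u ≗ sh (φ p)) (sym (top-move p)) (proj₂ (dd-valid 0 (valid p))))) (comp-shape r))))
          (own-head w (split w))
        where
        own-head : ∀ w → ∃[ z ] ∃[ y ] ∃[ x ] ∃[ u ] φ w ≡ z ∷ y ∷ x ∷ u → Rem (hd (φ w)) (sh (φ w))
        own-head w (z , y , x , u , e) = subst (λ k → Rem (hd k) (sh k)) (sym e) (remHead {z} {y ∷ x ∷ u})

    edge-kind : ∀ {p q} → Edge G I p q → Comp i p q ⊎ Joined p q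
    edge-kind {p} {q} ed with split p
    ... | z , y , x , u , e with valid-tri (valid-word e)
    ... | inj₁ bt = ⊥-elim (true≢false (edge-adm {I} {p} {q} ed) (trans (adm-word 0 e 3≤) (cong not (btw-true bt))))
    ... | inj₂ (inj₂ bt) = inj₁ (subst (Comp i p) (edge-nb ed) (proj₂ (z-middle e bt)))
    ... | inj₂ (inj₁ bt) = inj₂ (joined e bt ε (subst (λ a → Comp i a q) (sym (edge-nb ed)) ε))

    module Closing (sim : suc (suc m) < i → ∀ v → Sim G ax1 I 6 v) where

      module _ {a b p c q r : ℕ} {t : List ℕ} (a<p : a < p) (p<b : p < b) (b<q : b < q) (q<c : q < c) (p<r : p < r) (r<q : r < q) where
        private
          module F = Frame (frame a<p p<b b<q q<c p<r r<q)

          fits : ∀ {ts} → Fits 6 ts → Fits (length (map F.f F.w)) ts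
          fits {ts} = subst (λ k → Fits k ts) (sym (cong length F.start))

          run-frame : ∀ ts → Fits 6 ts → run ts (a ∷ b ∷ p ∷ c ∷ q ∷ r ∷ t) ≡ map F.f (run ts F.w) ++ t
          run-frame ts fs = trans (cong (λ w → run ts (w ++ t)) (sym F.start))
            (trans (run-++ˡ ts (map F.f F.w) t (fits fs)) (cong (_++ t) (run-map ts F.w F.mono)))

          3≤6 : 3 ≤ 6
          3≤6 = 3≤
          4≤6 : 4 ≤ 6
          4≤6 = 4≤
          5≤6 : 5 ≤ 6
          5≤6 = 5≤
          f₂₁₃₂ : Fits 6 (2 ∷ 1 ∷ 3 ∷ 2 ∷ [])
          f₂₁₃₂ = 5≤6 ∷ 4≤6 ∷ ≤-refl ∷ 5≤6 ∷ []
          f₂₃₁ : Fits 6 (2 ∷ 3 ∷ 1 ∷ [])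
          f₂₃₁ = 5≤6 ∷ ≤-refl ∷ 4≤6 ∷ []
          f₃₁₃₂ : Fits 6 (3 ∷ 1 ∷ 3 ∷ 2 ∷ [])
          f₃₁₃₂ = ≤-refl ∷ 4≤6 ∷ ≤-refl ∷ 5≤6 ∷ []

        opaque
          second-word : run (0 ∷ 2 ∷ 1 ∷ 3 ∷ 2 ∷ []) (a ∷ b ∷ p ∷ c ∷ q ∷ r ∷ t) ≡ b ∷ c ∷ q ∷ a ∷ p ∷ r ∷ t
          second-word = trans (run-frame (0 ∷ 2 ∷ 1 ∷ 3 ∷ 2 ∷ []) (3≤6 ∷ f₂₁₃₂)) (cong (_++ t) F.second)

          third-word : run (0 ∷ 2 ∷ 1 ∷ 3 ∷ 2 ∷ 0 ∷ 2 ∷ 3 ∷ 1 ∷ []) (a ∷ b ∷ p ∷ c ∷ q ∷ r ∷ t) ≡ c ∷ a ∷ b ∷ p ∷ q ∷ r ∷ t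
          third-word = trans (run-frame (0 ∷ 2 ∷ 1 ∷ 3 ∷ 2 ∷ 0 ∷ 2 ∷ 3 ∷ 1 ∷ []) (3≤6 ∷ AllP.++⁺ f₂₁₃₂ (3≤6 ∷ f₂₃₁))) (cong (_++ t) F.third)

          final-word : run loop (a ∷ b ∷ p ∷ c ∷ q ∷ r ∷ t) ≡ a ∷ b ∷ p ∷ c ∷ q ∷ r ∷ t
          final-word = trans (run-frame loop (3≤6 ∷ AllP.++⁺ f₂₁₃₂ (3≤6 ∷ AllP.++⁺ f₂₃₁ (3≤6 ∷ f₃₁₃₂)))) (cong (_++ t) F.final)

          -- Grouped as 0 · 2132 · 0 · 231 · 0 · 3132, the walk `loop` crosses three `I`-edges, and
          -- the blocks between them stay in lower components. Its closing in the graph is what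
          -- makes the third side return to `A`.
          triangle : ∀ {v} → φ v ≡ a ∷ b ∷ p ∷ c ∷ q ∷ r ∷ t → ∃[ T ] Triangle.A {a} {b} {c} T ≡ v
          triangle {v} e = record
            { A = v ; B = nb I v ; C = nb I v₂
            ; hA = cong hd e ; hB = joined-head e (inj₂ (a<p , p<b)) ; hC = joined-head e₂ (inj₂ (b<q , q<c))
            ; AB = joined e (inj₂ (a<p , p<b)) ε ε
            ; BC = joined e₂ (inj₂ (b<q , q<c)) (run-comp-suc i (1 ∷ 0 ∷ 2 ∷ 1 ∷ []) (nb I v)) ε
            ; CA = joined e₄ (inj₁ (<-trans a<p p<b , <-trans b<q q<c)) (run-comp-suc i (1 ∷ 2 ∷ 0 ∷ []) (nb I v₂))
                     (subst (Comp i (nb I v₄)) closed (run-comp-suc i (2 ∷ 0 ∷ 2 ∷ 1 ∷ []) (nb I v₄)))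
            } , refl
            where
            v₂ v₄ : Fin size
            v₂ = vrun I (0 ∷ 2 ∷ 1 ∷ 3 ∷ 2 ∷ []) v
            v₄ = vrun I (0 ∷ 2 ∷ 1 ∷ 3 ∷ 2 ∷ 0 ∷ 2 ∷ 3 ∷ 1 ∷ []) v
            e₂ : φ v₂ ≡ b ∷ c ∷ q ∷ a ∷ p ∷ r ∷ t
            e₂ = trans (φ-run top-move (0 ∷ 2 ∷ 1 ∷ 3 ∷ 2 ∷ []) v) (trans (cong (run (0 ∷ 2 ∷ 1 ∷ 3 ∷ 2 ∷ [])) e) second-word)
            e₄ : φ v₄ ≡ c ∷ a ∷ b ∷ p ∷ q ∷ r ∷ t
            e₄ = trans (φ-run top-move (0 ∷ 2 ∷ 1 ∷ 3 ∷ 2 ∷ 0 ∷ 2 ∷ 3 ∷ 1 ∷ []) v) (trans (cong (run (0 ∷ 2 ∷ 1 ∷ 3 ∷ 2 ∷ 0 ∷ 2 ∷ 3 ∷ 1 ∷ [])) e) third-word)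
            big : suc (suc m) < i
            big = ≤-pred-∸ (proj₁ (in-range 3 e (s≤s 5≤)))
              where
              ≤-pred-∸ : ∀ {a b} → a < b ∸ 2 → suc (suc a) < b
              ≤-pred-∸ {a} {suc (suc b)} l = s≤s (s≤s l)
            closed : vrun I loop v ≡ v
            closed = sim-loop G ax1 (sim big v) F.w∈ λ ts k fs l →
              let e' : φ (vrun I ts v) ≡ map F.f (run ts F.w) ++ t
                  e' = trans (φ-run top-move ts v) (trans (cong (run ts) e) (run-frame ts fs))
                  l' : k + 3 ≤ length (map F.f (run ts F.w))
                  l' = subst (k + 3 ≤_) (sym (trans (length-map F.f (run ts F.w)) (trans (length-run ts F.w) (trans (sym (length-map F.f F.w)) (cong length F.start))))) l
              in trans (adm-word k e' (≤-trans l' (subst (length (map F.f (run ts F.w)) ≤_) (sym (length-++ (map F.f (run ts F.w)))) (m≤m+n _ _))))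
                 (trans (active-++ k (map F.f (run ts F.w)) t l') (active-map k (run ts F.w) (mono-run {F.f} ts F.w F.mono)))

      record Located (a b c : ℕ) (x : Fin size) : Set where
        field
          T     : Triangle a b c
          place : (hd (φ x) ≡ a × Comp i x (Triangle.A T)) ⊎ (hd (φ x) ≡ b × Comp i x (Triangle.B T)) ⊎ (hd (φ x) ≡ c × Comp i x (Triangle.C T))

      opaque
        -- If the last letter is `b` or `c`, a word of `loop` with that head is reached inside the
        -- lower component, and the start of the loop is reached from there. `joined-unique`
        -- identifies the lower component with that of the triangle built at the start.
        locate : ∀ {x a b c} → Rem a (sh (φ x)) → Rem b (sh (φ x)) → Rem c (sh (φ x)) → a < b → b < c →
          hd (φ x) ≡ a ⊎ hd (φ x) ≡ b ⊎ hd (φ x) ≡ c → Located a b c x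
        locate {x} {a} {b} {c} ra rb rc a<b b<c o with three-corners (valid x) ra rb rc a<b b<c
        ... | p , q , r , t , (a<p , p<b) , (b<q , q<c) , (p<r , r<q) , v₀ , l₀ , e₀ = go (split x) o
          where
          W₀ WB WC : List ℕ
          W₀ = a ∷ b ∷ p ∷ c ∷ q ∷ r ∷ t
          WB = b ∷ a ∷ p ∷ c ∷ q ∷ r ∷ t
          WC = c ∷ a ∷ b ∷ p ∷ q ∷ r ∷ t
          tri₀ : ∀ {v} → φ v ≡ W₀ → ∃[ T ] Triangle.A {a} {b} {c} T ≡ v
          tri₀ = triangle a<p p<b b<q q<c p<r r<q
          bB : Btw b p a
          bB = inj₂ (a<p , p<b)
          bC : Btw a b c
          bC = inj₁ (a<b , b<c)
          runB : dd 0 W₀ ≡ WB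
          runB = dd-x (c ∷ q ∷ r ∷ t) bB
          runC : run (0 ∷ 2 ∷ 1 ∷ 3 ∷ 2 ∷ 0 ∷ 2 ∷ 3 ∷ 1 ∷ []) W₀ ≡ WC
          runC = third-word a<p p<b b<q q<c p<r r<q
          goal : ∀ {k u w} → φ x ≡ k ∷ u → Valid (k ∷ w) × sh (k ∷ w) ≗ sh W₀ → length w ≡ length (b ∷ p ∷ c ∷ q ∷ r ∷ t) → ∃[ v ] Comp i x v × φ v ≡ k ∷ w
          goal e (vw , sw) lw = lift e vw (suc-injective (trans (trans (cong length (sym e)) l₀) (cong suc (sym lw))))
            (≗-trans (subst (λ u → sh u ≗ sh W₀) e (≗-sym e₀)) (≗-sym sw))
          place-A : hd (φ x) ≡ a → ∃[ v ] Comp i x v × φ v ≡ W₀ → Located a b c x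
          place-A h (v , cv , e) = fin (tri₀ e)
            where
            fin : ∃[ T ] Triangle.A {a} {b} {c} T ≡ v → Located a b c x
            fin (T , eT) = record { T = T ; place = inj₁ (h , subst (Comp i x) (sym eT) cv) }
          place-B : hd (φ x) ≡ b → ∃[ v ] Comp i x v × φ v ≡ WB → Located a b c x
          place-B h (v , cv , e) = fin (tri₀ e₁)
            where
            e₁ : φ (nb I v) ≡ W₀
            e₁ = joined-target e (btw-sym bB)
            fin : ∃[ T ] Triangle.A {a} {b} {c} T ≡ nb I v → Located a b c x
            fin (T , eT) = record { T = T ; place = inj₂ (inj₁ (h , (cv ◅◅ joined-unique
                  (joined e₁ bB (subst (λ y → Comp i y (nb I v)) (sym eT) ε) (subst (λ y → Comp i y v) (sym (nb-invol I v)) ε))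
                  (Triangle.AB T) (trans (cong hd e) (sym (Triangle.hB T)))))) }
          place-C : hd (φ x) ≡ c → ∃[ v ] Comp i x v × φ v ≡ WC → Located a b c x
          place-C h (v , cv , e) = fin (tri₀ e₁)
            where
            v' : Fin size
            v' = vrun I (3 ∷ 1 ∷ 3 ∷ 2 ∷ []) (nb I v)
            e₁ : φ v' ≡ W₀
            e₁ = trans (φ-run top-move (0 ∷ 3 ∷ 1 ∷ 3 ∷ 2 ∷ []) v) (trans (cong (run (0 ∷ 3 ∷ 1 ∷ 3 ∷ 2 ∷ [])) (trans e (sym runC)))
                   (trans (sym (run-++ (0 ∷ 2 ∷ 1 ∷ 3 ∷ 2 ∷ 0 ∷ 2 ∷ 3 ∷ 1 ∷ []) (0 ∷ 3 ∷ 1 ∷ 3 ∷ 2 ∷ []) W₀)) (final-word a<p p<b b<q q<c p<r r<q)))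
            fin : ∃[ T ] Triangle.A {a} {b} {c} T ≡ v' → Located a b c x
            fin (T , eT) = record { T = T ; place = inj₂ (inj₂ (h , (cv ◅◅ joined-unique
                  (joined-sym (joined e bC ε (subst (Comp i (nb I v)) (sym eT) (run-comp-suc i (2 ∷ 0 ∷ 2 ∷ 1 ∷ []) (nb I v)))))
                  (joined-sym (Triangle.CA T)) (trans (cong hd e) (sym (Triangle.hC T)))))) }
          go : ∃[ z ] ∃[ y ] ∃[ x' ] ∃[ u ] φ x ≡ z ∷ y ∷ x' ∷ u → hd (φ x) ≡ a ⊎ hd (φ x) ≡ b ⊎ hd (φ x) ≡ c → Located a b c x
          go (z , y , x' , u , e) (inj₁ h) = place-A h (goal (trans e (cong (_∷ y ∷ x' ∷ u) (trans (sym (cong hd e)) h))) (v₀ , λ _ → refl) refl)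
          go (z , y , x' , u , e) (inj₂ (inj₁ h)) = place-B h (goal (trans e (cong (_∷ y ∷ x' ∷ u) (trans (sym (cong hd e)) h)))
            (subst (λ w → Valid w × sh w ≗ sh W₀) runB (dd-valid 0 v₀)) refl)
          go (z , y , x' , u , e) (inj₂ (inj₂ h)) = place-C h (goal (trans e (cong (_∷ y ∷ x' ∷ u) (trans (sym (cong hd e)) h)))
            (subst (λ w → Valid w × sh w ≗ sh W₀) runC (run-valid (0 ∷ 2 ∷ 1 ∷ 3 ∷ 2 ∷ 0 ∷ 2 ∷ 3 ∷ 1 ∷ []) v₀)) refl)

      shortcut : ∀ {x v b P₁ P₂ P₃} → Joined x v → Joined x b → Comp i x P₂ → Joined P₂ P₁ → Joined P₂ P₃ → Joined P₁ P₃ →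
        hd (φ P₁) ≡ hd (φ v) → hd (φ P₃) ≡ hd (φ b) → Joined v b
      shortcut jv jb cx j₁ j₃ j h₁ h₃ =
        joined-comp (joined-unique jv (joined-comp cx j₁ ε) (sym h₁)) j (joined-unique (joined-comp cx j₃ ε) jb h₃)

      joined-≢ : ∀ {v w} → Joined v w → hd (φ v) ≢ hd (φ w)
      joined-≢ (joined e b l r) q = proj₁ (btw-apart b)
        (trans (sym (joined-head e b)) (trans (comp-head r) (trans (sym q) (trans (comp-head l) (cong hd e)))))

      own-rem : ∀ {v w} → Joined v w → Rem (hd (φ v)) (sh (φ v))
      own-rem {v} j = rem-cong (≗-sym (shapes j)) (joined-rem (joined-sym j))
        where
        shapes : ∀ {v w} → Joined v w → sh (φ v) ≗ sh (φ w)
        shapes (joined {p} e b l r) = ≗-trans (comp-shape l) (≗-trans (≗-sym (subst (λ u → sh u ≗ sh (φ p)) (sym (top-move p)) (proj₂ (dd-valid 0 (valid p))))) (comp-shape r))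

      opaque
        -- In the triangle on the three heads, the two sides at the lower component of `x` lead to
        -- the lower components of `v` and `b` by uniqueness, so the opposite side joins these. The
        -- cases are the six orders of the heads.
        joined-trans : ∀ {x v b} → Joined x v → Joined x b → hd (φ v) ≢ hd (φ b) → Joined v b
        joined-trans {x} {v} {b} jv jb ne
          with <-cmp (hd (φ x)) (hd (φ v)) | <-cmp (hd (φ v)) (hd (φ b)) | <-cmp (hd (φ x)) (hd (φ b))
        ... | tri≈ _ e _ | _ | _ = ⊥-elim (joined-≢ jv e)
        ... | _ | tri≈ _ e _ | _ = ⊥-elim (ne e)
        ... | _ | _ | tri≈ _ e _ = ⊥-elim (joined-≢ jb e)
        ... | tri< p _ _ | tri< q _ _ | _ = use (locate (own-rem jv) (joined-rem jv) (joined-rem jb) p q (inj₁ refl))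
          where
          use : Located (hd (φ x)) (hd (φ v)) (hd (φ b)) x → Joined v b
          use record { T = T ; place = inj₁ (_ , cx) } = shortcut jv jb cx AB (joined-sym CA) BC hB hC
            where open Triangle T
          use record { T = T ; place = inj₂ (inj₁ (e , _)) } = ⊥-elim (joined-≢ jv e)
          use record { T = T ; place = inj₂ (inj₂ (e , _)) } = ⊥-elim (joined-≢ jb e)
        ... | tri< p _ _ | tri> _ _ q | tri< s _ _ = use (locate (own-rem jv) (joined-rem jb) (joined-rem jv) s q (inj₁ refl))
          where
          use : Located (hd (φ x)) (hd (φ b)) (hd (φ v)) x → Joined v b
          use record { T = T ; place = inj₁ (_ , cx) } = shortcut jv jb cx (joined-sym CA) AB (joined-sym BC) hC hB
            where open Triangle T
          use record { T = T ; place = inj₂ (inj₁ (e , _)) } = ⊥-elim (joined-≢ jb e)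
          use record { T = T ; place = inj₂ (inj₂ (e , _)) } = ⊥-elim (joined-≢ jv e)
        ... | tri< p _ _ | tri> _ _ q | tri> _ _ s = use (locate (joined-rem jb) (own-rem jv) (joined-rem jv) s p (inj₂ (inj₁ refl)))
          where
          use : Located (hd (φ b)) (hd (φ x)) (hd (φ v)) x → Joined v b
          use record { T = T ; place = inj₁ (e , _) } = ⊥-elim (joined-≢ jb e)
          use record { T = T ; place = inj₂ (inj₁ (_ , cx)) } = shortcut jv jb cx BC (joined-sym AB) CA hC hA
            where open Triangle T
          use record { T = T ; place = inj₂ (inj₂ (e , _)) } = ⊥-elim (joined-≢ jv e)
        ... | tri> _ _ p | tri< q _ _ | tri< s _ _ = use (locate (joined-rem jv) (own-rem jv) (joined-rem jb) p s (inj₂ (inj₁ refl)))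
          where
          use : Located (hd (φ v)) (hd (φ x)) (hd (φ b)) x → Joined v b
          use record { T = T ; place = inj₁ (e , _) } = ⊥-elim (joined-≢ jv e)
          use record { T = T ; place = inj₂ (inj₁ (_ , cx)) } = shortcut jv jb cx (joined-sym AB) BC (joined-sym CA) hA hC
            where open Triangle T
          use record { T = T ; place = inj₂ (inj₂ (e , _)) } = ⊥-elim (joined-≢ jb e)
        ... | tri> _ _ p | tri< q _ _ | tri> _ _ s = use (locate (joined-rem jv) (joined-rem jb) (own-rem jv) q s (inj₂ (inj₂ refl)))
          where
          use : Located (hd (φ v)) (hd (φ b)) (hd (φ x)) x → Joined v b
          use record { T = T ; place = inj₁ (e , _) } = ⊥-elim (joined-≢ jv e)
          use record { T = T ; place = inj₂ (inj₁ (e , _)) } = ⊥-elim (joined-≢ jb e)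
          use record { T = T ; place = inj₂ (inj₂ (_ , cx)) } = shortcut jv jb cx CA (joined-sym BC) AB hA hB
            where open Triangle T
        ... | tri> _ _ p | tri> _ _ q | _ = use (locate (joined-rem jb) (joined-rem jv) (own-rem jv) q p (inj₂ (inj₂ refl)))
          where
          use : Located (hd (φ b)) (hd (φ v)) (hd (φ x)) x → Joined v b
          use record { T = T ; place = inj₁ (e , _) } = ⊥-elim (joined-≢ jb e)
          use record { T = T ; place = inj₂ (inj₁ (e , _)) } = ⊥-elim (joined-≢ jv e)
          use record { T = T ; place = inj₂ (inj₂ (_ , cx)) } = shortcut jv jb cx (joined-sym BC) CA (joined-sym AB) hB hA
            where open Triangle T

      Linked-once : Fin size → Fin size → Set
      Linked-once v w = ∃[ a ] ∃[ b ] (Comp i v a × (a ≡ b ⊎ Edge G I a b) × Comp i b w)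

      from-joined : ∀ {v w} → Joined v w → Linked-once v w
      from-joined (joined {p} e b l r) = p , nb I p , l , inj₂ (nb-edge (top-range e) (trans (adm-word 0 e 3≤) (cong not (btw-excl b)))) , r

      -- An `I`-edge inside a lower component is dropped. Otherwise the two moves of the last letter
      -- either return to the original corner, and by uniqueness to the original lower component, or
      -- are replaced by the third side of a triangle.
      two-edges : ∀ {v x a b} → Edge G I v x → Comp i x a → Edge G I a b → Linked-once v b
      two-edges {v} {x} {a} {b} e cxa e' with edge-kind (edge-sym {I} {v} {x} e) | edge-kind e'
      ... | inj₁ cxv | _ = a , b , conn-sym cxv ◅◅ cxa , inj₂ e' , ε
      ... | inj₂ _ | inj₁ cab = v , x , ε , inj₂ e , cxa ◅◅ cab
      ... | inj₂ jv | inj₂ jb with hd (φ v) ≟ hd (φ b)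
      ...   | yes h = v , v , ε , inj₁ refl , joined-unique jv (joined-comp cxa jb ε) h
      ...   | no h = from-joined (joined-trans jv (joined-comp cxa jb ε) h)

      link : Link I
      link v w p with go p
        where
        go : ∀ {v w} → Comp I v w → Linked-once v w
        go {v} ε = v , v , ε , inj₁ refl , ε
        go {v} (_◅_ {j = x} (j , (m<j , j≤I) , e) p) with go p | m≤n⇒m<n∨m≡n j≤I
        ... | a , b , ca , o , cb | inj₁ (s≤s j≤i) = a , b , (j , (m<j , j≤i) , e) ◅ ca , o , cb
        ... | a , b , ca , inj₁ refl , cb | inj₂ refl = v , x , ε , inj₂ e , ca ◅◅ cb
        ... | a , b , ca , inj₂ e' , cb | inj₂ refl with two-edges {v} {x} {a} {b} e ca e'
        ...   | a' , b' , ca' , o' , cb' = a' , b' , ca' , o' , cb' ◅◅ cb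
      ... | a , b , ca , o , cb = a , b , upto ca , o , upto cb

-- Tableaux from content words

bump : ℕ → (ℕ → ℕ) → ℕ → ℕ
bump r l k = if k ≡ᵇ r then suc (l k) else l k

bump-at : ∀ r l → bump r l r ≡ suc (l r)
bump-at r l rewrite ≡ᵇ-refl r = refl

bump-other : ∀ {r k} l → k ≢ r → bump r l k ≡ l k
bump-other l ne rewrite ≡ᵇ-false ne = refl

Anti : (ℕ → ℕ) → Set
Anti l = ∀ k → l (suc k) ≤ l k

anti : ∀ {l} → Anti l → ∀ {j k} → j ≤ k → l k ≤ l j
anti {l} a {j} {zero} z≤n = ≤-refl
anti {l} a {j} {suc k} le with m≤n⇒m<n∨m≡n le
... | inj₂ refl = ≤-refl
... | inj₁ (s≤s q) = ≤-trans (a k) (anti a q)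

-- The rows of successive cells, last letter first, encode a tableau as a lattice (Yamanouchi) word
-- does; `lens` recovers the shape.
lens : List ℕ → ℕ → ℕ
lens []      = λ _ → 0
lens (r ∷ R) = bump r (lens R)

module Contents (n : ℕ) where
  open Words n

  -- A cell at the end of row r (counted from 0) in a shape with row lengths l has content l r − r; contents are shifted by n.
  data Rows : List ℕ → List ℕ → Set where
    []  : Rows [] []
    _∷_ : ∀ {c w r R} → n + lens R r ≡ c + r → Rows w R → Rows (c ∷ w) (r ∷ R)

  -- The Maya diagram of the shape: a step `p` is `true` exactly when `p = n + λ_r − r` for some row
  -- `r`. Adding a cell of content `c` moves the bead of its row from `c` to `c + 1`, which is the
  -- exchange made by `addc`.
  record Good (R : List ℕ) (s : ℕ → Bool) : Set where
    field
      to    : ∀ p → s p ≡ true → ∃[ r ] n + lens R r ≡ p + r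
      from  : ∀ p r → n + lens R r ≡ p + r → s p ≡ true
      decr  : Anti (lens R)

  same-row : ∀ {l c r r'} → Anti l → n + l r ≡ c + r → n + l r' ≡ c + r' → r ≡ r'
  same-row {l} {c} {r} {r'} a e e' with <-cmp r r'
  ... | tri≈ _ q _ = q
  ... | tri< q _ _ = ⊥-elim (<⇒≱ q (+-cancelˡ-≤ c r' r (subst₂ _≤_ e' e (+-monoʳ-≤ n (anti {l} a (<⇒≤ q))))))
  ... | tri> _ _ q = ⊥-elim (<⇒≱ q (+-cancelˡ-≤ c r r' (subst₂ _≤_ e e' (+-monoʳ-≤ n (anti {l} a (<⇒≤ q))))))

  room : ∀ {R s c r} → Good R s → Add c s → n + lens R (suc r) ≡ c + suc r → lens R (suc r) < lens R r
  room {R} {s} {c} {r} g A e = ≤∧≢⇒< (Good.decr g r) λ q →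
    true≢false (Good.from g (suc c) r (trans (cong (n +_) (sym q)) (trans e (+-suc c r)))) (Add.stepʳ A)

  good-[] : Good [] (sh [])
  good-[] = record
    { to = λ p e → n ∸ p , trans (+-identityʳ n) (sym (m+[n∸m]≡n (≤ᵇ⇒≤ p n (Equivalence.from T-≡ e))))
    ; from = λ p r e → Equivalence.to T-≡ (≤⇒≤ᵇ (≤-trans (m≤m+n p r) (≤-reflexive (trans (sym e) (+-identityʳ n)))))
    ; decr = λ k → z≤n }

  good-∷ : ∀ {R s c r} → Good R s → Add c s → n + lens R r ≡ c + r → Good (r ∷ R) (addc c s)
  good-∷ {R} {s} {c} {r} g A e = record { to = to' ; from = from' ; decr = decr' }
    where
    open Good g
    to' : ∀ p → addc c s p ≡ true → ∃[ k ] n + bump r (lens R) k ≡ p + k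
    to' p t with p ≟ c | p ≟ suc c
    ... | yes refl | _ = ⊥-elim (true≢false t (addc-at p s))
    ... | no _ | yes refl = r , trans (cong (n +_) (bump-at r (lens R))) (trans (+-suc n _) (cong suc e))
    ... | no a | no b with to p (trans (sym (addc-other s a b)) t)
    ...   | k , q = k , trans (cong (n +_) (bump-other (lens R) λ { refl → a (+-cancelʳ-≡ k p c (trans (sym q) e)) })) q
    from' : ∀ p k → n + bump r (lens R) k ≡ p + k → addc c s p ≡ true
    from' p k q with k ≟ r
    ... | yes refl = subst (λ p → addc c s p ≡ true)
            (+-cancelʳ-≡ k (suc c) p (trans (sym (trans (cong (n +_) (bump-at k (lens R))) (trans (+-suc n _) (cong suc e)))) q)) (addc-suc c s)
    ... | no ne = trans (addc-other s (λ { refl → ne (same-row decr q' e) })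
                    (λ { refl → true≢false (from p k q') (Add.stepʳ A) })) (from p k q')
      where
      q' : n + lens R k ≡ p + k
      q' = trans (cong (n +_) (sym (bump-other (lens R) ne))) q
    decr' : Anti (bump r (lens R))
    decr' k with suc k ≟ r | k ≟ r
    ... | yes refl | yes ()
    ... | yes refl | no b rewrite bump-at (suc k) (lens R) | bump-other {suc k} {k} (lens R) b = room g A e
    ... | no a | yes refl rewrite bump-at k (lens R) | bump-other {k} {suc k} (lens R) a = ≤-trans (decr k) (n≤1+n _)
    ... | no a | no b rewrite bump-other {r} {k} (lens R) b | bump-other {r} {suc k} (lens R) a = decr k

  rows-good : ∀ {w R} → Valid w → Rows w R → Good R (sh w)
  rows-good [] [] = good-[]
  rows-good (A ∷ v) (e ∷ rs) = good-∷ (rows-good v rs) A e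

  rows-exist : ∀ {w} → Valid w → ∃[ R ] Rows w R
  rows-exist [] = [] , []
  rows-exist (A ∷ v) with rows-exist v
  ... | R , rs with Good.to (rows-good v rs) _ (Add.stepˡ A)
  ... | r , e = r ∷ R , e ∷ rs

  rows-unique : ∀ {w R R'} → Valid w → Rows w R → Rows w R' → R ≡ R'
  rows-unique [] [] [] = refl
  rows-unique (A ∷ v) (e ∷ rs) (e' ∷ rs') with rows-unique v rs rs'
  ... | refl = cong (_∷ _) (same-row (Good.decr (rows-good v rs)) e e')

  contents-unique : ∀ {w w' R} → Rows w R → Rows w' R → w ≡ w'
  contents-unique [] [] = refl
  contents-unique {c ∷ _} {c' ∷ _} {r ∷ _} (e ∷ rs) (e' ∷ rs') = cong₂ _∷_ (+-cancelʳ-≡ r c c' (trans (sym e) e')) (contents-unique rs rs')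

  length-rows : ∀ {w R} → Rows w R → length R ≡ length w
  length-rows [] = refl
  length-rows (_ ∷ rs) = cong suc (length-rows rs)

  grown : ∀ {c r R} → n + lens R r ≡ c + r → n + lens (r ∷ R) r ≡ suc c + r
  grown {c} {r} {R} e = trans (cong (n +_) (bump-at r (lens R))) (trans (+-suc n _) (cong suc e))

  rows-≢ : ∀ {z y w rz ry R} → Rows (z ∷ y ∷ w) (rz ∷ ry ∷ R) → suc y ≢ z → rz ≢ ry
  rows-≢ {z} {y} {w} {rz} {ry} {R} (e ∷ (e' ∷ rs)) ne refl = ne (+-cancelʳ-≡ rz (suc y) z
    (trans (trans (cong suc (sym e')) (sym (+-suc n _))) (trans (cong (n +_) (sym (bump-at rz (lens R)))) e)))

  rows-swap : ∀ {z y w rz ry R} → Rows (z ∷ y ∷ w) (rz ∷ ry ∷ R) → suc y ≢ z → Rows (y ∷ z ∷ w) (ry ∷ rz ∷ R)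
  rows-swap {z} {y} {w} {rz} {ry} {R} rs@(e ∷ (e' ∷ rs')) ne =
    trans (cong (n +_) (bump-other (lens R) (rows-≢ rs ne ∘ sym))) e' ∷
    (trans (cong (n +_) (sym (bump-other (lens R) (rows-≢ rs ne)))) e ∷ rs')

  -- The equation for `ra` says that `d` further cells follow the cell of content `ca` in its row.
  -- As row lengths decrease upwards, the content of a later cell then decides on which side of that
  -- row it is placed.
  later-right : ∀ {l ca ra cb rb} d → Anti l → n + l ra ≡ suc (d + ca) + ra → n + l rb ≡ cb + rb → d + ca < cb → rb ≤ ra
  later-right {l} {ca} {ra} {cb} {rb} d a e e' lt with ra <? rb
  ... | no q = ≮⇒≥ q
  ... | yes q = ⊥-elim (<⇒≱ (+-mono-≤-< lt q) (subst₂ _≤_ e' e (+-monoʳ-≤ n (anti {l} a (<⇒≤ q)))))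

  later-left : ∀ {l ca ra cb rb} d → Anti l → n + l ra ≡ suc (d + ca) + ra → n + l rb ≡ cb + rb → cb < ca → ra < rb
  later-left {l} {ca} {ra} {cb} {rb} d a e e' lt with ra <? rb
  ... | yes q = q
  ... | no q = ⊥-elim (<⇒≱ (+-mono-<-≤ (≤-trans lt (≤-trans (m≤n+m ca d) (n≤1+n _))) (≮⇒≥ q))
                 (subst₂ _≤_ e e' (+-monoʳ-≤ n (anti {l} a (≮⇒≥ q)))))

-- Building tableaux by inserting letters at row ends

insRow : ℕ → ℕ → Tab → Tab
insRow zero    x []        = (x ∷ []) ∷ []
insRow zero    x (row ∷ T) = (row ∷ʳ x) ∷ T
insRow (suc r) x []        = [] ∷ insRow r x []
insRow (suc r) x (row ∷ T) = row ∷ insRow r x T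

rowLen : Tab → ℕ → ℕ
rowLen []        _       = 0
rowLen (row ∷ T) zero    = length row
rowLen (row ∷ T) (suc r) = rowLen T r

rowLen-ins : ∀ r x T k → rowLen (insRow r x T) k ≡ bump r (rowLen T) k
rowLen-ins zero x [] zero = refl
rowLen-ins zero x [] (suc k) = refl
rowLen-ins zero x (row ∷ T) zero = trans (length-++ row) (+-comm (length row) 1)
rowLen-ins zero x (row ∷ T) (suc k) = refl
rowLen-ins (suc r) x [] zero = refl
rowLen-ins (suc r) x [] (suc k) = rowLen-ins r x [] k
rowLen-ins (suc r) x (row ∷ T) zero = refl
rowLen-ins (suc r) x (row ∷ T) (suc k) = rowLen-ins r x T k

at-snoc : ∀ (row : List ℕ) x → at (row ∷ʳ x) (length row) ≡ just x
at-snoc [] x = refl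
at-snoc (y ∷ row) x = at-snoc row x

at-snoc-other : ∀ (row : List ℕ) x {c} → c ≢ length row → at (row ∷ʳ x) c ≡ at row c
at-snoc-other [] x {zero} ne = ⊥-elim (ne refl)
at-snoc-other [] x {suc c} ne = refl
at-snoc-other (y ∷ row) x {zero} ne = refl
at-snoc-other (y ∷ row) x {suc c} ne = at-snoc-other row x (ne ∘ cong suc)

entry-new : ∀ r x T → entry (insRow r x T) r (rowLen T r) ≡ just x
entry-new zero x [] = refl
entry-new zero x (row ∷ T) = at-snoc row x
entry-new (suc r) x [] = entry-new r x []
entry-new (suc r) x (row ∷ T) = entry-new r x T

entry-old : ∀ r x T {k c} → ¬ (k ≡ r × c ≡ rowLen T r) → entry (insRow r x T) k c ≡ entry T k c
entry-old zero x [] {zero} {zero} ne = ⊥-elim (ne (refl , refl))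
entry-old zero x [] {zero} {suc c} ne = refl
entry-old zero x [] {suc k} ne = refl
entry-old zero x (row ∷ T) {zero} ne = at-snoc-other row x (λ e → ne (refl , e))
entry-old zero x (row ∷ T) {suc k} ne = refl
entry-old (suc r) x [] {zero} ne = refl
entry-old (suc r) x [] {suc k} ne = entry-old r x [] {k} (λ (p , q) → ne (cong suc p , q))
entry-old (suc r) x (row ∷ T) {zero} ne = refl
entry-old (suc r) x (row ∷ T) {suc k} ne = entry-old r x T {k} (λ (p , q) → ne (cong suc p , q))

entry-< : ∀ T {k c a} → entry T k c ≡ just a → c < rowLen T k
entry-< (row ∷ T) {zero} e = at-<-length row e
entry-< (row ∷ T) {suc k} e = entry-< T {k} e

ins-comm : ∀ {r r'} x x' T → r ≢ r' → insRow r x (insRow r' x' T) ≡ insRow r' x' (insRow r x T)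
ins-comm {zero} {zero} x x' T ne = ⊥-elim (ne refl)
ins-comm {zero} {suc r'} x x' [] ne = refl
ins-comm {zero} {suc r'} x x' (row ∷ T) ne = refl
ins-comm {suc r} {zero} x x' [] ne = refl
ins-comm {suc r} {zero} x x' (row ∷ T) ne = refl
ins-comm {suc r} {suc r'} x x' [] ne = cong ([] ∷_) (ins-comm x x' [] (ne ∘ cong suc))
ins-comm {suc r} {suc r'} x x' (row ∷ T) ne = cong (row ∷_) (ins-comm x x' T (ne ∘ cong suc))

ins-map : ∀ (f : ℕ → ℕ) r x T → map (map f) (insRow r x T) ≡ insRow r (f x) (map (map f) T)
ins-map f zero x [] = refl
ins-map f zero x (row ∷ T) = cong (_∷ map (map f) T) (map-++ f row (x ∷ []))
ins-map f (suc r) x [] = cong ([] ∷_) (ins-map f r x [])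
ins-map f (suc r) x (row ∷ T) = cong (map f row ∷_) (ins-map f r x T)

ins-word : ∀ r x T → readingWord (insRow r x T) ↭ x ∷ readingWord T
ins-word zero x [] = ↭-refl
ins-word zero x (row ∷ T) = ↭-trans (↭-reflexive (trans (readingWord-∷ (row ∷ʳ x) T) (sym (++-assoc (readingWord T) row (x ∷ [])))))
  (↭-trans (↭-sym (∷↭∷ʳ x (readingWord T ++ row))) (↭-reflexive (cong (x ∷_) (sym (readingWord-∷ row T)))))
ins-word (suc r) x [] = ↭-trans (↭-reflexive (readingWord-∷ [] (insRow r x []))) (++⁺ʳ [] (ins-word r x []))
ins-word (suc r) x (row ∷ T) = ↭-trans (↭-reflexive (readingWord-∷ row (insRow r x T)))
  (↭-trans (++⁺ʳ row (ins-word r x T)) (↭-reflexive (cong (x ∷_) (sym (readingWord-∷ row T)))))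

ins-sum : ∀ r x T → sum (map length (insRow r x T)) ≡ suc (sum (map length T))
ins-sum zero x [] = refl
ins-sum zero x (row ∷ T) = cong (_+ sum (map length T)) (trans (length-++ row) (+-comm (length row) 1))
ins-sum (suc r) x [] = ins-sum r x []
ins-sum (suc r) x (row ∷ T) = trans (cong (length row +_) (ins-sum r x T)) (+-suc (length row) _)

rowLen-pos : ∀ T k → 1 ≤ rowLen T k → k < length T
rowLen-pos (row ∷ T) zero l = s≤s z≤n
rowLen-pos (row ∷ T) (suc k) l = s≤s (rowLen-pos T k l)

Anti-Decr : ∀ T → Anti (rowLen T) → Decr (map length T)
Anti-Decr [] a = []
Anti-Decr (row ∷ []) a = [ _ ]
Anti-Decr (row ∷ row' ∷ T) a = a 0 ∷ Anti-Decr (row' ∷ T) (a ∘ suc)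

ins-pos : ∀ r x T → r ≤ length T → AllPos (map length T) → AllPos (map length (insRow r x T))
ins-pos zero x [] _ [] = s≤s z≤n ∷ []
ins-pos zero x (row ∷ T) _ (p ∷ ps) = subst (1 ≤_) (sym (length-++ row)) (≤-trans p (m≤m+n _ _)) ∷ ps
ins-pos (suc r) x (row ∷ T) (s≤s l) (p ∷ ps) = p ∷ ins-pos r x T l ps

map-local : ∀ {f : ℕ → ℕ} T → (∀ {a} → a ∈ readingWord T → f a ≡ a) → map (map f) T ≡ T
map-local {f} T h = tab-from-word _ T (trans (sym (map-∘ T)) (map-cong (λ r → length-map f r) T))
  (trans (readingWord-map f T) (trans (map-cong-local (All.tabulate h)) (map-id (readingWord T))))

dd-prefix : ∀ S w → dd (length S) (S ++ w) ≡ S ++ dd 0 w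
dd-prefix [] w = refl
dd-prefix (c ∷ S) w = cong (c ∷_) (dd-prefix S w)

module Tableaux (n m₀ : ℕ) where
  open Words n
  open Contents n

  -- The letters 1, …, m₀ are prepended to the bottom row; the cells of the word carry the letters m₀ + 1, m₀ + 2, ….
  letter : List ℕ → ℕ
  letter R = suc m₀ + length R

  tab : List ℕ → Tab
  tab []      = letters m₀ ∷ []
  tab (r ∷ R) = insRow r (letter R) (tab R)

  letter-suc : ∀ r R → letter (r ∷ R) ≡ suc (letter R)
  letter-suc r R = +-suc (suc m₀) (length R)

  data Standard : List ℕ → Set where
    []  : Standard []
    _∷_ : ∀ {r R} → Anti (lens (r ∷ R)) → Standard R → Standard (r ∷ R)

  rows-standard : ∀ {w R} → Valid w → Rows w R → Standard R
  rows-standard [] [] = []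
  rows-standard v@(_ ∷ v') rs@(_ ∷ rs') = Good.decr (rows-good v rs) ∷ rows-standard v' rs'

  standard-anti : ∀ {R} → Standard R → Anti (lens R)
  standard-anti [] k = z≤n
  standard-anti (a ∷ _) = a

  rowLen-tab : ∀ R k → rowLen (tab R) k ≡ lens R k + rowLen (tab []) k
  rowLen-tab [] k = refl
  rowLen-tab (r ∷ R) k = trans (rowLen-ins r (letter R) (tab R) k) (go k)
    where
    go : ∀ k → bump r (rowLen (tab R)) k ≡ bump r (lens R) k + rowLen (tab []) k
    go k with k ≟ r
    ... | yes refl = trans (bump-at k (rowLen (tab R))) (trans (cong suc (rowLen-tab R k)) (cong (_+ rowLen (tab []) k) (sym (bump-at k (lens R)))))
    ... | no ne = trans (bump-other (rowLen (tab R)) ne) (trans (rowLen-tab R k) (cong (_+ rowLen (tab []) k) (sym (bump-other (lens R) ne))))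

  rowLen-anti : ∀ {R} → Standard R → Anti (rowLen (tab R))
  rowLen-anti {R} s k = subst₂ _≤_ (sym (rowLen-tab R (suc k))) (sym (rowLen-tab R k))
    (+-mono-≤ (standard-anti s k) (base k))
    where
    base : ∀ k → rowLen (tab []) (suc k) ≤ rowLen (tab []) k
    base k = z≤n

  letters-suc : ∀ k → letters (suc k) ↭ suc k ∷ letters k
  letters-suc k = ↭-trans (↭-reflexive (trans (cong (map suc) (sym (upTo-∷ʳ k))) (map-++ suc (upTo k) (k ∷ [])))) (↭-sym (∷↭∷ʳ (suc k) (letters k)))

  tab-word : ∀ R → readingWord (tab R) ↭ letters (m₀ + length R)
  tab-word [] = ↭-trans (↭-reflexive (readingWord-∷ (letters m₀) [])) (↭-reflexive (cong letters (sym (+-identityʳ m₀))))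
  tab-word (r ∷ R) = ↭-trans (ins-word r (letter R) (tab R)) (↭-trans (prep (letter R) (tab-word R))
    (↭-trans (↭-sym (letters-suc (m₀ + length R))) (↭-reflexive (cong letters (sym (+-suc m₀ (length R)))))))

  tab-sum : ∀ R → sum (map length (tab R)) ≡ m₀ + length R
  tab-sum [] = trans (+-identityʳ _) (trans (trans (length-map suc (upTo m₀)) (length-upTo m₀)) (sym (+-identityʳ m₀)))
  tab-sum (r ∷ R) = trans (ins-sum r (letter R) (tab R)) (trans (cong suc (tab-sum R)) (sym (+-suc m₀ (length R))))

  entry-below-letter : ∀ R {a} → a ∈ readingWord (tab R) → a < letter R
  entry-below-letter R m = s≤s (proj₂ (∈-letters⁻ (∈-resp-↭ (tab-word R) m)))

  -- A nonempty list is required because for `m₀ = 0` the empty one gives a single row of length 0,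
  -- which is not a partition.
  tab-partition : ∀ {r R} → Standard (r ∷ R) → IsPartition (map length (tab (r ∷ R)))
  tab-partition s = Anti-Decr _ (rowLen-anti s) , positive s
    where
    fits : ∀ {r R} → Anti (lens (r ∷ R)) → r ≤ length (tab R)
    fits {zero} a = z≤n
    fits {suc r} {R} a = rowLen-pos (tab R) r (≤-trans (≤-trans (s≤s z≤n) (subst₂ _≤_ (bump-at (suc r) (lens R)) (bump-other {suc r} {r} (lens R) (1+n≢n ∘ sym)) (a r)))
                                  (≤-trans (m≤m+n _ _) (≤-reflexive (sym (rowLen-tab R r)))))
    positive : ∀ {r R} → Standard (r ∷ R) → AllPos (map length (tab (r ∷ R)))
    positive {zero} {[]} _ = subst (1 ≤_) (sym (trans (length-++ (letters m₀)) (+-comm _ 1))) (s≤s z≤n) ∷ []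
    positive {suc r} {[]} (a ∷ _) = ⊥-elim (<⇒≱ (s≤s z≤n) (subst₂ _≤_ (bump-at (suc r) (lens [])) (bump-other {suc r} {r} (lens []) (1+n≢n ∘ sym)) (a r)))
    positive {r} {r' ∷ R} (a ∷ s) = ins-pos r (letter (r' ∷ R)) (tab (r' ∷ R)) (fits {r} {r' ∷ R} a) (positive s)

  private
    new? : ∀ T r k c → Dec (k ≡ r × c ≡ rowLen T r)
    new? T r k c with k ≟ r | c ≟ rowLen T r
    ... | yes p | yes q = yes (p , q)
    ... | no p | _ = no (p ∘ proj₁)
    ... | yes _ | no q = no (q ∘ proj₂)

    just-inj : ∀ {a b : ℕ} → just a ≡ just b → a ≡ b
    just-inj refl = refl

  tab-rows : ∀ {R} → Standard R → ∀ k c a b → entry (tab R) k c ≡ just a → entry (tab R) k (suc c) ≡ just b → a < b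
  tab-rows [] zero c a b e e' = ascending (λ x → x) (λ _ → ≤-refl) m₀ c e e'
    where
    ascending : ∀ (f : ℕ → ℕ) → (∀ j → f j < f (suc j)) → ∀ k c {a b} →
      at (map suc (applyUpTo f k)) c ≡ just a → at (map suc (applyUpTo f k)) (suc c) ≡ just b → a < b
    ascending f h (suc (suc k)) zero refl refl = s≤s (h 0)
    ascending f h (suc k) (suc c) e e' = ascending (f ∘ suc) (h ∘ suc) k c e e'
  tab-rows {r ∷ R} (_ ∷ s) k c a b e e' with new? (tab R) r k (suc c)
  ... | yes (refl , q) = subst (a <_) (just-inj (trans (sym (entry-new r (letter R) (tab R))) (trans (cong (entry (tab (r ∷ R)) r) (sym q)) e')))
          (entry-below-letter R (entry-∈ (tab R) {k} {c} (trans (sym (entry-old r (letter R) (tab R) {k} {c} λ (_ , q') → 1+n≢n (trans q (sym q')))) e)))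
  ... | no ne with trans (sym (entry-old r (letter R) (tab R) {k} {suc c} ne)) e' | new? (tab R) r k c
  ...   | old' | yes (refl , q) = ⊥-elim (<⇒≱ (entry-< (tab R) {k} old') (≤-trans (≤-reflexive (sym q)) (n≤1+n c)))
  ...   | old' | no ne' = tab-rows s k c a b (trans (sym (entry-old r (letter R) (tab R) {k} {c} ne')) e) old'

  tab-cols : ∀ {R} → Standard R → ∀ k c a b → entry (tab R) k c ≡ just a → entry (tab R) (suc k) c ≡ just b → a < b
  tab-cols {r ∷ R} (_ ∷ s) k c a b e e' with new? (tab R) r (suc k) c
  ... | yes (refl , q) = subst (a <_) (just-inj (trans (sym (entry-new r (letter R) (tab R))) (trans (cong (entry (tab (r ∷ R)) r) (sym q)) e')))
          (entry-below-letter R (entry-∈ (tab R) {k} {c} (trans (sym (entry-old r (letter R) (tab R) {k} {c} λ (p , _) → 1+n≢n (sym p))) e)))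
  ... | no ne with trans (sym (entry-old r (letter R) (tab R) {suc k} {c} ne)) e' | new? (tab R) r k c
  ...   | old' | yes (refl , q) = ⊥-elim (<⇒≱ (entry-< (tab R) {suc k} old') (≤-trans (rowLen-anti s k) (≤-reflexive (sym q))))
  ...   | old' | no ne' = tab-cols s k c a b (trans (sym (entry-old r (letter R) (tab R) {k} {c} ne')) e) old'

  tab-SYT : ∀ {R} → Standard R → IsSYT (map length (tab R)) (tab R)
  tab-SYT {R} s = refl , tab-rows s , tab-cols s , ↭-trans (tab-word R) (↭-reflexive (cong letters (sym (tab-sum R))))

  data Located (T : Tab) : List ℕ → Set where
    []  : Located T []
    _∷_ : ∀ {r R} → ∃[ c ] entry T r c ≡ just (letter R) → Located T R → Located T (r ∷ R)

  located-ins : ∀ {r x T R} → Located T R → Located (insRow r x T) R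
  located-ins [] = []
  located-ins {r} {x} {T} (_∷_ {r = k} (c , e) l) =
    (c , trans (entry-old r x T {k} {c} λ { (refl , q) → <⇒≢ (entry-< T {k} e) q }) e) ∷ located-ins l

  tab-located : ∀ R → Located (tab R) R
  tab-located [] = []
  tab-located (r ∷ R) = (rowLen (tab R) r , entry-new r (letter R) (tab R)) ∷ located-ins (tab-located R)

  located-unique : ∀ {T R R'} → Unique (readingWord T) → Located T R → Located T R' → length R ≡ length R' → R ≡ R'
  located-unique U [] [] _ = refl
  located-unique {T} U (_∷_ {r = r} {R} (c , e) l) (_∷_ {r = r'} {R'} (c' , e') l') q with located-unique U l l' (suc-injective q)
  ... | refl = cong (_∷ R) (proj₁ (same-cell T {r} {c} {r'} {c'} U e e'))

  tab-injective : ∀ {R R'} → length R ≡ length R' → tab R ≡ tab R' → R ≡ R'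
  tab-injective {R} {R'} l e = located-unique (unique-letters (tab-word R)) (tab-located R) (subst (λ T → Located T R') (sym e) (tab-located R')) l

  swap-top : ∀ {a b R} → a ≢ b → map (map (swapV (letter R) (suc (letter R)))) (tab (a ∷ b ∷ R)) ≡ tab (b ∷ a ∷ R)
  swap-top {a} {b} {R} ne = trans (ins-map σ a (letter (b ∷ R)) (tab (b ∷ R)))
    (trans (cong₂ (insRow a) (trans (cong σ (next {b})) (swap-eqʳ p (suc p)))
       (trans (ins-map σ b p (tab R)) (cong₂ (insRow b) (trans (swap-eqˡ p (suc p)) (sym (next {a}))) stable)))
    (ins-comm p (letter (a ∷ R)) (tab R) ne))
    where
    p = letter R
    σ = swapV p (suc p)
    next : ∀ {r} → letter (r ∷ R) ≡ suc p
    next = +-suc (suc m₀) (length R)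
    stable : map (map σ) (tab R) ≡ tab R
    stable = map-local (tab R) λ m → let l = entry-below-letter R m in swap-other (<⇒≢ l) (<⇒≢ (≤-trans l (n≤1+n p)))

  swap-under : ∀ {p R R'} S → length R ≡ length R' → suc p < letter R →
    map (map (swapV p (suc p))) (tab R) ≡ tab R' → map (map (swapV p (suc p))) (tab (S ++ R)) ≡ tab (S ++ R')
  swap-under [] l q e = e
  swap-under {p} {R} {R'} (s ∷ S) l q e = trans (ins-map _ s (letter (S ++ R)) (tab (S ++ R)))
    (cong₂ (insRow s) (trans (swap-other (λ r → <⇒≢ (≤-trans (n≤1+n _) big) (sym r)) (λ r → <⇒≢ big (sym r)))
                             (cong (suc m₀ +_) (trans (length-++ S) (trans (cong (length S +_) l) (sym (length-++ S))))))
       (swap-under S l q e))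
    where
    big : suc p < letter (S ++ R)
    big = ≤-trans q (+-monoʳ-≤ (suc m₀) (≤-trans (m≤n+m (length R) (length S)) (≤-reflexive (sym (length-++ S)))))

  located-suffix : ∀ {T R} S → Located T (S ++ R) → Located T R
  located-suffix [] l = l
  located-suffix (_ ∷ S) (_ ∷ l) = located-suffix S l

  valid-suffix : ∀ S {w} → Valid (S ++ w) → Valid w
  valid-suffix [] v = v
  valid-suffix (_ ∷ S) (_ ∷ v) = valid-suffix S v

  rows-prefix : ∀ S S' {w w' R R'} → length S ≡ length S' → Rows (S ++ w) (S' ++ R) → Rows w' R' → lens R ≗ lens R' →
    Rows (S ++ w') (S' ++ R')
  rows-prefix [] [] _ _ rs' _ = rs'
  rows-prefix (c ∷ S) (r ∷ S') {R = R} {R'} q (e ∷ rs) rs' h =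
    trans (cong (n +_) (sym (agree' S' r))) e ∷ rows-prefix S S' (suc-injective q) rs rs' h
    where
    agree' : ∀ S' → lens (S' ++ R) ≗ lens (S' ++ R')
    agree' [] k = h k
    agree' (s ∷ S') k with k ≡ᵇ s
    ... | true  = cong suc (agree' S' k)
    ... | false = agree' S' k

  lens-swap : ∀ a b R → lens (a ∷ b ∷ R) ≗ lens (b ∷ a ∷ R)
  lens-swap a b R k with k ≡ᵇ a | k ≡ᵇ b
  ... | true  | true  = refl
  ... | true  | false = refl
  ... | false | true  = refl
  ... | false | false = refl

  lens-cons : ∀ {a R R'} → lens R ≗ lens R' → lens (a ∷ R) ≗ lens (a ∷ R')
  lens-cons {a} h k with k ≡ᵇ a
  ... | true  = cong suc (h k)
  ... | false = h k

  record Split (t : ℕ) (w R : List ℕ) : Set where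
    field
      {S SR u R'}         : List ℕ
      {z y x rz ry rx}    : ℕ
      w≡  : w ≡ S ++ z ∷ y ∷ x ∷ u
      R≡  : R ≡ SR ++ rz ∷ ry ∷ rx ∷ R'
      lS  : length S ≡ t
      lSR : length SR ≡ t
      rows : Rows (z ∷ y ∷ x ∷ u) (rz ∷ ry ∷ rx ∷ R')

  split-rows : ∀ t {w R} → Rows w R → t + 3 ≤ length w → Split t w R
  split-rows zero rs@(_ ∷ (_ ∷ (_ ∷ _))) _ = record { S = [] ; SR = [] ; w≡ = refl ; R≡ = refl ; lS = refl ; lSR = refl ; rows = rs }
  split-rows zero (_ ∷ []) (s≤s ())
  split-rows zero (_ ∷ (_ ∷ [])) (s≤s (s≤s ()))
  split-rows (suc t) {c ∷ w} {r ∷ R} (_ ∷ rs) (s≤s l) = record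
    { S = c ∷ S ; SR = r ∷ SR ; w≡ = cong (c ∷_) w≡ ; R≡ = cong (r ∷_) R≡ ; lS = cong suc lS ; lSR = cong suc lSR ; rows = rows }
    where open Split (split-rows t rs l)

  module Positions {R} (std : Standard R) (part : IsPartition (map length (tab R))) where
    private
      T = tab R
      W = readingWord T
      module Y = SYT part (tab-SYT std)

    pos-right : ∀ {a b ra rb ca cb} → entry T ra ca ≡ just a → entry T rb cb ≡ just b → a < b → rb ≤ ra → pos a W < pos b W
    pos-right {a} {b} {ra} {rb} {ca} {cb} e e' l q = cell-order T {ra} {ca} {_} {rb} {cb} Y.uniq e e' (before' (m≤n⇒m<n∨m≡n q))
      where
      before' : rb < ra ⊎ rb ≡ ra → CellBefore ra ca rb cb
      before' (inj₁ p) = inj₁ p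
      before' (inj₂ refl) with <-cmp ca cb
      ... | tri< p _ _ = inj₂ (refl , p)
      ... | tri≈ _ refl _ = ⊥-elim (<-irrefl (just-inj (trans (sym e) e')) l)
      ... | tri> _ _ p = ⊥-elim (<-asym l (Y.row-mono {ra} e' e p))

    pos-left : ∀ {a b ra rb ca cb} → entry T ra ca ≡ just a → entry T rb cb ≡ just b → ra < rb → pos b W < pos a W
    pos-left {ra = ra} {rb} {ca} {cb} e e' q = cell-order T {rb} {cb} {_} {ra} {ca} Y.uniq e' e (inj₁ q)

    Ordered : ℕ → ℕ → ℕ → ℕ → Set
    Ordered c c' a b = (c < c' → pos a W < pos b W) × (c' < c → pos b W < pos a W)

    ordered : ∀ {l ca ra cb rb a b} d → Anti l → n + l ra ≡ suc (d + ca) + ra → n + l rb ≡ cb + rb → (ca < cb → d + ca < cb) →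
      ∃[ k ] entry T ra k ≡ just a → ∃[ k ] entry T rb k ≡ just b → a < b → Ordered ca cb a b
    ordered {l} {ca} {ra} {cb} {rb} d al e e' up (ka , ea) (kb , eb) a<b =
      (λ q → pos-right {ra = ra} {rb} ea eb a<b (later-right {l} {ca} {ra} {cb} {rb} d al e e' (up q))) ,
      (λ q → pos-left {ra = ra} {rb} ea eb (later-left {l} {ca} {ra} {cb} {rb} d al e e' q))

    ordered-far : ∀ {x y z rx ry rz Q a b} → y ≢ z → Anti (lens (ry ∷ rx ∷ Q)) →
      n + lens Q rx ≡ x + rx → n + lens (rx ∷ Q) ry ≡ y + ry → n + lens (ry ∷ rx ∷ Q) rz ≡ z + rz →
      ∃[ k ] entry T rx k ≡ just a → ∃[ k ] entry T rz k ≡ just b → a < b → Ordered x z a b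
    ordered-far {x} {y} {z} {rx} {ry} {rz} {Q} y≢z a₂ ex ey ez lx lz a<b with rx ≟ ry
    ... | no ne = ordered {lens (ry ∷ rx ∷ Q)} {x} {rx} {z} {rz} 0 a₂
                    (trans (cong (n +_) (bump-other (lens (rx ∷ Q)) ne)) (grown {R = Q} ex)) ez (λ q → q) lx lz a<b
    -- Here `y` follows `x` in the same row, so `y = x + 1` and the row has one further cell. From
    -- `x < z` and `y ≢ z` it follows that `x + 1 < z`.
    ... | yes refl = ordered {lens (rx ∷ rx ∷ Q)} {x} {rx} {z} {rz} 1 a₂ (grown {R = rx ∷ Q} (grown {R = Q} ex)) ez
                       (λ q → ≤∧≢⇒< q (λ e → y≢z (trans (+-cancelʳ-≡ rx y (suc x) (trans (sym ey) (grown {R = Q} ex))) e))) lx lz a<b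

    btw-pos : ∀ {x y z a b c} → Ordered x y a b → Ordered y z b c → Btw x y z → Btw (pos a W) (pos b W) (pos c W)
    btw-pos o o' (inj₁ (p , q)) = inj₁ (proj₁ o p , proj₁ o' q)
    btw-pos o o' (inj₂ (p , q)) = inj₂ (proj₂ o' p , proj₂ o q)

    ordered-sym : ∀ {x y a b} → Ordered x y a b → Ordered y x b a
    ordered-sym (p , q) = q , p

  -- Three consecutive letters have distinct contents, and for them content order is reading order,
  -- so both operations fall into the same case; an exchange of letters swaps two neighbouring
  -- entries of `R`. The last equation says that the largest letter is `i + t + 1`.
  dTab-dd : ∀ {w R} t i → Valid w → Rows w R → IsPartition (map length (tab R)) → t + 3 ≤ length w → i + suc t ≡ m₀ + length w →
    ∃[ R₂ ] Rows (dd t w) R₂ × dTab i (tab R) ≡ tab R₂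
  dTab-dd {w} {R} t i v rs part l count = subst (λ i → ∃[ R₂ ] Rows (dd t w) R₂ × dTab i (tab R) ≡ tab R₂) (sym index) (result suffix loc (valid-tri vw))
    where
    open Split (split-rows t rs l) renaming (rows to suffix)
    vw : Valid (z ∷ y ∷ x ∷ u)
    vw = valid-suffix S (subst Valid w≡ v)
    p : ℕ
    p = letter R'
    T : Tab
    T = tab R
    W : List ℕ
    W = readingWord T
    open Positions (rows-standard v rs) part
    loc : Located T (rz ∷ ry ∷ rx ∷ R')
    loc = located-suffix SR (subst (Located T) R≡ (tab-located R))

    index : i ≡ suc p
    index = +-cancelʳ-≡ (suc t) i (suc p) (trans count (trans (cong (m₀ +_) len) (trans (sym (+-assoc m₀ (3 + length R') t)) (trans (cong (_+ t) (+-suc m₀ (2 + length R'))) (trans (cong (λ k → suc k + t) (+-suc m₀ (suc (length R')))) (trans (cong (λ k → suc (suc k) + t) (+-suc m₀ (length R'))) (sym (+-suc (suc p) t))))))))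
      where
      len : length w ≡ 3 + length R' + t
      len = trans (cong length w≡) (trans (length-++ S) (trans (cong₂ _+_ lS (cong (3 +_) (suc-injective (suc-injective (suc-injective (sym (length-rows suffix))))))) (+-comm t _)))

    dd-w : dd t w ≡ S ++ dd₃ z y x u
    dd-w = trans (cong₂ dd (sym lS) w≡) (dd-prefix S (z ∷ y ∷ x ∷ u))

    replace : ∀ {w' R''} → dd₃ z y x u ≡ w' → Rows w' R'' → lens (rz ∷ ry ∷ rx ∷ R') ≗ lens R'' → Rows (dd t w) (SR ++ R'')
    replace {w'} {R''} q rs' h = subst (λ k → Rows k (SR ++ R'')) (sym (trans dd-w (cong (S ++_) q)))
      (rows-prefix S SR (trans lS (sym lSR)) (subst₂ Rows w≡ R≡ rs) rs' h)

    letter₂ : letter (rx ∷ R') ≡ suc p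
    letter₂ = +-suc (suc m₀) (length R')

    letter₃ : letter (ry ∷ rx ∷ R') ≡ suc p + 1
    letter₃ = trans (+-suc (suc m₀) (suc (length R'))) (trans (cong suc letter₂) (+-comm 1 (suc p)))

    X Y Z : ℕ
    X = pos p W
    Y = pos (suc p) W
    Z = pos (suc p + 1) W

    result : Rows (z ∷ y ∷ x ∷ u) (rz ∷ ry ∷ rx ∷ R') → Located T (rz ∷ ry ∷ rx ∷ R') → Btw x y z ⊎ Btw y x z ⊎ Btw x z y →
      ∃[ R₂ ] Rows (dd t w) R₂ × dTab (suc p) T ≡ tab R₂
    result rs'@(ez ∷ rs₂@(ey ∷ rs₁@(ex ∷ rs₀))) ((kz , lz) ∷ ((ky , ly) ∷ (lx ∷ _))) = cases
      where
      V₁ : Valid (x ∷ u)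
      V₁ = tailV (tailV vw)
      a₁ : Anti (lens (rx ∷ R'))
      a₁ = Good.decr (rows-good V₁ rs₁)
      a₂ : Anti (lens (ry ∷ rx ∷ R'))
      a₂ = Good.decr (rows-good (tailV vw) rs₂)
      ly' : ∃[ k ] entry T ry k ≡ just (suc p)
      ly' = ky , trans ly (cong just letter₂)
      lz' : ∃[ k ] entry T rz k ≡ just (suc p + 1)
      lz' = kz , trans lz (cong just letter₃)
      oxy : Ordered x y p (suc p)
      oxy = ordered {lens (rx ∷ R')} {x} {rx} {y} {ry} 0 a₁ (grown {R = R'} ex) ey (λ q → q) lx ly' ≤-refl
      oyz : Ordered y z (suc p) (suc p + 1)
      oyz = ordered {lens (ry ∷ rx ∷ R')} {y} {ry} {z} {rz} 0 a₂ (grown {R = rx ∷ R'} ey) ez (λ q → q) ly' lz' (m<m+n (suc p) (s≤s z≤n))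
      oxz : Ordered x z p (suc p + 1)
      oxz = ordered-far {Q = R'} (proj₁ (proj₂ (distinct vw))) a₂ ex ey ez lx lz' (≤-trans (n≤1+n (suc p)) (≤-reflexive (+-comm 1 (suc p))))
      cases : Btw x y z ⊎ Btw y x z ⊎ Btw x z y → ∃[ R₂ ] Rows (dd t w) R₂ × dTab (suc p) T ≡ tab R₂
      cases (inj₁ b) = SR ++ rz ∷ ry ∷ rx ∷ R' , replace (dd-y u b) rs' (λ _ → refl) ,
        trans (map-map-id (λ k → dsel-fixed (suc p) {X} {Y} {Z} k (btw-true (btw-pos oxy oyz b))) T) (cong tab R≡)
      cases (inj₂ (inj₁ b)) = SR ++ ry ∷ rz ∷ rx ∷ R' , replace (dd-x u b) (rows-swap rs' (proj₁ (proj₂ (btw-apart b)))) (lens-swap rz ry (rx ∷ R')) ,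
        trans (map-cong (map-cong λ k → trans (dsel-upper (suc p) {X} {Y} {Z} k (btw-excl bp) (btw-true bp)) (cong₂ (λ a b → swapV a b k) (sym letter₂) (trans (+-comm (suc p) 1) (cong suc (sym letter₂))))) T)
        (trans (cong (map (map (swapV q (suc q)))) (cong tab R≡))
        (swap-under SR refl (≤-reflexive (sym (trans (letter-suc rz (ry ∷ rx ∷ R')) (cong suc (letter-suc ry (rx ∷ R'))))))
          (swap-top {rz} {ry} {rx ∷ R'} (rows-≢ rs' (proj₁ (proj₂ (btw-apart b)))))))
        where
        q = letter (rx ∷ R')
        bp : Btw Y X Z
        bp = btw-pos (ordered-sym oxy) oxz b
      cases (inj₂ (inj₂ b)) = SR ++ rz ∷ rx ∷ ry ∷ R' , replace (dd-z u b)
          (trans (cong (n +_) (sym (lens-swap ry rx R' rz))) ez ∷ rows-swap rs₂ (proj₁ (proj₂ (btw-apart b)))) (lens-cons {rz} {ry ∷ rx ∷ R'} {rx ∷ ry ∷ R'} (lens-swap ry rx R')) ,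
        trans (map-cong (map-cong λ k → dsel-lower (suc p) {X} {Y} {Z} k (btw-excl₃ {X} {Z} {Y} bp) (btw-excl₃ {Y} {Z} {X} (btw-sym bp))) T)
        (trans (cong (map (map (swapV p (suc p)))) (cong tab R≡))
        (swap-under {p} {rz ∷ ry ∷ rx ∷ R'} {rz ∷ rx ∷ ry ∷ R'} SR refl (≤-trans two (≤-trans (n≤1+n _) (≤-reflexive (sym (letter-suc rz (ry ∷ rx ∷ R'))))))
          (swap-under {p} {ry ∷ rx ∷ R'} {rx ∷ ry ∷ R'} (rz ∷ []) refl two
            (swap-top {ry} {rx} {R'} (rows-≢ rs₂ (proj₁ (proj₂ (btw-apart b))))))))
        where
        two : suc p < letter (ry ∷ rx ∷ R')
        two = ≤-reflexive (sym (trans (letter-suc ry (rx ∷ R')) (cong suc (letter-suc rx R'))))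
        bp : Btw X Z Y
        bp = btw-pos oxz (ordered-sym oyz) b

-- The two implications

compIso-restrict : ∀ (G : SCG) {C D : ℕ → Set} {v₀} → (∀ {j} → D j → C j) → CompIso G C v₀ → CompIso G D v₀
compIso-restrict G {C} {D} {v₀} sub (sizes , T₀ , part , syt , f , g , F , K , E) =
  sizes , f v₀ , part , gconn-SYT syt (proj₁ (F v₀ ε)) , f , g ,
  (λ v c → forward ε c , proj₂ (F v (grow c))) ,
  (λ T c → backward refl ε c) ,
  (λ j v w d c c' → E j v w (sub d) (grow c) (grow c'))
  where
  grow : ∀ {v w} → Conn G D v w → Conn G C v w
  grow ε = ε
  grow ((j , d , e) ◅ p) = (j , sub d , e) ◅ grow p
  forward : ∀ {a v} → Conn G C v₀ a → Conn G D a v → GConn sizes D (f a) (f v)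
  forward c ε = ε
  forward {a} c (_◅_ {j = x} (j , d , e) p) =
    (j , d , Equivalence.to (E j a x (sub d) c c') e) ◅ forward c' p
    where
    c' = c ◅◅ ((j , sub d , e) ◅ ε)
  backward : ∀ {a U T} → f a ≡ U → Conn G C v₀ a → GConn sizes D U T → Conn G D a (g T) × f (g T) ≡ T
  backward {a} refl c ε = subst (Conn G D a) (sym (proj₂ (F a c))) ε , cong f (proj₂ (F a c))
  backward {a} refl c (_◅_ {j = U} (j , d , e) p) =
    let cU , eU = K U (proj₁ (F a c) ◅◅ ((j , sub d , e) ◅ ε))
        r , q = backward {g U} eU cU p
    in (j , d , Equivalence.from (E j a (g U) (sub d) c cU) (subst (GEdge sizes j (f a)) (sym eU) e)) ◅ r , q

module Main (G : SCG) (ax1 : Ax1 G) (ax2 : Ax2 G) (ax3 : Ax3 G) (ax5 : Ax5 G) where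
  open SCG G
  open Vert G ax1
  open Words n
  open Covers G ax1 ax2 ax3 ax5
  open Injectivity G ax1 ax2 ax3 ax5 using (Link; link-inj; module Closing)
  open Windows G ax1 ax2 ax3 ax5 using (module TopMove)

  colors : ∀ {I s t} → m + s ≤ I → t + 3 ≤ 2 + s → I < n → InR (I ∸ t) × (I ≤ (I ∸ t) + t) × (I ∸ t ≤ I)
  colors {I} {s} {t} b l I<n =
    (m+n≤o⇒m≤o∸n (suc m) (≤-trans (≤-reflexive (sym (+-suc m t))) (≤-trans (+-monoʳ-≤ m (≤-pred (≤-pred (subst (_≤ 2 + s) (+-comm t 3) l)))) b)) ,
     ≤-trans (s≤s (m∸n≤m I t)) I<n) ,
    ≤-trans (m≤n+m∸n I t) (≤-reflexive (+-comm t (I ∸ t))) , m∸n≤m I t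

  room-below : ∀ {I s} → m + s ≤ I → 2 + s ≤ suc I
  room-below b = s≤s (≤-trans (+-monoˡ-≤ _ m-pos) b)

  module FromAx4 (ax4 : Ax4 G) where

    -- A window of `2 + s` letters carries `s` colours. Axiom 4 supplies at most three of them, and
    -- `m + s ≤ I` keeps them all above `m`.
    sims : ∀ {I} s → 1 ≤ s → s ≤ 3 → suc m < I → m + s ≤ I → I < n → ∀ v → Sim G ax1 I (2 + s) v
    sims {I} s 1≤s s≤3 m<I b I<n v = local-sim G ax1 ax3 {C = Cols4 G I} {I} {2 + s} {v} (s≤s (s≤s 1≤s)) (room-below b)
      (λ t l → let r , lo , hi = colors b l I<n in r , proj₁ r , ≤-trans lo (+-monoʳ-≤ (I ∸ t) (t≤2 l)) , hi) (ax4 I m<I I<n v)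
      where
      t≤2 : ∀ {t} → t + 3 ≤ 2 + s → t ≤ 2
      t≤2 {t} l = +-cancelʳ-≤ 3 t 2 (≤-trans l (s≤s (s≤s s≤3)))

    double : ∀ {i} → m < i → suc i < n → Double (suc i)
    double m<i I<n = sim-double G ax1 (sims 2 (s≤s z≤n) (s≤s (s≤s z≤n)) (s≤s m<i) (≤-trans (≤-reflexive (+-comm m 2)) (s≤s m<i)) I<n)

    square : ∀ {i} → suc m < i → suc i < n → Square (suc i)
    square m<i I<n = sim-square G ax1 (sims 3 (s≤s z≤n) ≤-refl (s≤s (<⇒≤ m<i)) (≤-trans (≤-reflexive (+-comm m 3)) (s≤s m<i)) I<n)

  loop-sim : Ax4⁺ G → ∀ {i} → suc (suc m) < i → suc i < n → ∀ v → Sim G ax1 (suc i) 6 v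
  loop-sim ax4⁺ {i} m<i I<n v = local-sim G ax1 ax3 {C = Cols4⁺ G (suc i)} {suc i} {6} {v} (s≤s (s≤s (s≤s z≤n))) (room-below b)
      (λ t l → let r , lo , hi = colors b l I<n in r , proj₁ r , ≤-trans lo (+-monoʳ-≤ (suc i ∸ t) (+-cancelʳ-≤ 3 t 3 l)) , hi)
      (ax4⁺ (suc i) (s≤s (≤-trans (n≤1+n _) (<⇒≤ m<i))) I<n v)
    where
    b : m + 4 ≤ suc i
    b = ≤-trans (≤-reflexive (+-comm m 4)) (s≤s m<i)

  record Level (i : ℕ) : Set where
    field
      cover : PreCover i
      top   : Top cover
      inj   : Inj cover i

  -- There are no colours up to `m`, so components are single vertices. The letters `m` and `m + 1`
  -- form a row or a column according to the sign at `m`; the first cell has the shifted content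
  -- `n`.
  base : Level m
  base = record
    { cover = record
      { φ = λ v → word (σ v m)
      ; len = λ v → trans (len (σ v m)) (cong (2 +_) (sym (n∸n≡0 m)))
      ; valid = λ v → valid (σ v m)
      ; sign = λ { zero v _ → sign (σ v m) ; (suc t) v l → ⊥-elim (n≮0 (subst (suc t ≤_) (n∸n≡0 m) l)) }
      ; move = λ t v → trans (cong (λ a → word (σ a m)) (still (suc t) v)) (sym (short (suc t) (σ v m))) }
    ; top = λ v → trans (cong (λ a → word (σ a m)) (still 0 v)) (sym (short 0 (σ v m)))
    ; inj = λ v w c _ → alone c }
    where
    word : Sgn → List ℕ
    word plus  = suc n ∷ n ∷ []
    word minus = (n ∸ 1) ∷ n ∷ []
    len : ∀ s → length (word s) ≡ 2
    len plus = refl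
    len minus = refl
    first : Add n (sh [])
    first = sh-left [] n (≤-reflexive (+-identityʳ n)) , sh-right [] (suc n) (s≤s (≤-reflexive (+-identityʳ n)))
    n-1 : suc (n ∸ 1) ≡ n
    n-1 = m+[n∸m]≡n n-pos
    valid : ∀ s → Valid (word s)
    valid plus = (addc-suc n (sh []) , trans (addc-other (sh []) (λ e → <⇒≢ (≤-trans (n<1+n n) (n≤1+n _)) (sym e)) 1+n≢n)
                   (sh-right [] (suc (suc n)) (s≤s (≤-trans (≤-reflexive (+-identityʳ n)) (n≤1+n n))))) ∷ (first ∷ [])
    valid minus = (trans (addc-other (sh []) (<⇒≢ (≤-reflexive n-1)) (<⇒≢ (≤-trans (≤-reflexive n-1) (n≤1+n n))))
                     (sh-left [] (n ∸ 1) (≤-trans (≤-reflexive (+-identityʳ (n ∸ 1))) (m∸n≤m n 1))) ,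
                   subst (λ k → addc n (sh []) k ≡ false) (sym n-1) (addc-at n (sh []))) ∷ (first ∷ [])
    sign : ∀ s → s ≡ signAt 0 (word s)
    sign plus = sym (sgn-plus (n<1+n n))
    sign minus = sym (sgn-minus (m∸n≤m n 1))
    still : ∀ t v → nb (m ∸ t) v ≡ v
    still t v = nb-out λ r → <⇒≱ (proj₁ r) (m∸n≤m m t)
    short : ∀ t s → dd t (word s) ≡ word s
    short zero plus = refl
    short zero minus = refl
    short (suc zero) plus = refl
    short (suc zero) minus = refl
    short (suc (suc zero)) plus = refl
    short (suc (suc zero)) minus = refl
    short (suc (suc (suc t))) plus = refl
    short (suc (suc (suc t))) minus = refl
    alone : ∀ {v w} → Comp m v w → v ≡ w
    alone ε = refl
    alone ((j , (l , l') , _) ◅ _) = ⊥-elim (<⇒≱ l l')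

  module Build (ax4 : Ax4 G)
               (link : ∀ {i} (c : PreCover (suc i)) → m ≤ i → suc i < n → Inj c i → Link (suc i)) where
    open FromAx4 ax4

    next : ∀ {i} → m ≤ i → suc i < n → Level i → Level (suc i)
    next {i} m≤i I<n l = record
      { cover = X.extension
      ; top = TopMove.top-move X.extension m≤i I<n (λ q → double q I<n) (λ q → square q I<n)
      ; inj = link-inj X.extension m≤i I<n (λ q → double q I<n) (λ q → square q I<n) X.extension-inj
                (link X.extension m≤i I<n X.extension-inj) }
      where
      open Level l
      module X = Extend cover top inj m≤i I<n

    level : ∀ i → m ≤ i → i < n → Level i
    level i m≤i i<n with m≤n⇒m<n∨m≡n m≤i
    ... | inj₂ refl = base
    level (suc i) m≤i i<n | inj₁ (s≤s m≤i') = next m≤i' i<n (level i m≤i' (<-trans (n<1+n i) i<n))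

  module Forward (ax4⁺ : Ax4⁺ G) where

    ax4 : Ax4 G
    ax4 i p q v = compIso-restrict G (λ (a , b , c) → a , ≤-trans b (+-monoʳ-≤ _ (n≤1+n 2)) , c) (ax4⁺ i p q v)

    open FromAx4 ax4

    link : ∀ {i} (c : PreCover (suc i)) → m ≤ i → suc i < n → Inj c i → Link (suc i)
    link c m≤i I<n inj = Closing.link c m≤i I<n (λ q → double q I<n) (λ q → square q I<n) inj (λ q → loop-sim ax4⁺ q I<n)

    open Build ax4 link

    ax6 : Ax6 G
    ax6 (suc i) (s≤s m≤i , I<n) = link X.extension m≤i I<n X.extension-inj
      where
      open Level (level i m≤i (<-trans (n<1+n i) I<n))
      module X = Extend cover top inj m≤i I<n

  module Realize {K} (K+1 : suc K ≡ n) (m≤K : m ≤ K) (lev : Level K) (C : ℕ → Set) (v₀ : Fin size) where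
    open Level lev
    open PreCover cover hiding (Top)
    open Contents n
    open Tableaux n (m ∸ 1)

    private
      m₀ : ℕ
      m₀ = m ∸ 1

      m₀+1 : suc m₀ ≡ m
      m₀+1 = m+[n∸m]≡n m-pos

      rows : Fin size → List ℕ
      rows v = proj₁ (rows-exist (valid v))

      isRows : ∀ v → Rows (φ v) (rows v)
      isRows v = proj₂ (rows-exist (valid v))

      standard : ∀ v → Standard (rows v)
      standard v = rows-standard (valid v) (isRows v)

      length-rows-v : ∀ v → length (rows v) ≡ 2 + (K ∸ m)
      length-rows-v v = trans (length-rows (isRows v)) (len v)

      partition : ∀ v → IsPartition (map length (tab (rows v)))
      partition v = go (standard v) (length-rows-v v)
        where
        go : ∀ {R} → Standard R → length R ≡ 2 + (K ∸ m) → IsPartition (map length (tab R))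
        go s@(_ ∷ _) _ = tab-partition s

      f : Fin size → Tab
      f v = tab (rows v)

      total : ∀ v → m₀ + length (rows v) ≡ n
      total v = trans (cong (m₀ +_) (length-rows-v v)) (trans (+-suc m₀ (suc (K ∸ m)))
        (trans (cong suc (+-suc m₀ (K ∸ m))) (trans (cong (λ k → suc (k + (K ∸ m))) m₀+1) (trans (cong suc (m+[n∸m]≡n m≤K)) K+1))))

      upto-K : ∀ {j} → InR j → Upto K j
      upto-K (p , q) = p , ≤-pred (subst (_ <_) (sym K+1) q)

      f-move : ∀ {j} v → InR j → f (nb j v) ≡ dTab j (f v)
      f-move {j} v r with upto-K r
      ... | m<j , j≤K = trans (cong tab (rows-unique (valid (nb j v)) (isRows (nb j v))
              (subst (λ w → Rows w (proj₁ d)) (sym moved') (proj₁ (proj₂ d))))) (sym (proj₂ (proj₂ d)))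
        where
        t : ℕ
        t = K ∸ j
        moved' : φ (nb j v) ≡ dd t (φ v)
        moved' = trans (cong (λ k → φ (nb k v)) (sym (m∸[m∸n]≡n j≤K))) (moves top t v)
        d : ∃[ R₂ ] Rows (dd t (φ v)) R₂ × dTab j (f v) ≡ tab R₂
        d = dTab-dd t j (valid v) (isRows v) (partition v)
              (subst₂ _≤_ (+-comm 3 t) (sym (len v)) (s≤s (s≤s (∸-monoʳ-< m<j j≤K))))
              (trans (+-suc j t) (trans (cong suc (m+[n∸m]≡n j≤K)) (trans K+1 (trans (sym (total v)) (cong (m₀ +_) (length-rows (isRows v)))))))

      f-word : ∀ {u v} → f u ≡ f v → φ u ≡ φ v
      f-word {u} {v} e = contents-unique (isRows u) (subst (Rows (φ v)) (sym same-rows) (isRows v))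
        where
        same-rows : rows u ≡ rows v
        same-rows = tab-injective (trans (length-rows-v u) (sym (length-rows-v v))) e

      f-inj : ∀ {u v} → Comp K u v → f u ≡ f v → u ≡ v
      f-inj {u} {v} c e = inj u v c (f-word e)

      sizes : List ℕ
      sizes = map length (f v₀)

      sum-sizes : sum sizes ≡ n
      sum-sizes = trans (tab-sum (rows v₀)) (total v₀)

      dTab-sizes : ∀ j T → map length (dTab j T) ≡ map length T
      dTab-sizes j T = trans (sym (map-∘ T)) (map-cong (λ r → length-map _ r) T)

      sizes-conn : ∀ {v w} → Conn G C v w → map length (f v) ≡ map length (f w)
      sizes-conn ε = refl
      sizes-conn {v} (_◅_ {j = x} (j , _ , e) p) = trans
        (sym (trans (cong (map length) (trans (cong f (sym (edge-nb e))) (f-move v (edge-range {j} {v} {x} e)))) (dTab-sizes j (f v)))) (sizes-conn p)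

      syt : ∀ {v} → Conn G C v₀ v → IsSYT sizes (f v)
      syt {v} c = subst (λ s → IsSYT s (f v)) (sym (sizes-conn c)) (tab-SYT (standard v))

      comp : ∀ {v w} → Conn G C v w → Comp K v w
      comp = conn-mono (λ r _ → upto-K r)

      edge⇒ : ∀ {j v w} → C j → Conn G C v₀ v → Edge G j v w → GEdge sizes j (f v) (f w)
      edge⇒ {j} {v} {w} cj c e = inj₁ (≤-trans (s≤s m-pos) (proj₁ r) , subst (j <_) (sym sum-sizes) (proj₂ r) , syt c , syt (c ◅◅ ((j , cj , e) ◅ ε)) ,
        trans (cong f (sym (edge-nb e))) (f-move v r) ,
        λ q → true≢false (subst (λ x → Edge G j v x) (f-inj (conn-sym (comp {v} {w} ((j , cj , e) ◅ ε))) q) e) (E-irr j v))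
        where
        r : InR j
        r = edge-range {j} {v} {w} e

      gedge-move : ∀ {j v U} → C j → m < j → GEdge sizes j (f v) U → InR j × U ≡ f (nb j v) × U ≢ f v
      gedge-move {j} {v} cj m<j (inj₁ (_ , q , _ , _ , e , ne)) = r , trans e (sym (f-move v r)) , ne
        where
        r : InR j
        r = m<j , subst (j <_) sum-sizes q
      gedge-move {j} {v} {U} cj m<j (inj₂ (p , q , _ , _ , e , ne)) =
        r , trans (sym (dTab-invol j U (<⇒≤ p))) (trans (cong (dTab j) (sym e)) (sym (f-move v r))) , ne ∘ sym
        where
        r : InR j
        r = m<j , subst (j <_) sum-sizes q

      bound : ℕ
      bound = suc (n + (2 + (K ∸ m)))

      -- Both boundaries read `false` from `bound` on, so comparing finitely many steps decides
      -- equality of shapes.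
      SameShape : Fin size → Set
      SameShape u = ∀ {p} → p < bound → sh (φ v₀) p ≡ sh (φ u) p

      sameShape? : ∀ u → Dec (SameShape u)
      sameShape? u = allUpTo? (λ p → sh (φ v₀) p Bool.≟ sh (φ u) p) bound

      extend : ∀ u → SameShape u → sh (φ v₀) ≗ sh (φ u)
      extend u h p with p <? bound
      ... | yes l = h l
      ... | no ¬l = trans (outside v₀) (sym (outside u))
        where
        outside : ∀ v → sh (φ v) p ≡ false
        outside v = sh-right (valid v) p (subst (λ k → n + k < p) (sym (len v)) (≮⇒≥ ¬l))

      -- A vertex `u` carrying the sought tableau may lie in a different component from `v₀`.
      -- Equality of shapes provides moves from the word of `v₀` to that of `u`, and replaying them
      -- from `v₀` stays in its component.
      transport : ∀ u → Dec (SameShape u) → Fin size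
      transport u (yes h) = vrun K (proj₁ (same-shape-connected (φ v₀) (φ u) (valid v₀) (valid u) (trans (len v₀) (sym (len u))) (extend u h))) v₀
      transport u (no _)  = v₀

      locate : ∀ {T} → Dec (∃[ u ] f u ≡ T) → Fin size
      locate (yes (u , _)) = transport u (sameShape? u)
      locate (no _)        = v₀

      search : ∀ T → Dec (∃[ u ] f u ≡ T)
      search T = any? (λ u → ≡-dec (≡-dec _≟_) (f u) T)

      -- An arbitrary tableau is decoded by a search through the finite vertex set; `v₀` is a
      -- default value outside the image.
      g : Tab → Fin size
      g T = locate (search T)

      g-f : ∀ {v} → Comp K v₀ v → g (f v) ≡ v
      g-f {v} c = at-search (search (f v))
        where
        at-shape : ∀ u → f u ≡ f v → (d : Dec (SameShape u)) → transport u d ≡ v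
        at-shape u e (no ¬h) = ⊥-elim (¬h λ {p} _ → subst (λ w → sh (φ v₀) p ≡ sh w p) (sym (f-word e)) (cover-shape cover top c p))
        at-shape u e (yes h) = inj _ v (conn-sym (run-comp K (proj₁ path) v₀) ◅◅ c)
            (trans (φ-run top (proj₁ path) v₀) (trans (proj₂ path) (f-word e)))
          where
          path : ∃[ ts ] run ts (φ v₀) ≡ φ u
          path = same-shape-connected (φ v₀) (φ u) (valid v₀) (valid u) (trans (len v₀) (sym (len u))) (extend u h)
        at-search : (d : Dec (∃[ u ] f u ≡ f v)) → locate d ≡ v
        at-search (yes (u , e)) = at-shape u e (sameShape? u)
        at-search (no ¬u) = ⊥-elim (¬u (v , refl))

    compIso : (∀ {j} → C j → m < j) → CompIso G C v₀
    compIso low = sizes , f v₀ , partition v₀ , syt ε , f , g ,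
      (λ v c → forward ε c , g-f (comp c)) ,
      (λ T p → finish (backward refl ε p)) ,
      (λ j v w cj c c' → mk⇔ (edge⇒ cj c) (edge⇐ cj c c'))
      where
      forward : ∀ {a v} → Conn G C v₀ a → Conn G C a v → GConn sizes C (f a) (f v)
      forward c ε = ε
      forward {a} c (_◅_ {j = x} (j , cj , e) p) = (j , cj , edge⇒ {j} {a} {x} cj c e) ◅ forward (c ◅◅ ((j , cj , e) ◅ ε)) p
      backward : ∀ {a U T} → U ≡ f a → Conn G C v₀ a → GConn sizes C U T → ∃[ v ] Conn G C v₀ v × f v ≡ T
      backward {a} e c ε = a , c , sym e
      backward {a} refl c (_◅_ {j = U} (j , cj , e) p) with gedge-move {j} {a} {U} cj (low cj) e
      ... | r , eU , _ = backward {nb j a} eU (c ◅◅ nb-conn (λ _ → cj)) p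
      finish : ∀ {T} → ∃[ v ] Conn G C v₀ v × f v ≡ T → Conn G C v₀ (g T) × f (g T) ≡ T
      finish (v , c , refl) = subst (Conn G C v₀) (sym (g-f (comp c))) c , cong f (g-f (comp c))
      edge⇐ : ∀ {j v w} → C j → Conn G C v₀ v → Conn G C v₀ w → GEdge sizes j (f v) (f w) → Edge G j v w
      edge⇐ {j} {v} {w} cj c c' e with gedge-move {j} {v} {f w} cj (low cj) e
      ... | r , eq , ne = choose (nb-cases j v)
        where
        w≡ : nb j v ≡ w
        w≡ = sym (f-inj (comp (conn-sym c' ◅◅ (c ◅◅ nb-conn (λ _ → cj)))) eq)
        choose : (InR j × adm j v ≡ true × Edge G j v (nb j v)) ⊎ (nb j v ≡ v) → Edge G j v w
        choose (inj₁ (_ , _ , e')) = subst (Edge G j v) w≡ e'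
        choose (inj₂ q) = ⊥-elim (ne (trans eq (cong f q)))

  module Backward (ax4 : Ax4 G) (ax6 : Ax6 G) where
    open Build ax4 (λ {i} c m≤i I<n inj → ax6 (suc i) (s≤s m≤i , I<n))

    ax4⁺ : Ax4⁺ G
    ax4⁺ i m<i i<n v = Realize.compIso K+1 m≤K (level (n ∸ 1) m≤K (≤-reflexive K+1)) (Cols4⁺ G i) v proj₁
      where
      K+1 : suc (n ∸ 1) ≡ n
      K+1 = m+[n∸m]≡n n-pos
      m≤K : m ≤ n ∸ 1
      m≤K = ≤-pred (subst (suc m ≤_) (sym K+1) (<⇒≤ (<-trans m<i i<n)))

theorem3p17 : (G : SCG) →
    (Ax1 G × Ax2 G × Ax3 G × Ax4⁺ G × Ax5 G) ⇔ IsDEG G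
theorem3p17 G = mk⇔
  (λ (ax1 , ax2 , ax3 , ax4⁺ , ax5) → let open Main.Forward G ax1 ax2 ax3 ax5 ax4⁺ in
     ax1 , ax2 , ax3 , ax4 , ax5 , ax6)
  (λ (ax1 , ax2 , ax3 , ax4 , ax5 , ax6) → let open Main.Backward G ax1 ax2 ax3 ax5 ax4 ax6 in
     ax1 , ax2 , ax3 , ax4⁺ , ax5)
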